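{- The algorithm LetrecMatch is sound and complete for nominal letrec matching. It decides nominal letrec matching in nondeterministic polynomial time. Its collecting version returns a finite complete set of an at most exponential number of matching substitutions, which are of at most polynomial size.
   Context: **Ground language $LRL$.** Let $\mathbb{A}$ be an infinite set of atoms and $\mathcal{F}$ a set of function symbols $f$ with arity $ar(f)$. Expressions of $LRL$: $e ::= a \mid \lambda a.e \mid (f~e_1\ldots e_{ar(f)}) \mid (\mathtt{letrec}~a_1.e_1;\ldots;a_n.e_n~\mathtt{in}~e)$, with pairwise distinct binding atoms in a letrec; environments are multisets of bindings. The scope of $a$ in $\lambda a.e$ is $e$; the scope of each $a_i$ in the letrec is all of $e_1,\ldots,e_n,e$. $FA(e)$ is the set of free atoms; $a\#e$ means $a\notin FA(e)$. Permutations $\pi$ are finite permutations of $\mathbb{A}$ (lists of swappings $(a~b)$), $dom(\pi)=\{a\mid \pi(a)\ne a\}$; $\pi\cdot e$ applies $\pi$ to all atoms of $e$, including binders. $\alpha$-equivalence $\sim$: $a\sim a$; congruence for function symbols and for $\lambda a$; $\lambda a.e\sim\lambda b.e'$ if $a\#e'$ and $e\sim(a~b)\cdot e'$; and $(\mathtt{letrec}~a_1.s_1;\ldots;a_n.s_n~\mathtt{in}~r)\sim(\mathtt{letrec}~b_1.t_1;\ldots;b_n.t_n~\mathtt{in}~r')$ if (after possibly reordering bindings) there is a permutation $\pi$ with $dom(\pi)\subseteq\{a_i\}\cup\{b_i\}$, $\pi(b_i)=a_i$, $a_i\#(\mathtt{letrec}~b_1.t_1;\ldots;b_n.t_n~\mathtt{in}~r')$,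 $s_i\sim\pi\cdot t_i$ for all $i$, and $r\sim\pi\cdot r'$. **$LRLX$** extends $LRL$ by variables $X$ and suspensions $\pi\cdot X$. A substitution replaces variables (capture is allowed), and $(\pi\cdot X)\rho=\pi\cdot(X\rho)$. **Nominal letrec matching.** Input: a finite set $\Gamma=\{s_1\unlhd t_1,\ldots,s_n\unlhd t_n\}$ of match equations, where each $s_i$ is an $LRLX$-expression and each $t_i$ is a ground $LRL$-expression. A matching substitution (matcher) is a substitution $\sigma$ mapping the variables of $\Gamma$ to ground expressions with $s_i\sigma\sim t_i$ for all $i$. A set of matching substitutions is complete if every matching substitution agrees, up to $\sim$ on each variable of $\Gamma$, with some member of the set. The algorithm is sound if every substitution it outputs is a matcher, and complete if the set of outputs over all nondeterministic runs is complete. **Algorithm LetrecMatch.** It transforms $\Gamma$ using the following rules: - delete $e\unlhd e$; - replace $(f~s_1\ldots s_n)\unlhd(f~s_1'\ldots s_n')$ by $s_i\unlhd s_i'$ for all $i$; - replace $\lambda a.s\unlhd\lambda a.t$ by $s\unlhd t$; - if $a\#t$, replace $\lambda a.s\unlhd\lambda b.t$ (for different atoms $a,b$) by $s\unlhd(a~b)\cdot t$; - replace $\pi\cdot X\unlhd e$ by $X\unlhd\pi^{ -1}\cdot e$; - if $X\unlhd e_1$, $X\unlhd e_2$ are in $\Gamma$ and $e_1\sim e_2$, delete $X\unlhd e_2$; - if $a_i\#(\mathtt{letrec}~b_1.t_1;\ldots;b_n.t_n~\mathtt{in}~r')$ for all $i=1,\ldots,n$, replace $(\mathtt{letrec}~a_1.s_1;\ldots;a_n.s_n~\mathtt{in}~r)\unlhd(\mathtt{letrec}~b_1.t_1;\ldots;b_n.t_n~\mathtt{in}~r')$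 by $s_i\unlhd\pi\cdot t_{\rho(i)}$ ($i=1,\ldots,n$) and $r\unlhd\pi\cdot r'$, where $\rho$ is a don't-know nondeterministically chosen permutation of $\{1,\ldots,n\}$ and $\pi$ is a permutation of atoms extending $\{b_{\rho(i)}\mapsto a_i\mid i=1,\ldots,n\}$ with $dom(\pi)\subseteq\{a_1,\ldots,a_n,b_1,\ldots,b_n\}$. Failure rules: fail if $\Gamma$ contains such a letrec match equation for which some $a_i$ is not fresh for the right-hand side letrec; if $\Gamma$ contains $s\unlhd t$, where $s$ is not a suspension and the top symbols of $s$ and $t$ differ (top symbol of an atom: the atom itself; of $(f\ldots)$: $f$; of an abstraction: $\lambda$; of a letrec: $(\mathtt{letrec},n)$ with $n$ the number of bindings); if $\Gamma$ contains $\lambda a.s\unlhd\lambda b.t$ for different atoms $a,b$ and $a$ is not fresh for $t$; or if $\Gamma$ contains $X\unlhd e_1$, $X\unlhd e_2$ with $e_1\not\sim e_2$. The result is either failure or a substitution in the form $X_1\unlhd s_1,\ldots,X_n\unlhd s_n$. The collecting version is the deterministic algorithm that explores all choices of $\rho$ in the letrec rule and collects all resulting substitutions. -}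

module Defs where

open import Data.Empty using (⊥; ⊥-elim)
open import Data.Fin using (Fin; zero; suc)
open import Data.Fin.Permutation using (Permutation′; _⟨$⟩ʳ_) renaming (_≈_ to _≈ₚ_)
open import Data.List using (List; []; _∷_; _++_; length; map; reverse; concat)
open import Data.List.Membership.Propositional using (_∈_)
open import Data.List.Relation.Unary.All using (All)
open import Data.List.Relation.Unary.AllPairs using (AllPairs)
open import Data.List.Relation.Unary.Any using (Any)
open import Data.List.Relation.Unary.Unique.Propositional using (Unique)
open import Data.List.Relation.Binary.Permutation.Propositional using (_↭_)
open import Data.List.Relation.Binary.Pointwise using (Pointwise)
open import Data.Maybe using (Maybe; just; nothing; zipWith) renaming (map to mapMaybe)
open import Data.Nat using (ℕ; zero; suc; _+_; _*_; _^_; _≤_)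
open import Data.Product using (∃-syntax; _×_; _,_; proj₁)
open import Data.Sum using (_⊎_)
open import Data.Vec using (Vec; []; _∷_; lookup; tabulate; toList)
import Data.Vec as Vec
open import Data.Vec.Membership.Propositional using () renaming (_∈_ to _∈ᵥ_; _∉_ to _∉ᵥ_)
open import Data.Vec.Relation.Unary.Unique.Propositional using () renaming (Unique to Uniqueᵥ)
import Data.Vec.Relation.Unary.Unique.Propositional.Properties as Uniqueᵥ
open import Function using (_↣_; _⇔_)
open import Function.Bundles using (module Injection)
open import Relation.Binary using (Rel; DecidableEquality)
open import Relation.Binary.Construct.Closure.ReflexiveTransitive using (Star)
open import Relation.Binary.PropositionalEquality using (_≡_; _≢_; refl; sym; trans)
open import Relation.Nullary using (¬_; yes; no; contradiction)
open import Level using (0ℓ)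

-- Coefficients, constant term first.
Polynomial : Set
Polynomial = List ℕ

⟦_⟧ : Polynomial → ℕ → ℕ
⟦ [] ⟧     n = 0
⟦ c ∷ cs ⟧ n = c + n * ⟦ cs ⟧ n

-- Iter R n x y : y is reached from x by exactly n steps of R.
data Iter {A : Set} (R : Rel A 0ℓ) : ℕ → A → A → Set where
  stop : ∀ {x} → Iter R zero x x
  step : ∀ {n x y z} → R x y → Iter R n y z → Iter R (suc n) x z

------------------------------------------------------------------------
-- The model of computation: nondeterministic first-order programs with
-- general recursion over binary trees, run by an abstract machine at unit
-- cost per transition.  A transition only looks up a variable, allocates or
-- inspects one node, or pushes or pops one frame (trees are shared through
-- pointers, and there is no primitive test for equality of trees), so up to
-- a polynomial this is the time of a nondeterministic Turing machine.

data Tree : Set where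
  leaf : Tree
  _∙_  : Tree → Tree → Tree

infixr 5 _∙_

∣_∣ᵗ : Tree → ℕ
∣ leaf ∣ᵗ  = 1
∣ l ∙ r ∣ᵗ = suc (∣ l ∣ᵗ + ∣ r ∣ᵗ)

-- Term m n : m unary function names may be called, n variables are in scope.
data Term (m : ℕ) : ℕ → Set where
  var    : ∀ {n} → Fin n → Term m n
  leaf   : ∀ {n} → Term m n
  _∙_    : ∀ {n} → Term m n → Term m n → Term m n
  bind   : ∀ {n} → Term m n → Term m (suc n) → Term m n
  match  : ∀ {n} → Term m n → Term m n → Term m (suc (suc n)) → Term m n
  call   : ∀ {n} → Fin m → Term m n → Term m n
  choose : ∀ {n} → Term m n → Term m n → Term m n

-- Execution starts with function number zero.
record Program : Set where
  field
    others : ℕ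
    body   : Fin (suc others) → Term (suc others) 1

module Machine (P : Program) where
  open Program P

  Code : ℕ → Set
  Code = Term (suc others)

  Env : ℕ → Set
  Env = Vec Tree

  data Frame : Set where
    consˡ : ∀ {n} → Code n → Env n → Frame
    consʳ : Tree → Frame
    bindᶠ : ∀ {n} → Code (suc n) → Env n → Frame
    match : ∀ {n} → Code n → Code (suc (suc n)) → Env n → Frame
    callᶠ : Fin (suc others) → Frame

  data Config : Set where
    eval   : ∀ {n} → Code n → Env n → List Frame → Config
    return : Tree → List Frame → Config

  infix 4 _↦_

  data _↦_ : Config → Config → Set where
    var     : ∀ {n} {x : Fin n} {ρ K} → eval (var x) ρ K ↦ return (lookup ρ x) K
    leaf    : ∀ {n} {ρ : Env n} {K} → eval leaf ρ K ↦ return leaf K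
    cons    : ∀ {n} {e₁ e₂ : Code n} {ρ K} →
              eval (e₁ ∙ e₂) ρ K ↦ eval e₁ ρ (consˡ e₂ ρ ∷ K)
    consˡ   : ∀ {n} {e : Code n} {ρ v K} →
              return v (consˡ e ρ ∷ K) ↦ eval e ρ (consʳ v ∷ K)
    consʳ   : ∀ {v w K} → return w (consʳ v ∷ K) ↦ return (v ∙ w) K
    bind    : ∀ {n} {e₁ : Code n} {e₂ ρ K} →
              eval (bind e₁ e₂) ρ K ↦ eval e₁ ρ (bindᶠ e₂ ρ ∷ K)
    bindᶠ   : ∀ {n} {e : Code (suc n)} {ρ v K} →
              return v (bindᶠ e ρ ∷ K) ↦ eval e (v ∷ ρ) K
    match   : ∀ {n} {e e₀ : Code n} {e₁ ρ K} →
              eval (match e e₀ e₁) ρ K ↦ eval e ρ (match e₀ e₁ ρ ∷ K)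
    matchˡ  : ∀ {n} {e₀ : Code n} {e₁ ρ K} →
              return leaf (match e₀ e₁ ρ ∷ K) ↦ eval e₀ ρ K
    matchⁿ  : ∀ {n} {e₀ : Code n} {e₁ ρ l r K} →
              return (l ∙ r) (match e₀ e₁ ρ ∷ K) ↦ eval e₁ (l ∷ r ∷ ρ) K
    call    : ∀ {n} {f} {e : Code n} {ρ K} →
              eval (call f e) ρ K ↦ eval e ρ (callᶠ f ∷ K)
    callᶠ   : ∀ {f v K} → return v (callᶠ f ∷ K) ↦ eval (body f) (v ∷ []) K
    choose₁ : ∀ {n} {e₁ e₂ : Code n} {ρ K} → eval (choose e₁ e₂) ρ K ↦ eval e₁ ρ K
    choose₂ : ∀ {n} {e₁ e₂ : Code n} {ρ K} → eval (choose e₁ e₂) ρ K ↦ eval e₂ ρ K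

  start : Tree → Config
  start v = eval (body zero) (v ∷ []) []

  -- The only configurations without a successor are  return v [].
  _⇓_ : Tree → Tree → Set
  v ⇓ w = Star _↦_ (start v) (return w [])

  RunsWithin : Tree → ℕ → Set
  RunsWithin v b = ∀ {n c} → Iter _↦_ n (start v) c → n ≤ b

------------------------------------------------------------------------

record Signature : Set₁ where
  field
    Atom     : Set
    _≟ₐ_     : DecidableEquality Atom
    infinite : ℕ ↣ Atom
    Fun      : Set
    _≟f_     : DecidableEquality Fun
    ar       : Fun → ℕ
    Var      : Set
    _≟ᵥ_     : DecidableEquality Var

module Matching (S : Signature) where
  open Signature S

  ----------------------------------------------------------------------

  -- A list of swappings denotes their composition; its head acts last.
  Perm : Set
  Perm = List (Atom × Atom)

  swap : Atom → Atom → Atom → Atom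
  swap a b c with c ≟ₐ a | c ≟ₐ b
  ... | yes _ | _     = b
  ... | no  _ | yes _ = a
  ... | no  _ | no  _ = c

  _·ₐ_ : Perm → Atom → Atom
  []            ·ₐ c = c
  ((a , b) ∷ π) ·ₐ c = swap a b (π ·ₐ c)

  _⁻¹ : Perm → Perm
  π ⁻¹ = reverse π

  swap-injective : ∀ a b {c d} → swap a b c ≡ swap a b d → c ≡ d
  swap-injective a b {c} {d} eq with c ≟ₐ a | c ≟ₐ b | d ≟ₐ a | d ≟ₐ b
  ... | yes p | _     | yes q | _     = trans p (sym q)
  ... | yes p | _     | no  q | yes r = trans p (trans (sym eq) (sym r))
  ... | yes p | _     | no  q | no  r = contradiction (sym eq) r
  ... | no  p | yes s | yes q | _     = trans s (trans (sym eq) (sym q))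
  ... | no  p | yes s | no  q | yes r = trans s (sym r)
  ... | no  p | yes s | no  q | no  r = contradiction (sym eq) q
  ... | no  p | no  s | yes q | _     = contradiction eq s
  ... | no  p | no  s | no  q | yes r = contradiction eq p
  ... | no  p | no  s | no  q | no  r = eq

  ·ₐ-injective : ∀ π {c d} → π ·ₐ c ≡ π ·ₐ d → c ≡ d
  ·ₐ-injective []            eq = eq
  ·ₐ-injective ((a , b) ∷ π) eq = ·ₐ-injective π (swap-injective a b eq)

  Renames : ∀ {n} → Permutation′ n → Perm → Vec Atom n → Vec Atom n → Set
  Renames ρ π as bs =
    (∀ i → π ·ₐ lookup bs (ρ ⟨$⟩ʳ i) ≡ lookup as i) ×
    (∀ c → π ·ₐ c ≢ c → c ∈ᵥ as ⊎ c ∈ᵥ bs)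

  ----------------------------------------------------------------------
  -- letrec as _ es e  stands for  letrec a₁.e₁;…;aₙ.eₙ in e.  The order of
  -- the bindings is irrelevant to every notion defined below except the
  -- encoding as a tree.
  data Exp (V : Set) : Set where
    atom   : Atom → Exp V
    lam    : Atom → Exp V → Exp V
    app    : (f : Fun) → Vec (Exp V) (ar f) → Exp V
    letrec : ∀ {n} (as : Vec Atom n) → .(Uniqueᵥ as) → Vec (Exp V) n → Exp V → Exp V
    var    : V → Exp V
    susp   : Perm → V → Exp V

  LRL LRLX : Set
  LRL  = Exp ⊥
  LRLX = Exp Var

  infixr 7 _·_

  mutual
    _·_ : Perm → LRL → LRL
    π · atom a           = atom (π ·ₐ a)
    π · lam a e          = lam (π ·ₐ a) (π · e)
    π · app f es         = app f (π ·* es)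
    π · letrec as u es e =
      letrec (Vec.map (π ·ₐ_) as) (Uniqueᵥ.map⁺ (·ₐ-injective π) u) (π ·* es) (π · e)
    π · var ()
    π · susp _ ()

    _·*_ : ∀ {n} → Perm → Vec LRL n → Vec LRL n
    π ·* []       = []
    π ·* (e ∷ es) = (π · e) ∷ (π ·* es)

  data _∈FA_ (c : Atom) : LRL → Set where
    atom   : c ∈FA atom c
    lam    : ∀ {a e} → c ≢ a → c ∈FA e → c ∈FA lam a e
    app    : ∀ {f es} i → c ∈FA lookup es i → c ∈FA app f es
    letrec : ∀ {n} {as : Vec Atom n} .{u} {es e} → c ∉ᵥ as →
             ∀ i → c ∈FA lookup es i → c ∈FA letrec as u es e
    inside : ∀ {n} {as : Vec Atom n} .{u} {es e} → c ∉ᵥ as →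
             c ∈FA e → c ∈FA letrec as u es e

  infix 4 _#_ _#*_ _∼_

  _#_ : Atom → LRL → Set
  a # e = ¬ a ∈FA e

  _#*_ : ∀ {n} → Vec Atom n → LRL → Set
  as #* e = ∀ i → lookup as i # e

  data _∼_ : LRL → LRL → Set where
    atom   : ∀ {a} → atom a ∼ atom a
    app    : ∀ {f es es′} → (∀ i → lookup es i ∼ lookup es′ i) → app f es ∼ app f es′
    lam    : ∀ {a e e′} → e ∼ e′ → lam a e ∼ lam a e′
    lam-α  : ∀ {a b e e′} → a # e′ → e ∼ ((a , b) ∷ []) · e′ → lam a e ∼ lam b e′
    letrec : ∀ {n} {as bs : Vec Atom n} .{u v} {ss ts r r′} →
             (ρ : Permutation′ n) (π : Perm) → Renames ρ π as bs →
             as #* letrec bs v ts r′ →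
             (∀ i → lookup ss i ∼ π · lookup ts (ρ ⟨$⟩ʳ i)) → r ∼ π · r′ →
             letrec as u ss r ∼ letrec bs v ts r′

  -- s ≐ t : s contains no variables and is the expression t, environments
  -- being compared as multisets.
  data _≐_ : LRLX → LRL → Set where
    atom   : ∀ {a} → atom a ≐ atom a
    lam    : ∀ {a s t} → s ≐ t → lam a s ≐ lam a t
    app    : ∀ {f ss ts} → (∀ i → lookup ss i ≐ lookup ts i) → app f ss ≐ app f ts
    letrec : ∀ {n} {as bs : Vec Atom n} .{u v} {ss ts r r′} (ρ : Permutation′ n) →
             (∀ i → lookup as i ≡ lookup bs (ρ ⟨$⟩ʳ i)) →
             (∀ i → lookup ss i ≐ lookup ts (ρ ⟨$⟩ʳ i)) → r ≐ r′ →
             letrec as u ss r ≐ letrec bs v ts r′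

  data _occursIn_ (X : Var) : LRLX → Set where
    var    : X occursIn var X
    susp   : ∀ {π} → X occursIn susp π X
    lam    : ∀ {a s} → X occursIn s → X occursIn lam a s
    app    : ∀ {f ss} i → X occursIn lookup ss i → X occursIn app f ss
    letrec : ∀ {n} {as : Vec Atom n} .{u} {ss s} i →
             X occursIn lookup ss i → X occursIn letrec as u ss s
    inside : ∀ {n} {as : Vec Atom n} .{u} {ss s} →
             X occursIn s → X occursIn letrec as u ss s

  ----------------------------------------------------------------------

  infix 5 _⊴_

  record Equation : Set where
    constructor _⊴_
    field
      lhs : LRLX
      rhs : LRL
  open Equation public

  -- Lists stand for finite sets: all rules apply up to reordering.
  Problem : Set
  Problem = List Equation

  _∈vars_ : Var → Problem → Set
  X ∈vars Γ = Any (λ q → X occursIn lhs q) Γ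

  Subst : Set
  Subst = List (Var × LRL)

  _‼_ : Subst → Var → Maybe LRL
  []            ‼ X = nothing
  ((Y , e) ∷ σ) ‼ X with X ≟ᵥ Y
  ... | yes _ = just e
  ... | no  _ = σ ‼ X

  -- The ground instance sσ; nothing if some variable of s is not in the
  -- domain of σ.
  mutual
    _⟨_⟩ : LRLX → Subst → Maybe LRL
    atom a           ⟨ σ ⟩ = just (atom a)
    lam a s          ⟨ σ ⟩ = mapMaybe (lam a) (s ⟨ σ ⟩)
    app f ss         ⟨ σ ⟩ = mapMaybe (app f) (ss ⟨ σ ⟩*)
    letrec as u ss s ⟨ σ ⟩ = zipWith (letrec as u) (ss ⟨ σ ⟩*) (s ⟨ σ ⟩)
    var X            ⟨ σ ⟩ = σ ‼ X
    susp π X         ⟨ σ ⟩ = mapMaybe (π ·_) (σ ‼ X)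

    _⟨_⟩* : ∀ {n} → Vec LRLX n → Subst → Maybe (Vec LRL n)
    []       ⟨ σ ⟩* = just []
    (s ∷ ss) ⟨ σ ⟩* = zipWith _∷_ (s ⟨ σ ⟩) (ss ⟨ σ ⟩*)

  Matcher : Problem → Subst → Set
  Matcher Γ σ = All (λ q → ∃[ e ] lhs q ⟨ σ ⟩ ≡ just e × e ∼ rhs q) Γ

  AgreeOn : Problem → Subst → Subst → Set
  AgreeOn Γ σ τ = ∀ X → X ∈vars Γ →
    ∃[ d ] ∃[ e ] σ ‼ X ≡ just d × τ ‼ X ≡ just e × d ∼ e

  IsComplete : Problem → (Subst → Set) → Set
  IsComplete Γ M = ∀ τ → Matcher Γ τ → ∃[ σ ] M σ × AgreeOn Γ τ σ

  ----------------------------------------------------------------------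

  infix 4 _⟶ˢ_ _⟶_

  data _⟶ˢ_ : Problem → Problem → Set where
    delete : ∀ {Γ Δ s t} → Γ ↭ (s ⊴ t) ∷ Δ → s ≐ t → Γ ⟶ˢ Δ
    app    : ∀ {Γ Δ f ss ts} → Γ ↭ (app f ss ⊴ app f ts) ∷ Δ →
             Γ ⟶ˢ toList (Vec.zipWith _⊴_ ss ts) ++ Δ
    lam    : ∀ {Γ Δ a s t} → Γ ↭ (lam a s ⊴ lam a t) ∷ Δ → Γ ⟶ˢ (s ⊴ t) ∷ Δ
    lam-α  : ∀ {Γ Δ a b s t} → Γ ↭ (lam a s ⊴ lam b t) ∷ Δ → a ≢ b → a # t →
             Γ ⟶ˢ (s ⊴ ((a , b) ∷ []) · t) ∷ Δ
    susp   : ∀ {Γ Δ π X e} → Γ ↭ (susp π X ⊴ e) ∷ Δ → Γ ⟶ˢ (var X ⊴ π ⁻¹ · e) ∷ Δ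
    merge  : ∀ {Γ Δ X e₁ e₂} → Γ ↭ (var X ⊴ e₁) ∷ (var X ⊴ e₂) ∷ Δ → e₁ ∼ e₂ →
             Γ ⟶ˢ (var X ⊴ e₁) ∷ Δ

  letrecEqs : ∀ {n} → Permutation′ n → Perm →
              Vec LRLX n → LRLX → Vec LRL n → LRL → Problem
  letrecEqs ρ π ss r ts r′ =
    (r ⊴ π · r′) ∷ toList (tabulate λ i → lookup ss i ⊴ π · lookup ts (ρ ⟨$⟩ʳ i))

  data _⟶_ : Problem → Problem → Set where
    simplify : ∀ {Γ Γ′} → Γ ⟶ˢ Γ′ → Γ ⟶ Γ′
    letrec   : ∀ {Γ Δ n} {as bs : Vec Atom n} .{u v} {ss r ts r′} →
               Γ ↭ (letrec as u ss r ⊴ letrec bs v ts r′) ∷ Δ →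
               as #* letrec bs v ts r′ →
               (ρ : Permutation′ n) (π : Perm) → Renames ρ π as bs →
               Γ ⟶ letrecEqs ρ π ss r ts r′ ++ Δ

  data TopSymbol : Set where
    atom   : Atom → TopSymbol
    fun    : Fun → TopSymbol
    lam    : TopSymbol
    letrec : ℕ → TopSymbol

  top : ∀ {V} → Exp V → Maybe TopSymbol
  top (atom a)               = just (atom a)
  top (lam _ _)              = just lam
  top (app f _)              = just (fun f)
  top (letrec {n = n} _ _ _ _) = just (letrec n)
  top (var _)                = nothing
  top (susp _ _)             = nothing

  data Fails (Γ : Problem) : Set where
    letrec : ∀ {n} {as bs : Vec Atom n} .{u v} {ss r ts r′} →
             (letrec as u ss r ⊴ letrec bs v ts r′) ∈ Γ →
             (∃[ i ] ¬ lookup as i # letrec bs v ts r′) → Fails Γ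
    clash  : ∀ {s t x y} → (s ⊴ t) ∈ Γ → top s ≡ just x → top t ≡ just y → x ≢ y → Fails Γ
    lam    : ∀ {a b s t} → (lam a s ⊴ lam b t) ∈ Γ → a ≢ b → ¬ a # t → Fails Γ
    merge  : ∀ {X e₁ e₂} → (var X ⊴ e₁) ∈ Γ → (var X ⊴ e₂) ∈ Γ → ¬ e₁ ∼ e₂ → Fails Γ

  Solved : Problem → Subst → Set
  Solved Γ σ = Γ ↭ map (λ (X , e) → var X ⊴ e) σ × Unique (map proj₁ σ)

  Output : Problem → Subst → Set
  Output Γ σ = ∃[ Γ′ ] Star _⟶_ Γ Γ′ × Solved Γ′ σ

  Enumerates : ∀ {n} → List (Permutation′ n) → Set
  Enumerates ρs = (∀ ρ → Any (ρ ≈ₚ_) ρs) × AllPairs (λ ρ ρ′ → ¬ ρ ≈ₚ ρ′) ρs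

  -- Collects Γ σs : the collecting version, started on Γ, returns σs.  Only
  -- the choices of ρ are explored; which rule is applied where, and which
  -- extension π is taken, is left open, so that every strategy for these
  -- don't-care choices is covered.
  data Collects : Problem → List Subst → Set where
    solved   : ∀ {Γ σ} → Solved Γ σ → Collects Γ (σ ∷ [])
    failed   : ∀ {Γ} → Fails Γ → Collects Γ []
    simplify : ∀ {Γ Γ′ σs} → Γ ⟶ˢ Γ′ → Collects Γ′ σs → Collects Γ σs
    letrec   : ∀ {Γ Δ n} {as bs : Vec Atom n} .{u v} {ss r ts r′ ρs σss} →
               Γ ↭ (letrec as u ss r ⊴ letrec bs v ts r′) ∷ Δ →
               as #* letrec bs v ts r′ →
               Enumerates ρs →
               Pointwise (λ ρ σs → ∃[ π ] Renames ρ π as bs ×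
                                   Collects (letrecEqs ρ π ss r ts r′ ++ Δ) σs)
                         ρs σss →
               Collects Γ (concat σss)

  ----------------------------------------------------------------------

  mutual
    ∣_∣ : ∀ {V} → Exp V → ℕ
    ∣ atom _ ∣                 = 1
    ∣ lam _ e ∣                = suc (suc ∣ e ∣)
    ∣ app _ es ∣               = suc ∣ es ∣*
    ∣ letrec {n = n} _ _ es e ∣ = suc (n + (∣ es ∣* + ∣ e ∣))
    ∣ var _ ∣                  = 1
    ∣ susp π _ ∣               = suc (suc (2 * length π))

    ∣_∣* : ∀ {V n} → Vec (Exp V) n → ℕ
    ∣ [] ∣*     = 0
    ∣ e ∷ es ∣* = ∣ e ∣ + ∣ es ∣*

  problemSize : Problem → ℕ
  problemSize []            = 0
  problemSize ((s ⊴ t) ∷ Γ) = suc (∣ s ∣ + ∣ t ∣ + problemSize Γ)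

  substSize : Subst → ℕ
  substSize []            = 0
  substSize ((_ , e) ∷ σ) = suc (suc (∣ e ∣ + substSize σ))

  ----------------------------------------------------------------------
  -- Representation of problems and substitutions as trees, relative to an
  -- arbitrary naming of atoms, function symbols and variables by trees

  record Naming : Set where
    field
      atoms : Atom ↣ Tree
      funs  : Fun  ↣ Tree
      vars  : Var  ↣ Tree

  module Encoding (N : Naming) where
    open Naming N

    private
      nameₐ = Injection.to atoms
      namef = Injection.to funs
      nameᵥ = Injection.to vars

    tagged : ℕ → Tree → Tree
    tagged k t = numeral k ∙ t
      where
      numeral : ℕ → Tree
      numeral zero    = leaf
      numeral (suc k) = leaf ∙ numeral k

    list : List Tree → Tree
    list []       = leaf
    list (t ∷ ts) = t ∙ list ts

    swappings : Perm → Tree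
    swappings π = list (map (λ (a , b) → nameₐ a ∙ nameₐ b) π)

    mutual
      exp : ∀ {V} → (V → Tree) → Exp V → Tree
      exp nm (atom a)           = tagged 0 (nameₐ a)
      exp nm (lam a e)          = tagged 1 (nameₐ a ∙ exp nm e)
      exp nm (app f es)         = tagged 2 (namef f ∙ exps nm es)
      exp nm (letrec as _ es e) = tagged 3 (bindings nm as es ∙ exp nm e)
      exp nm (var X)            = tagged 4 (nm X)
      exp nm (susp π X)         = tagged 5 (swappings π ∙ nm X)

      exps : ∀ {V n} → (V → Tree) → Vec (Exp V) n → Tree
      exps nm []       = leaf
      exps nm (e ∷ es) = exp nm e ∙ exps nm es

      bindings : ∀ {V n} → (V → Tree) → Vec Atom n → Vec (Exp V) n → Tree
      bindings nm []       []       = leaf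
      bindings nm (a ∷ as) (e ∷ es) = (nameₐ a ∙ exp nm e) ∙ bindings nm as es

    ground : LRL → Tree
    ground = exp ⊥-elim

    problem : Problem → Tree
    problem Γ = list (map (λ q → exp nameᵥ (lhs q) ∙ ground (rhs q)) Γ)

    subst : Subst → Tree
    subst σ = list (map (λ (X , e) → nameᵥ X ∙ ground e) σ)

    -- The trees by which a program reports failure and a substitution.
    failure : Tree
    failure = leaf

    success : Subst → Tree
    success σ = leaf ∙ subst σ

  ----------------------------------------------------------------------

  Sound : Set
  Sound = ∀ Γ σ → Output Γ σ → Matcher Γ σ

  Complete : Set
  Complete = ∀ Γ → IsComplete Γ (Output Γ)

  PolynomialRuns : Set
  PolynomialRuns =
    (∀ Γ → Fails Γ ⊎ (∃[ σ ] Solved Γ σ) ⊎ (∃[ Γ′ ] Γ ⟶ Γ′)) ×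
    (∃[ p ] ∀ Γ {n Γ′} → Iter _⟶_ n Γ Γ′ → n ≤ ⟦ p ⟧ (problemSize Γ))

  -- P carries out LetrecMatch in time b (in the size of the encoded input),
  -- knowing nothing about names beyond what comparing them reveals: each of its computations yields failure or an output of LetrecMatch, and
  -- it can yield a substitution exactly when a matcher exists.
  DecidesMatching : Program → Polynomial → Naming → Set
  DecidesMatching P b N = ∀ Γ →
    RunsWithin (problem Γ) (⟦ b ⟧ ∣ problem Γ ∣ᵗ) ×
    (∀ w → problem Γ ⇓ w → w ≡ failure ⊎ (∃[ σ ] w ≡ success σ × Output Γ σ)) ×
    ((∃[ σ ] problem Γ ⇓ success σ) ⇔ (∃[ σ ] Matcher Γ σ))
    where
    open Machine P
    open Encoding N

  DecidesInNP : Set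
  DecidesInNP = PolynomialRuns × (∃[ P ] ∃[ b ] ∀ N → DecidesMatching P b N)

  CollectsAll : Set
  CollectsAll =
    (∀ Γ → ∃[ σs ] Collects Γ σs) ×
    (∃[ p ] ∃[ q ] ∀ Γ σs → Collects Γ σs →
      All (Matcher Γ) σs ×
      IsComplete Γ (_∈ σs) ×
      length σs ≤ 2 ^ ⟦ p ⟧ (problemSize Γ) ×
      All (λ σ → substSize σ ≤ ⟦ q ⟧ (problemSize Γ)) σs)

-- α-equivalence is an instance of a relation f , g ⊢ e ≈ e′ that compares free atoms through f and g and bound ones
-- through their positions.  For this relation symmetry, transitivity and decidability are structural, and for f = g
-- injective it coincides with ∼.  Every rule both preserves and reflects matchers -- the letrec rule for each ρ that
-- underlies a derivation of ∼, and for any π, because two renamings agree on the atoms free in the bindings -- and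
-- every rule lowers the total size of the left-hand sides.  Failing problems have no matcher, and any other unsolved
-- problem has a step; soundness and completeness follow.  Exploring ρ multiplies the number of results by at most
-- n! ≤ 2 ^ (n * n) at a letrec with n bindings, and these n are paid for by the size of the left-hand side.
--
-- The program decomposes equations from a worklist and shuffles the bindings of each right-hand letrec
-- nondeterministically.  The merging test e₁ ∼ e₂ is hard for a deterministic program, but it is itself a matching
-- problem, with e₁ read as a left-hand side, so the same decomposition serves.  No function body loops, so running
-- time is bounded, up to a constant factor, by the number of calls.

module Submission where

open import Defs
open import Data.Bool using (Bool; true; false; T; _∧_; _∨_; not; if_then_else_)
import Data.Bool.Properties as Bool
open import Data.Empty using (⊥-elim)
open import Data.Fin using (Fin; zero; suc; punchIn; punchOut; funToFin; finToFun)
open import Data.Fin.Permutation using (Permutation′; _⟨$⟩ʳ_; _⟨$⟩ˡ_; inverseˡ; inverseʳ; flip; _∘ₚ_; insert; remove; insert-remove) renaming (_≈_ to _≈ₚ_; id to idₚ)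
open import Data.Fin.Properties using (any?; all?; injective⇒≤; finToFun-funToFin; punchIn-punchOut; suc-injective) renaming (_≟_ to _≟ᶠ_)
open import Data.List using (List; []; _∷_; _++_; length; map; reverse; concat; concatMap; allFin; deduplicate; _ʳ++_)
open import Data.List.Membership.Propositional using (_∈_)
open import Data.List.Relation.Unary.All as All using (All; []; _∷_)
open import Data.List.Relation.Unary.AllPairs using (AllPairs; []; _∷_)
open import Data.List.Relation.Unary.Any as Any using (Any; here; there)
open import Data.List.Relation.Unary.Unique.Propositional using (Unique)
open import Data.List.Relation.Binary.Permutation.Propositional using (_↭_; ↭-refl; ↭-sym; ↭-trans; ↭-prep; ↭-swap)
open import Data.List.Relation.Binary.Pointwise using (Pointwise; []; _∷_)
open import Data.Maybe using (Maybe; just; nothing; zipWith) renaming (map to mapMaybe)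
open import Data.Nat using (ℕ; zero; suc; _+_; _*_; _^_; _≤_; _<_; _<ᵇ_; z≤n; s≤s)
open import Data.Product using (∃; ∃-syntax; _×_; _,_; proj₁; proj₂)
open import Data.Sum using (_⊎_; inj₁; inj₂)
open import Data.Unit using (⊤; tt)
open import Data.Vec using (Vec; []; _∷_; lookup; tabulate; toList)
import Data.List.Membership.Propositional.Properties as ∈ₚ
import Data.Fin
import Data.List
import Data.List.Properties as List
import Data.List.Relation.Unary.Unique.DecSetoid.Properties as UniqueDecSetoid
import Data.List.Relation.Binary.Permutation.Propositional.Properties as ↭
import Data.List.Relation.Unary.All.Properties as All
import Data.List.Relation.Unary.Any.Properties as Any
import Data.Nat.Properties as ℕ
open import Data.Nat.Properties using (≤-trans; ≤-reflexive; ≤-refl; m≤n+m; m≤m+n; +-suc; +-identityʳ; +-mono-≤; +-monoʳ-≤; +-monoˡ-≤; *-monoˡ-≤; m≤n⇒m≤1+n; n≤1+n; <⇒≤)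
open import Data.Nat.Tactic.RingSolver using (solve-∀)
open import Data.Nat.ListAction using (sum)
open import Data.Nat.ListAction.Properties using (sum-↭; sum-++)
import Data.Sum as Sum
import Data.Sum.Properties as Sum
import Data.Vec as Vec
import Data.Vec.Properties as Vec
open import Data.Vec.Membership.Propositional using () renaming (_∈_ to _∈ᵥ_; _∉_ to _∉ᵥ_)
import Data.Vec.Membership.Propositional.Properties as ∈ᵥ
import Data.Vec.Relation.Unary.All as Allᵥ
import Data.Vec.Relation.Unary.All.Properties as Allᵥ
import Data.Vec.Relation.Unary.AllPairs as AllPairsᵥ
import Data.Vec.Relation.Unary.Any as Anyᵥ
import Data.Vec.Relation.Unary.Any.Properties as Anyᵥ
open import Data.Vec.Relation.Unary.Unique.Propositional using () renaming (Unique to Uniqueᵥ)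
import Data.Vec.Relation.Unary.Unique.Propositional.Properties as Uniqueᵥ
open import Function using (_∘_; id; _↣_; mk⇔; case_of_)
open import Function.Bundles using (module Injection)
open import Function.Definitions using (Injective)
open import Level using (Level)
open import Relation.Binary using (DecidableEquality; DecSetoid)
open import Relation.Binary.Construct.Closure.ReflexiveTransitive using (Star; ε; _◅_; _◅◅_)
open import Relation.Binary.PropositionalEquality using (_≡_; _≢_; refl; sym; trans; cong; cong₂; subst; module ≡-Reasoning)
open import Relation.Nullary using (¬_; Dec; yes; no; does; contradiction)
open import Relation.Nullary.Decidable using (recompute; ¬?; map′; _×-dec_; decidable-stable)

-- α-equivalence

-- The relation `_∼_` resists direct induction: freshness is asked on one side only and the support
-- of each π is confined to the binders at hand, so inverting or composing derivations means
-- rebuilding them, and a decision would have to search among permutations of an infinite set. With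
-- positions as names of bound atoms, only ρ is left to choose, from a finite set. The program is
-- judged by two families of specifications. `Must` bounds every run and says that a success is
-- justified by the rules; a failure needs no justification, since a wrong order of bindings may
-- have been guessed, also inside a merging test. That a matchable problem has a successful run is
-- shown separately with `MayCall`, a given matcher telling which orders to guess. Names are
-- arbitrary trees, so comparing two of them is not of unit cost. All costs are expressed in one
-- bound B for names, expressions and substitutions. Renaming introduces no names beyond those
-- present and keeps sizes, so B survives every step and can be the size of the encoded input.

module Nominal (S : Signature) where
  open Signature S public
  open Matching S public

  private variable
    n : ℕ
    ℓ : Level
    V D D′ : Set
    a b c : Atom
    e e′ e″ : LRL

  -- Recursion through lookup is not structural for the termination checker, hence an explicit eliminator.
  module _ (P : Exp V → Set ℓ)
           (pᵃ : ∀ a → P (atom a))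
           (pˡ : ∀ a {e} → P e → P (lam a e))
           (pᶠ : ∀ f {es} → (∀ i → P (lookup es i)) → P (app f es))
           (pʳ : ∀ {n} (as : Vec Atom n) .(u : Uniqueᵥ as) {es e} →
                 (∀ i → P (lookup es i)) → P e → P (letrec as u es e))
           (pᵛ : ∀ X → P (var X))
           (pˢ : ∀ π X → P (susp π X)) where
    mutual
      exp-elim : ∀ e → P e
      exp-elim (atom a)           = pᵃ a
      exp-elim (lam a e)          = pˡ a (exp-elim e)
      exp-elim (app f es)         = pᶠ f (exps-elim es)
      exp-elim (letrec as u es e) = pʳ as u (exps-elim es) (exp-elim e)
      exp-elim (var X)            = pᵛ X
      exp-elim (susp π X)         = pˢ π X

      exps-elim : (es : Vec (Exp V) n) → ∀ i → P (lookup es i)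
      exps-elim (e ∷ es) zero    = exp-elim e
      exps-elim (e ∷ es) (suc i) = exps-elim es i

  -- The distinctness proof inside a `letrec` is irrelevant. It can still be used, because
  -- distinctness of atoms is decidable and can be recomputed.
  unique⇒injective : (as : Vec Atom n) → .(Uniqueᵥ as) → ∀ {i j} → lookup as i ≡ lookup as j → i ≡ j
  unique⇒injective as u =
    Uniqueᵥ.lookup-injective (recompute (AllPairsᵥ.allPairs? (λ x y → ¬? (x ≟ₐ y)) as) u) _ _

  _∈ᵥ?_ : (c : Atom) (as : Vec Atom n) → Dec (∃[ i ] lookup as i ≡ c)
  c ∈ᵥ? as = any? (λ i → lookup as i ≟ₐ c)

  ∈ᵥ⇒index : {as : Vec Atom n} → c ∈ᵥ as → ∃[ i ] lookup as i ≡ c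
  ∈ᵥ⇒index c∈ = Anyᵥ.index c∈ , sym (Anyᵥ.lookup-index c∈)

  index⇒∈ᵥ : (as : Vec Atom n) → ∃[ i ] lookup as i ≡ c → c ∈ᵥ as
  index⇒∈ᵥ as (i , refl) = ∈ᵥ.∈-lookup i as

  lookup-· : ∀ π (es : Vec LRL n) i → lookup (π ·* es) i ≡ π · lookup es i
  lookup-· π (e ∷ es) zero    = refl
  lookup-· π (e ∷ es) (suc i) = lookup-· π es i

  swap-left : ∀ a b → swap a b a ≡ b
  swap-left a b with a ≟ₐ a | a ≟ₐ b
  ... | yes _ | _ = refl
  ... | no ¬p | _ = contradiction refl ¬p

  swap-right : ∀ a b → swap a b b ≡ a
  swap-right a b with b ≟ₐ a | b ≟ₐ b
  ... | yes p | _     = p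
  ... | no  _ | yes _ = refl
  ... | no  _ | no ¬p = contradiction refl ¬p

  swap-other : c ≢ a → c ≢ b → swap a b c ≡ c
  swap-other {c} {a} {b} c≢a c≢b with c ≟ₐ a | c ≟ₐ b
  ... | yes p | _     = contradiction p c≢a
  ... | no  _ | yes p = contradiction p c≢b
  ... | no  _ | no  _ = refl

  swap-involutive : ∀ a b c → swap a b (swap a b c) ≡ c
  swap-involutive a b c with c ≟ₐ a | c ≟ₐ b
  ... | yes refl | _        = swap-right a b
  ... | no  _    | yes refl = swap-left a b
  ... | no  c≢a  | no  c≢b  = swap-other c≢a c≢b

  ·ₐ-++ : ∀ π₁ π₂ c → (π₁ ++ π₂) ·ₐ c ≡ π₁ ·ₐ (π₂ ·ₐ c)
  ·ₐ-++ []             π₂ c = refl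
  ·ₐ-++ ((a , b) ∷ π₁) π₂ c = cong (swap a b) (·ₐ-++ π₁ π₂ c)

  ·ₐ-⁻¹ʳ : ∀ π c → π ·ₐ ((π ⁻¹) ·ₐ c) ≡ c
  ·ₐ-⁻¹ʳ []            c = refl
  ·ₐ-⁻¹ʳ ((a , b) ∷ π) c
    rewrite List.unfold-reverse (a , b) π | ·ₐ-++ (reverse π) ((a , b) ∷ []) c
          | ·ₐ-⁻¹ʳ π (swap a b c) = swap-involutive a b c

  ·ₐ-⁻¹ˡ : ∀ π c → (π ⁻¹) ·ₐ (π ·ₐ c) ≡ c
  ·ₐ-⁻¹ˡ π c = ·ₐ-injective π (·ₐ-⁻¹ʳ π (π ·ₐ c))

  -- Names for the bound atoms are their positions, so that a letrec enlarges the codomain D.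
  extend : (Fin n → Atom) → (Atom → D) → Atom → Fin n ⊎ D
  extend as f c with any? (λ i → as i ≟ₐ c)
  ... | yes (i , _) = inj₁ i
  ... | no _        = inj₂ (f c)

  Distinct : (Fin n → Atom) → Set
  Distinct as = ∀ {i j} → as i ≡ as j → i ≡ j

  extend-bound : {as : Fin n → Atom} {f : Atom → D} → Distinct as → ∀ i → extend as f (as i) ≡ inj₁ i
  extend-bound {as = as} inj i with any? (λ j → as j ≟ₐ as i)
  ... | yes (j , eq) = cong inj₁ (inj eq)
  ... | no ¬p        = contradiction (i , refl) ¬p

  extend-free : {as : Fin n → Atom} {f : Atom → D} → ¬ (∃[ i ] as i ≡ c) → extend as f c ≡ inj₂ (f c)
  extend-free {c = c} {as = as} c∉ with any? (λ j → as j ≟ₐ c)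
  ... | yes p = contradiction p c∉
  ... | no  _ = refl

  data Bound? {n} (as : Fin n → Atom) : Atom → Set where
    bound : ∀ i → Bound? as (as i)
    free  : ∀ {c} → ¬ (∃[ i ] as i ≡ c) → Bound? as c

  bound? : (as : Fin n → Atom) → ∀ c → Bound? as c
  bound? as c with any? (λ j → as j ≟ₐ c)
  ... | yes (i , refl) = bound i
  ... | no p           = free p

  one : Atom → Fin 1 → Atom
  one a _ = a

  distinct-one : ∀ a → Distinct (one a)
  distinct-one a {zero} {zero} _ = refl

  infix 4 _,_⊢_≈_

  -- In the style of de Bruijn, a binder and its partner are sent to the same position, so neither
  -- freshness nor a renaming is mentioned. In a `letrec` the right binders are listed in the order
  -- ρ, which makes partners share an index. Two name functions are allowed so that e can be
  -- compared with `π · e`.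
  data _,_⊢_≈_ {D : Set} (f g : Atom → D) : LRL → LRL → Set where
    atom   : ∀ {a b} → f a ≡ g b → f , g ⊢ atom a ≈ atom b
    lam    : ∀ {a b e e′} → extend (one a) f , extend (one b) g ⊢ e ≈ e′ → f , g ⊢ lam a e ≈ lam b e′
    app    : ∀ {h es es′} → (∀ i → f , g ⊢ lookup es i ≈ lookup es′ i) → f , g ⊢ app h es ≈ app h es′
    letrec : ∀ {n} {as bs : Vec Atom n} .{u v} {ss ts r r′} (ρ : Permutation′ n) →
             (∀ i → extend (lookup as) f , extend (lookup bs ∘ (ρ ⟨$⟩ʳ_)) g ⊢ lookup ss i ≈ lookup ts (ρ ⟨$⟩ʳ i)) →
             extend (lookup as) f , extend (lookup bs ∘ (ρ ⟨$⟩ʳ_)) g ⊢ r ≈ r′ →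
             f , g ⊢ letrec as u ss r ≈ letrec bs v ts r′

  permute-distinct : (bs : Vec Atom n) .(u : Uniqueᵥ bs) (ρ : Permutation′ n) → Distinct (lookup bs ∘ (ρ ⟨$⟩ʳ_))
  permute-distinct bs u ρ eq =
    trans (sym (inverseˡ ρ)) (trans (cong (ρ ⟨$⟩ˡ_) (unique⇒injective bs u eq)) (inverseˡ ρ))

  permute-free : (bs : Vec Atom n) (ρ : Permutation′ n) →
                 ∃[ i ] lookup bs i ≡ c → ∃[ i ] lookup bs (ρ ⟨$⟩ʳ i) ≡ c
  permute-free bs ρ (i , eq) = ρ ⟨$⟩ˡ i , trans (cong (lookup bs) (inverseʳ ρ)) eq

  -- Only the coincidences `f c ≡ g d` between free atoms are ever consulted, and under a binder the
  -- bound positions settle themselves. So f and g may be replaced by any pair that keeps these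
  -- coincidences, for instance after a renumbering of positions.
  ≈-cong : ∀ {f g : Atom → D} {f′ g′ : Atom → D′} → f , g ⊢ e ≈ e′ →
           (∀ {c d} → c ∈FA e → d ∈FA e′ → f c ≡ g d → f′ c ≡ g′ d) → f′ , g′ ⊢ e ≈ e′
  ≈-cong (atom eq) h = atom (h atom atom eq)
  ≈-cong {f = f} {g} {f′} {g′} (lam {a} {b} p) h = lam (≈-cong p hˡ)
    where
    hˡ : ∀ {c d} → c ∈FA _ → d ∈FA _ → extend (one a) f c ≡ extend (one b) g d →
         extend (one a) f′ c ≡ extend (one b) g′ d
    hˡ {c} {d} c∈ d∈ eq with any? {n = 1} (λ _ → a ≟ₐ c) | any? {n = 1} (λ _ → b ≟ₐ d)
    ... | yes (zero , _) | yes (zero , _) = refl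
    ... | no c∉ | no d∉ = cong inj₂ (h (lam (λ { refl → c∉ (zero , refl) }) c∈)
                                       (lam (λ { refl → d∉ (zero , refl) }) d∈) (Sum.inj₂-injective eq))
  ≈-cong (app ps) h = app (λ i → ≈-cong (ps i) (λ c∈ d∈ → h (app i c∈) (app i d∈)))
  ≈-cong {f = f} {g} {f′} {g′} (letrec {as = as} {bs} ρ ps p) h =
    letrec ρ (λ i → ≈-cong (ps i) (hʳ (λ c∉ c∈ → letrec c∉ i c∈) (λ d∉ d∈ → letrec d∉ (ρ ⟨$⟩ʳ i) d∈)))
             (≈-cong p (hʳ inside inside))
    where
    hʳ : ∀ {s t} → (∀ {c} → c ∉ᵥ as → c ∈FA s → c ∈FA _) → (∀ {d} → d ∉ᵥ bs → d ∈FA t → d ∈FA _) →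
         ∀ {c d} → c ∈FA s → d ∈FA t → extend (lookup as) f c ≡ extend (lookup bs ∘ (ρ ⟨$⟩ʳ_)) g d →
         extend (lookup as) f′ c ≡ extend (lookup bs ∘ (ρ ⟨$⟩ʳ_)) g′ d
    hʳ l r {c} {d} c∈ d∈ eq
      with any? (λ i → lookup as i ≟ₐ c) | any? (λ i → lookup bs (ρ ⟨$⟩ʳ i) ≟ₐ d)
    ... | yes _ | yes _ = cong inj₁ (Sum.inj₁-injective eq)
    ... | no c∉ | no d∉ = cong inj₂ (h (l (c∉ ∘ ∈ᵥ⇒index) c∈) (r (d∉ ∘ permute-free bs ρ ∘ ∈ᵥ⇒index) d∈)
                                       (Sum.inj₂-injective eq))

  extend-relabel : {as as′ : Fin n → Atom} {f : Atom → D} (ρ : Permutation′ n) → Distinct as → Distinct as′ →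
                   (∀ i → as′ (ρ ⟨$⟩ʳ i) ≡ as i) →
                   ∀ c → extend as′ f c ≡ Sum.map (ρ ⟨$⟩ʳ_) id (extend as f c)
  extend-relabel {as = as} {as′} {f} ρ das das′ eq c with bound? as c
  ... | bound i = trans (trans (cong (extend as′ f) (sym (eq i))) (extend-bound das′ (ρ ⟨$⟩ʳ i)))
                        (sym (cong (Sum.map (ρ ⟨$⟩ʳ_) id) (extend-bound das i)))
  ... | free c∉ = trans (extend-free λ (i , p) → c∉ (ρ ⟨$⟩ˡ i , trans (sym (eq _)) (trans (cong as′ (inverseʳ ρ)) p)))
                        (sym (cong (Sum.map (ρ ⟨$⟩ʳ_) id) (extend-free c∉)))

  -- A renumbering by ρ acts on both sides at once and hence keeps all coincidences. It reconciles
  -- the orders in which symmetry and transitivity list one family of binders.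
  ≈-relabel : {as as′ bs bs′ : Fin n → Atom} {f g : Atom → D} (ρ : Permutation′ n) →
              Distinct as → Distinct as′ → Distinct bs → Distinct bs′ →
              (∀ i → as′ (ρ ⟨$⟩ʳ i) ≡ as i) → (∀ i → bs′ (ρ ⟨$⟩ʳ i) ≡ bs i) →
              extend as f , extend bs g ⊢ e ≈ e′ → extend as′ f , extend bs′ g ⊢ e ≈ e′
  ≈-relabel ρ das das′ dbs dbs′ eqa eqb p = ≈-cong p λ {c} {d} _ _ eq →
    trans (extend-relabel ρ das das′ eqa c)
      (trans (cong (Sum.map (ρ ⟨$⟩ʳ_) id) eq) (sym (extend-relabel ρ dbs dbs′ eqb d)))

  ≈-sym : {f g : Atom → D} → f , g ⊢ e ≈ e′ → g , f ⊢ e′ ≈ e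
  ≈-sym (atom eq) = atom (sym eq)
  ≈-sym (lam p)   = lam (≈-sym p)
  ≈-sym (app ps)  = app (λ i → ≈-sym (ps i))
  ≈-sym {f = f} {g} (letrec {as = as} {bs} {u} {v} {ss} {ts} ρ ps p) =
    letrec (flip ρ)
      (λ j → subst (λ k → extend (lookup bs) g , extend (lookup as ∘ (ρ ⟨$⟩ˡ_)) f ⊢ lookup ts k ≈ lookup ss (ρ ⟨$⟩ˡ j))
                   (inverseʳ ρ) (relabel (≈-sym (ps (ρ ⟨$⟩ˡ j)))))
      (relabel (≈-sym p))
    where
    relabel : ∀ {e e′} → extend (lookup bs ∘ (ρ ⟨$⟩ʳ_)) g , extend (lookup as) f ⊢ e ≈ e′ →
              extend (lookup bs) g , extend (lookup as ∘ (ρ ⟨$⟩ˡ_)) f ⊢ e ≈ e′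
    relabel = ≈-relabel ρ (permute-distinct bs v ρ) (unique⇒injective bs v)
      (unique⇒injective as u) (permute-distinct as u (flip ρ))
      (λ _ → refl) (λ _ → cong (lookup as) (inverseˡ ρ))

  ≈-trans : {f g h : Atom → D} → f , g ⊢ e ≈ e′ → g , h ⊢ e′ ≈ e″ → f , h ⊢ e ≈ e″
  ≈-trans (atom eq) (atom eq′) = atom (trans eq eq′)
  ≈-trans (lam p)   (lam q)    = lam (≈-trans p q)
  ≈-trans (app ps)  (app qs)   = app (λ i → ≈-trans (ps i) (qs i))
  ≈-trans {g = g} {h} (letrec {bs = bs} {v = v} ρ ps p) (letrec {bs = cs} {v = w} ρ′ qs q) =
    letrec (ρ ∘ₚ ρ′) (λ i → ≈-trans (ps i) (relabel (qs (ρ ⟨$⟩ʳ i)))) (≈-trans p (relabel q))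
    where
    relabel : ∀ {e e′} → extend (lookup bs) g , extend (lookup cs ∘ (ρ′ ⟨$⟩ʳ_)) h ⊢ e ≈ e′ →
              extend (lookup bs ∘ (ρ ⟨$⟩ʳ_)) g , extend (lookup cs ∘ ((ρ ∘ₚ ρ′) ⟨$⟩ʳ_)) h ⊢ e ≈ e′
    relabel = ≈-relabel (flip ρ) (unique⇒injective bs v) (permute-distinct bs v ρ)
      (permute-distinct cs w ρ′) (permute-distinct cs w (ρ ∘ₚ ρ′))
      (λ _ → cong (lookup bs) (inverseʳ ρ)) (λ _ → cong (λ k → lookup cs (ρ′ ⟨$⟩ʳ k)) (inverseʳ ρ))

  -- Under binders a free atom is named `inj₂` and a bound one `inj₁`, so the partner of an atom
  -- that escapes the binders escapes too. The freshness conditions in `≈⇒∼` come from here.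
  ≈-free : {f g : Atom → D} → f , g ⊢ e ≈ e′ → c ∈FA e → ∃[ d ] d ∈FA e′ × f c ≡ g d
  ≈-free (atom eq) atom = _ , atom , eq
  ≈-free {c = c} {f} {g} (lam {a} {b} p) (lam c≢a c∈) with ≈-free p c∈
  ... | d , d∈ , eq with bound? (one b) d
  ...   | bound zero = case trans (sym (extend-free {as = one a} (λ (_ , p) → c≢a (sym p))))
                                  (trans eq (extend-bound (distinct-one b) zero)) of λ ()
  ...   | free d∉    = d , lam (λ p → d∉ (zero , sym p)) d∈ ,
                       Sum.inj₂-injective (trans (sym (extend-free {as = one a} (λ (_ , p) → c≢a (sym p))))
                                                 (trans eq (extend-free d∉)))
  ≈-free (app ps) (app i c∈) with ≈-free (ps i) c∈
  ... | d , d∈ , eq = d , app i d∈ , eq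
  ≈-free {c = c} {f} {g} (letrec {as = as} {bs} {u} {v} ρ ps p) c∈ = go c∈
    where
    f′ = extend (lookup as) f
    g′ = extend (lookup bs ∘ (ρ ⟨$⟩ʳ_)) g
    escape : c ∉ᵥ as → ∀ {d} → f′ c ≡ g′ d → d ∉ᵥ bs × f c ≡ g d
    escape c∉ {d} eq with bound? (lookup bs ∘ (ρ ⟨$⟩ʳ_)) d
    ... | bound i = case trans (sym (extend-free (c∉ ∘ index⇒∈ᵥ as)))
                               (trans eq (extend-bound (permute-distinct bs v ρ) i)) of λ ()
    ... | free d∉ = d∉ ∘ permute-free bs ρ ∘ ∈ᵥ⇒index ,
                    Sum.inj₂-injective (trans (sym (extend-free (c∉ ∘ index⇒∈ᵥ as))) (trans eq (extend-free d∉)))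
    go : c ∈FA letrec as _ _ _ → ∃[ d ] d ∈FA letrec bs _ _ _ × f c ≡ g d
    go (letrec c∉ i c∈) with ≈-free (ps i) c∈
    ... | d , d∈ , eq = d , letrec (proj₁ (escape c∉ eq)) (ρ ⟨$⟩ʳ i) d∈ , proj₂ (escape c∉ eq)
    go (inside c∉ c∈) with ≈-free p c∈
    ... | d , d∈ , eq = d , inside (proj₁ (escape c∉ eq)) d∈ , proj₂ (escape c∉ eq)

  -- The permutation maps binders injectively to the binders of `π · e`, so positions do not change
  -- and only free atoms have to be compared. Every passage between a permuted expression and the
  -- positional relation goes through this lemma.
  ≈-· : ∀ e {D} {f g : Atom → D} π → (∀ {c} → c ∈FA e → f c ≡ g (π ·ₐ c)) → f , g ⊢ e ≈ π · e
  ≈-· = exp-elim _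
    (λ a π h → atom (h atom))
    (λ a {e} IH {f = f} {g} π h → lam (IH π λ {c} c∈ → lam-case {π = π} h c∈))
    (λ h {es} IH π hyp → app λ i → subst (_ , _ ⊢ _ ≈_) (sym (lookup-· π es i)) (IH i π (hyp ∘ app i)))
    (λ as u {es} IHs IH π h → letrec idₚ
      (λ i → subst (_ , _ ⊢ _ ≈_) (sym (lookup-· π es i)) (IHs i π λ c∈ → letrec-case as u π (λ c∉ → h (letrec c∉ i c∈))))
      (IH π λ c∈ → letrec-case as u π (λ c∉ → h (inside c∉ c∈))))
    (λ ()) (λ π ())
    where
    lam-case : ∀ {D} {f g : Atom → D} {π a e} → (∀ {c} → c ∈FA lam a e → f c ≡ g (π ·ₐ c)) →
               ∀ {c} → c ∈FA e → extend (one a) f c ≡ extend (one (π ·ₐ a)) g (π ·ₐ c)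
    lam-case {π = π} {a} h {c} c∈ with bound? (one a) c
    ... | bound zero = trans (extend-bound (distinct-one a) zero) (sym (extend-bound (distinct-one (π ·ₐ a)) zero))
    ... | free c∉    = trans (extend-free c∉) (trans (cong inj₂ (h (lam (λ p → c∉ (zero , sym p)) c∈)))
                         (sym (extend-free {as = one (π ·ₐ a)} λ (i , p) → c∉ (i , ·ₐ-injective π p))))
    letrec-case : ∀ {D} {f g : Atom → D} {n} (as : Vec Atom n) .(u : Uniqueᵥ as) π {c} →
                  (c ∉ᵥ as → f c ≡ g (π ·ₐ c)) →
                  extend (lookup as) f c ≡ extend (lookup (Vec.map (π ·ₐ_) as)) g (π ·ₐ c)
    letrec-case {f = f} {g} as u π {c} h with bound? (lookup as) c
    ... | bound i = trans (extend-bound (unique⇒injective as u) i)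
        (trans (sym (extend-bound (unique⇒injective as′ (Uniqueᵥ.map⁺ (·ₐ-injective π) u)) i))
               (cong (extend (lookup as′) g) (Vec.lookup-map i (π ·ₐ_) as)))
      where
      as′ = Vec.map (π ·ₐ_) as
    ... | free c∉ = trans (extend-free c∉) (trans (cong inj₂ (h (c∉ ∘ ∈ᵥ⇒index)))
        (sym (extend-free λ (i , p) → c∉ (i , ·ₐ-injective π (trans (sym (Vec.lookup-map i (π ·ₐ_) as)) p)))))

  ≈-refl : {f : Atom → D} → f , f ⊢ e ≈ e
  -- The detour through `[] · e` and back replaces a further induction.
  ≈-refl {e = e} = ≈-trans (≈-· e [] λ _ → refl) (≈-sym (≈-· e [] λ _ → refl))

  fixes-others : ∀ {π} {P : Set} → (π ·ₐ c ≢ c → P) → ¬ P → π ·ₐ c ≡ c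
  fixes-others {c} {π} h ¬P = decidable-stable ((π ·ₐ c) ≟ₐ c) (¬P ∘ h)

  -- Atoms outside both families are fixed by π. The dangerous ones are those among `as` but not
  -- among `bs`; the last hypothesis excludes them, and freshness of `as` for the right-hand side
  -- supplies it for the atoms that occur there.
  extend-rename : {as bs : Fin n → Atom} {f : Atom → D} {π : Perm} → Distinct as → Distinct bs →
                  (∀ i → π ·ₐ bs i ≡ as i) →
                  (∀ c → π ·ₐ c ≢ c → (∃[ i ] as i ≡ c) ⊎ (∃[ i ] bs i ≡ c)) →
                  ∀ c → (¬ (∃[ i ] bs i ≡ c) → ¬ (∃[ i ] as i ≡ c)) →
                  extend bs f c ≡ extend as f (π ·ₐ c)
  extend-rename {as = as} {bs} {f} {π} das dbs ren supp c fr with bound? bs c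
  ... | bound i = trans (extend-bound dbs i) (sym (trans (cong (extend as f) (ren i)) (extend-bound das i)))
  ... | free c∉ = trans (extend-free c∉) (sym (trans
        (cong (extend as f) (fixes-others {π = π} (supp c) Sum.[ fr c∉ , c∉ ]))
        (extend-free (fr c∉))))

  swap-renames : ∀ a b c → ((a , b) ∷ []) ·ₐ c ≢ c → (∃[ i ] one a i ≡ c) ⊎ (∃[ i ] one b i ≡ c)
  swap-renames a b c neq with c ≟ₐ a | c ≟ₐ b
  ... | yes p | _     = inj₁ (zero , sym p)
  ... | no  _ | yes p = inj₂ (zero , sym p)
  ... | no  _ | no  _ = contradiction refl neq

  renames-support : {as bs : Vec Atom n} (ρ : Permutation′ n) {π : Perm} → Renames ρ π as bs →
                    ∀ c → π ·ₐ c ≢ c → (∃[ i ] lookup as i ≡ c) ⊎ (∃[ i ] lookup bs (ρ ⟨$⟩ʳ i) ≡ c)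
  renames-support {bs = bs} ρ (_ , supp) c neq =
    Sum.map ∈ᵥ⇒index (permute-free bs ρ ∘ ∈ᵥ⇒index) (supp c neq)

  lam-rename : ∀ {f : Atom → D} a b {t} → a # t → ∀ {c} → c ∈FA t →
               extend (one b) f c ≡ extend (one a) f (((a , b) ∷ []) ·ₐ c)
  lam-rename a b a# {c} c∈ = extend-rename {as = one a} {one b} {π = (a , b) ∷ []}
    (distinct-one a) (distinct-one b) (λ _ → swap-right a b) (swap-renames a b) c λ { _ (_ , refl) → a# c∈ }

  letrec-rename : ∀ {f : Atom → D} {as bs : Vec Atom n} .(u : Uniqueᵥ as) .{v} {ts r′} (ρ : Permutation′ n) π →
                  Renames ρ π as bs → as #* letrec bs v ts r′ → (c ∉ᵥ bs → c ∈FA letrec bs v ts r′) →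
                  extend (lookup bs ∘ (ρ ⟨$⟩ʳ_)) f c ≡ extend (lookup as) f (π ·ₐ c)
  letrec-rename {c = c} {as = as} {bs} u {v} ρ π ren as# c∈ = extend-rename {π = π} (unique⇒injective as u)
    (permute-distinct bs v ρ) (proj₁ ren) (renames-support ρ {π} ren) c
    λ { c∉ (k , refl) → as# k (c∈ (c∉ ∘ permute-free bs ρ ∘ ∈ᵥ⇒index)) }

  -- Each renaming made by a derivation of `_∼_` is undone by `≈-·`. Free atoms are then compared
  -- with themselves, which is why every f qualifies.
  ∼⇒≈ : ∀ {f : Atom → D} → e ∼ e′ → f , f ⊢ e ≈ e′
  ∼⇒≈ atom     = atom refl
  ∼⇒≈ (app ps) = app (λ i → ∼⇒≈ (ps i))
  ∼⇒≈ (lam p)  = lam (∼⇒≈ p)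
  ∼⇒≈ (lam-α {a} {b} {e′ = e′} a# p) =
    lam (≈-trans (∼⇒≈ p) (≈-sym (≈-· e′ ((a , b) ∷ []) (lam-rename a b a#))))
  ∼⇒≈ (letrec {u = u} {r′ = r′} ρ π ren as# ps p) = letrec ρ
    (λ i → ≈-trans (∼⇒≈ (ps i)) (≈-sym (≈-· _ π λ c∈ → letrec-rename u ρ π ren as# λ c∉ → letrec c∉ (ρ ⟨$⟩ʳ i) c∈)))
    (≈-trans (∼⇒≈ p) (≈-sym (≈-· r′ π λ c∈ → letrec-rename u ρ π ren as# λ c∉ → inside c∉ c∈)))

  -- align as bs π extends π to a renaming of bs to as; π records the swaps made so far.
  align : Vec Atom n → Vec Atom n → Perm → Perm
  align []       []       π = π
  align (a ∷ as) (b ∷ bs) π = align as bs ((a , π ·ₐ b) ∷ π)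

  align-other : ∀ (as bs : Vec Atom n) π → (∀ i → lookup as i ≢ π ·ₐ c) → (∀ i → lookup bs i ≢ c) →
                align as bs π ·ₐ c ≡ π ·ₐ c
  align-other []       []       π c∉as c∉bs = refl
  align-other {c = c} (a ∷ as) (b ∷ bs) π c∉as c∉bs =
    trans (align-other as bs _ (λ i p → c∉as (suc i) (trans p fixed)) (c∉bs ∘ suc)) fixed
    where
    fixed : swap a (π ·ₐ b) (π ·ₐ c) ≡ π ·ₐ c
    fixed = swap-other (c∉as zero ∘ sym) (c∉bs zero ∘ ·ₐ-injective π ∘ sym)

  -- The swapping just added sends b to a. The later ones exchange other atoms of `as` with images
  -- of other atoms of `bs`, all different from a by distinctness and by injectivity of
  -- permutations, so they leave this value alone.
  align-renames : ∀ (as bs : Vec Atom n) π → Distinct (lookup as) → Distinct (lookup bs) →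
                  ∀ i → align as bs π ·ₐ lookup bs i ≡ lookup as i
  align-renames (a ∷ as) (b ∷ bs) π das dbs zero = trans
    (align-other as bs _
      (λ i p → contradiction (das {suc i} {zero} (trans p (swap-right a (π ·ₐ b)))) λ ())
      (λ i p → contradiction (dbs {suc i} {zero} p) λ ()))
    (swap-right a (π ·ₐ b))
  align-renames (a ∷ as) (b ∷ bs) π das dbs (suc i) =
    align-renames as bs _ (suc-injective ∘ das) (suc-injective ∘ dbs) i

  reorder : {A : Set} → Vec A n → Permutation′ n → Vec A n
  reorder xs ρ = tabulate (λ i → lookup xs (ρ ⟨$⟩ʳ i))

  lookup-reorder : {A : Set} (xs : Vec A n) (ρ : Permutation′ n) → ∀ i → lookup (reorder xs ρ) i ≡ lookup xs (ρ ⟨$⟩ʳ i)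
  lookup-reorder xs ρ = Vec.lookup∘tabulate _

  aligning : Permutation′ n → Vec Atom n → Vec Atom n → Perm
  aligning ρ as bs = align as (reorder bs ρ) []

  aligning-renames : (ρ : Permutation′ n) (as bs : Vec Atom n) .(u : Uniqueᵥ as) .(v : Uniqueᵥ bs) →
                     Renames ρ (aligning ρ as bs) as bs
  aligning-renames {n} ρ as bs u v =
    (λ i → trans (cong (aligning ρ as bs ·ₐ_) (sym (lookup-reorder bs ρ i)))
                 (align-renames as (reorder bs ρ) [] (unique⇒injective as u) dbs i)) , supp
    where
    dbs : Distinct (lookup (reorder bs ρ))
    dbs eq = permute-distinct bs v ρ (trans (sym (lookup-reorder bs ρ _)) (trans eq (lookup-reorder bs ρ _)))
    supp : ∀ c → aligning ρ as bs ·ₐ c ≢ c → c ∈ᵥ as ⊎ c ∈ᵥ bs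
    supp c neq with c ∈ᵥ? as | c ∈ᵥ? bs
    ... | yes p | _     = inj₁ (index⇒∈ᵥ as p)
    ... | no  _ | yes p = inj₂ (index⇒∈ᵥ bs p)
    ... | no c∉ | no d∉ = contradiction
      (align-other as (reorder bs ρ) [] (λ i p → c∉ (i , p))
        (λ i p → d∉ (ρ ⟨$⟩ʳ i , trans (sym (lookup-reorder bs ρ i)) p))) neq

  -- Injectivity turns equal names back into equal atoms and is inherited by `extend`. The induction
  -- is on e rather than on the derivation, because the derivation is first composed with `≈-·` and
  -- is then no longer a subderivation.
  ≈⇒∼ : ∀ e {D} {f : Atom → D} → (∀ {a b} → f a ≡ f b → a ≡ b) → ∀ {e′} → f , f ⊢ e ≈ e′ → e ∼ e′
  ≈⇒∼ = exp-elim _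
    (λ { a inj (atom eq) → subst (λ b → atom a ∼ atom b) (inj eq) atom })
    (λ { a {e} IH inj (lam {b = b} p) → lam-case a e IH inj b p (a ≟ₐ b) })
    (λ { f IH inj (app ps) → app (λ i → IH i inj (ps i)) })
    (λ as u IHs IH inj p → letrec-case as u IHs IH inj p)
    (λ ()) (λ π ())
    where
    extend-injective : ∀ {D} {f : Atom → D} → (∀ {a b} → f a ≡ f b → a ≡ b) →
                       ∀ {n} (as : Fin n → Atom) → Distinct as →
                       ∀ {a b} → extend as f a ≡ extend as f b → a ≡ b
    extend-injective inj as das {a} {b} eq with any? (λ i → as i ≟ₐ a) | any? (λ i → as i ≟ₐ b)
    ... | yes (i , p) | yes (j , q) = trans (sym p) (trans (cong as (Sum.inj₁-injective eq)) q)
    ... | no _        | no _        = inj (Sum.inj₂-injective eq)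

    Reflects : LRL → Set₁
    Reflects e = ∀ {D} {f : Atom → D} → (∀ {a b} → f a ≡ f b → a ≡ b) → ∀ {e′} → f , f ⊢ e ≈ e′ → e ∼ e′

    lam-case : ∀ a e → Reflects e →
               ∀ {D} {f : Atom → D} → (∀ {a b} → f a ≡ f b → a ≡ b) →
               ∀ b {e′} → extend (one a) f , extend (one b) f ⊢ e ≈ e′ → Dec (a ≡ b) → lam a e ∼ lam b e′
    lam-case a e IH inj b p (yes refl) = lam (IH (extend-injective inj (one a) (distinct-one a)) p)
    lam-case a e IH {f = f} inj b {e′} p (no a≢b) = lam-α a# (IH (extend-injective inj (one a) (distinct-one a))
        (≈-trans p (≈-· e′ ((a , b) ∷ []) (lam-rename a b a#))))
      where
      a# : a # e′
      a# a∈ with ≈-free (≈-sym {f = f} {f} (lam p)) (lam a≢b a∈)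
      ... | d , lam d≢a _ , eq = d≢a (sym (inj eq))

    letrec-case : ∀ {n} (as : Vec Atom n) .(u : Uniqueᵥ as) {ss r} →
      (∀ i → Reflects (lookup ss i)) → Reflects r → Reflects (letrec as u ss r)
    letrec-case as u {ss} {r} IHs IH {f = f} inj q@(letrec {bs = bs} {v = v} {ts = ts} {r′ = r′} ρ ps p) =
      letrec ρ π ren as#
        (λ i → IHs i inj′ (≈-trans (ps i) (≈-· _ π λ c∈ → letrec-rename u ρ π ren as# λ c∉ → letrec c∉ (ρ ⟨$⟩ʳ i) c∈)))
        (IH inj′ (≈-trans p (≈-· r′ π λ c∈ → letrec-rename u ρ π ren as# λ c∉ → inside c∉ c∈)))
      where
      π = aligning ρ as bs
      ren = aligning-renames ρ as bs u v
      inj′ : ∀ {a b} → extend (lookup as) f a ≡ extend (lookup as) f b → a ≡ b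
      inj′ = extend-injective inj (lookup as) (unique⇒injective as u)
      -- An atom free on the right has a partner free on the left, which is the same atom by
      -- injectivity; but no atom free on the left is among `as`.
      as# : as #* letrec bs v ts r′
      as# k a∈ with ≈-free (≈-sym q) a∈
      ... | d , letrec d∉ _ _ , eq = d∉ (index⇒∈ᵥ as (k , inj eq))
      ... | d , inside d∉ _   , eq = d∉ (index⇒∈ᵥ as (k , inj eq))

  ∼-refl : e ∼ e
  ∼-refl {e} = ≈⇒∼ e {f = id} id ≈-refl

  ∼-sym : e ∼ e′ → e′ ∼ e
  ∼-sym p = ≈⇒∼ _ {f = id} id (≈-sym (∼⇒≈ p))

  ∼-trans : e ∼ e′ → e′ ∼ e″ → e ∼ e″
  ∼-trans p q = ≈⇒∼ _ {f = id} id (≈-trans (∼⇒≈ p) (∼⇒≈ q))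

  -- Both sides are compared with the unpermuted e, naming its atoms through `π ·ₐ_` and those of
  -- the image by themselves. This makes the choice of π in the letrec rule immaterial.
  ·-local : ∀ π π′ → (∀ {c} → c ∈FA e → π ·ₐ c ≡ π′ ·ₐ c) → π · e ∼ π′ · e
  ·-local {e} π π′ h = ≈⇒∼ _ {f = id} id
    (≈-trans (≈-sym {f = π ·ₐ_} (≈-· e π λ _ → refl)) (≈-· e π′ h))

  ·-resp-∼ : ∀ π → e ∼ e′ → π · e ∼ π · e′
  ·-resp-∼ {e} {e′} π p = ≈⇒∼ _ {f = id} id
    (≈-trans (≈-sym {f = π ·ₐ_} (≈-· e π λ _ → refl)) (≈-trans (∼⇒≈ p) (≈-· e′ π λ _ → refl)))

  ·-inverse : ∀ π π′ → (∀ c → π ·ₐ (π′ ·ₐ c) ≡ c) → π · (π′ · e) ∼ e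
  ·-inverse {e} π π′ h = ≈⇒∼ _ {f = id} id
    (≈-trans (≈-sym {f = π ·ₐ_} (≈-· (π′ · e) π λ _ → refl)) (≈-sym (≈-· e π′ λ {c} _ → sym (h c))))

  ·-⁻¹ʳ : ∀ π → π · e ∼ e′ → e ∼ (π ⁻¹) · e′
  ·-⁻¹ʳ π p = ∼-trans (∼-sym (·-inverse (π ⁻¹) π (·ₐ-⁻¹ˡ π))) (·-resp-∼ (π ⁻¹) p)

  ·-⁻¹ˡ : ∀ π → e ∼ (π ⁻¹) · e′ → π · e ∼ e′
  ·-⁻¹ˡ π p = ∼-trans (·-resp-∼ π p) (·-inverse π (π ⁻¹) (·ₐ-⁻¹ʳ π))

-- Permutations and decidability

allPermutations : ∀ n → List (Permutation′ n)
allPermutations zero    = idₚ ∷ []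
allPermutations (suc n) = concatMap (λ j → map (insert zero j) (allPermutations n)) (allFin (suc n))

allPermutations-complete : ∀ {n} (ρ : Permutation′ n) → Any (ρ ≈ₚ_) (allPermutations n)
allPermutations-complete {zero}  ρ = here λ ()
allPermutations-complete {suc n} ρ =
  Any.concatMap⁺ (λ j → map (insert zero j) (allPermutations n)) (Any.map
    (λ { refl → Any.map⁺ (Any.map extend (allPermutations-complete (remove zero ρ))) })
    (∈ₚ.∈-allFin (ρ ⟨$⟩ʳ zero)))
  where
  extend : ∀ {ρ′} → remove zero ρ ≈ₚ ρ′ → ρ ≈ₚ insert zero (ρ ⟨$⟩ʳ zero) ρ′
  extend eq zero    = refl
  extend {ρ′} eq (suc i) = begin
    ρ ⟨$⟩ʳ suc i                                    ≡⟨ sym (insert-remove zero ρ (suc i)) ⟩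
    insert zero (ρ ⟨$⟩ʳ zero) (remove zero ρ) ⟨$⟩ʳ suc i  ≡⟨ cong (punchIn (ρ ⟨$⟩ʳ zero)) (eq i) ⟩
    insert zero (ρ ⟨$⟩ʳ zero) ρ′ ⟨$⟩ʳ suc i          ∎
    where open ≡-Reasoning

permutationDecSetoid : ℕ → DecSetoid _ _
permutationDecSetoid n = record
  { Carrier = Permutation′ n
  ; _≈_ = _≈ₚ_
  ; isDecEquivalence = record
    { isEquivalence = record
      { refl = λ _ → refl ; sym = λ p i → sym (p i) ; trans = λ p q i → trans (p i) (q i) }
    ; _≟_ = λ ρ ρ′ → all? (λ i → (ρ ⟨$⟩ʳ i) ≟ᶠ (ρ′ ⟨$⟩ʳ i)) } }

-- Deduplication gives the distinctness demanded by `Enumerates` without an analysis of `insert`.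
permutations : ∀ n → List (Permutation′ n)
permutations n = deduplicate (DecSetoid._≟_ (permutationDecSetoid n)) (allPermutations n)

permutations-complete : ∀ {n} (ρ : Permutation′ n) → Any (ρ ≈ₚ_) (permutations n)
permutations-complete {n} ρ = Any.deduplicate⁺ (DecSetoid._≟_ (permutationDecSetoid n))
  (λ p q i → trans (q i) (sym (p i))) (allPermutations-complete ρ)

permutations-distinct : ∀ n → AllPairs (λ ρ ρ′ → ¬ ρ ≈ₚ ρ′) (permutations n)
permutations-distinct n = UniqueDecSetoid.deduplicate-! (permutationDecSetoid n) (allPermutations n)

lookup-distinct : ∀ {A : Set} {R : A → A → Set} → (∀ {x y} → R x y → R y x) → ∀ {xs} → AllPairs (λ x y → ¬ R x y) xs →
                  ∀ i j → R (Data.List.lookup xs i) (Data.List.lookup xs j) → i ≡ j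
lookup-distinct R-sym (_ ∷ _)  zero    zero    _ = refl
lookup-distinct R-sym (p ∷ _)  zero    (suc j) r = contradiction r (All.lookup p (∈ₚ.∈-lookup j))
lookup-distinct R-sym (p ∷ _)  (suc i) zero    r = contradiction (R-sym r) (All.lookup p (∈ₚ.∈-lookup i))
lookup-distinct R-sym (_ ∷ ps) (suc i) (suc j) r = cong suc (lookup-distinct R-sym ps i j r)

n≤2^n : ∀ n → n ≤ 2 ^ n
n≤2^n zero    = z≤n
n≤2^n (suc n) = +-mono-≤ (ℕ.m^n>0 2 n) (≤-trans (n≤2^n n) (m≤m+n (2 ^ n) 0))

-- Permutations that differ pointwise are different functions, so there are at most `n ^ n` of them,
-- and `n ≤ 2 ^ n` turns this into a power of two.
distinct-permutations-length : ∀ {n} {ρs : List (Permutation′ n)} → AllPairs (λ ρ ρ′ → ¬ ρ ≈ₚ ρ′) ρs →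
                               length ρs ≤ 2 ^ (n * n)
distinct-permutations-length {n} {ρs} distinct = ≤-trans (injective⇒≤ code-injective)
  (≤-trans (ℕ.^-monoˡ-≤ n (n≤2^n n)) (≤-reflexive (ℕ.^-*-assoc 2 n n)))
  where
  code : Fin (length ρs) → Fin (n ^ n)
  code k = funToFin (Data.List.lookup ρs k ⟨$⟩ʳ_)
  code-injective : Injective _≡_ _≡_ code
  code-injective {k} {l} eq = lookup-distinct (λ p i → sym (p i)) distinct k l λ i →
    trans (sym (finToFun-funToFin (Data.List.lookup ρs k ⟨$⟩ʳ_) i))
          (trans (cong (λ c → finToFun c i) eq) (finToFun-funToFin (Data.List.lookup ρs l ⟨$⟩ʳ_) i))

module Decidability (S : Signature) where
  open Nominal S public

  private variable
    n : ℕ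
    D : Set

  -- The enumeration contains a permutation only up to pointwise equality, hence the premise that P
  -- respects it.
  any-permutation? : ∀ {P : Permutation′ n → Set} → (∀ ρ → Dec (P ρ)) → (∀ {ρ ρ′} → ρ ≈ₚ ρ′ → P ρ → P ρ′) → Dec (∃ P)
  any-permutation? {n = n} {P} P? resp with Any.any? P? (permutations n)
  ... | yes p = yes (Any.lookup p , Any.lookup-result p)
  ... | no ¬p = no λ (ρ , Pρ) → ¬p (Any.map (λ eq → resp eq Pρ) (permutations-complete ρ))

  -- At a `letrec` the search is over ρ alone, which is finite. D is arbitrary because each binder
  -- enlarges it.
  ≈-dec : ∀ e {D} → DecidableEquality D → ∀ (f g : Atom → D) e′ → Dec (f , g ⊢ e ≈ e′)
  ≈-dec = exp-elim _ atom-case lam-case app-case letrec-case (λ ()) (λ _ ())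
    where
    ≈-Decidable : LRL → Set₁
    ≈-Decidable e = ∀ {D} → DecidableEquality D → ∀ (f g : Atom → D) e′ → Dec (f , g ⊢ e ≈ e′)

    atom-case : ∀ a → ≈-Decidable (atom a)
    atom-case a _≟_ f g (atom b) = map′ atom (λ { (atom p) → p }) (f a ≟ g b)
    atom-case a _≟_ f g (lam _ _) = no λ ()
    atom-case a _≟_ f g (app _ _) = no λ ()
    atom-case a _≟_ f g (letrec _ _ _ _) = no λ ()

    lam-case : ∀ a {e} → ≈-Decidable e → ≈-Decidable (lam a e)
    lam-case a IH _≟_ f g (atom _) = no λ ()
    lam-case a IH _≟_ f g (lam b e′) = map′ lam (λ { (lam p) → p }) (IH (Sum.≡-dec _≟ᶠ_ _≟_) _ _ e′)
    lam-case a IH _≟_ f g (app _ _) = no λ ()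
    lam-case a IH _≟_ f g (letrec _ _ _ _) = no λ ()

    app-case : ∀ h {es} → (∀ i → ≈-Decidable (lookup es i)) → ≈-Decidable (app h es)
    app-case h IH _≟_ f g (atom _) = no λ ()
    app-case h IH _≟_ f g (lam _ _) = no λ ()
    app-case h IH _≟_ f g (app k es′) with h ≟f k
    ... | yes refl = map′ app (λ { (app ps) → ps }) (all? λ i → IH i _≟_ f g (lookup es′ i))
    ... | no h≢k   = no λ { (app _) → h≢k refl }
    app-case h IH _≟_ f g (letrec _ _ _ _) = no λ ()

    letrec-case : ∀ {n} (as : Vec Atom n) .(u : Uniqueᵥ as) {ss r} →
                  (∀ i → ≈-Decidable (lookup ss i)) → ≈-Decidable r → ≈-Decidable (letrec as u ss r)
    letrec-case as u IHs IH _≟_ f g (atom _) = no λ ()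
    letrec-case as u IHs IH _≟_ f g (lam _ _) = no λ ()
    letrec-case as u IHs IH _≟_ f g (app _ _) = no λ ()
    letrec-case {n} as u {ss} {r} IHs IH _≟_ f g (letrec {m} bs v ts r′) with n ℕ.≟ m
    ... | no n≢m   = no λ { (letrec _ _ _) → n≢m refl }
    ... | yes refl = map′ (λ (ρ , ps , p) → letrec ρ ps p) (λ { (letrec ρ ps p) → ρ , ps , p })
      (any-permutation? (λ ρ → all? (λ i → IHs i (Sum.≡-dec _≟ᶠ_ _≟_) _ _ (lookup ts (ρ ⟨$⟩ʳ i)))
                               ×-dec IH (Sum.≡-dec _≟ᶠ_ _≟_) _ _ r′) (λ {ρ} {ρ′} → resp {ρ} {ρ′}))
      where
      Body : Permutation′ n → Set
      Body ρ = (∀ i → extend (lookup as) f , extend (lookup bs ∘ (ρ ⟨$⟩ʳ_)) g ⊢ lookup ss i ≈ lookup ts (ρ ⟨$⟩ʳ i)) ×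
               extend (lookup as) f , extend (lookup bs ∘ (ρ ⟨$⟩ʳ_)) g ⊢ r ≈ r′
      resp : ∀ {ρ ρ′} → ρ ≈ₚ ρ′ → Body ρ → Body ρ′
      resp {ρ} {ρ′} eq (ps , p) =
        (λ i → subst (λ k → _ , _ ⊢ lookup ss i ≈ lookup ts k) (eq i) (reindex (ps i))) , reindex p
        where
        reindex : ∀ {e e′} → extend (lookup as) f , extend (lookup bs ∘ (ρ ⟨$⟩ʳ_)) g ⊢ e ≈ e′ →
                  extend (lookup as) f , extend (lookup bs ∘ (ρ′ ⟨$⟩ʳ_)) g ⊢ e ≈ e′
        reindex = ≈-relabel idₚ (unique⇒injective as u) (unique⇒injective as u)
          (permute-distinct bs v ρ) (permute-distinct bs v ρ′) (λ _ → refl) (λ i → cong (lookup bs) (sym (eq i)))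

  _∼?_ : ∀ e e′ → Dec (e ∼ e′)
  e ∼? e′ = map′ (≈⇒∼ e {f = id} id) ∼⇒≈ (≈-dec e _≟ₐ_ id id e′)

  mutual
    -- Written with the recursion of `occursBody` and its companions, so that the program can be
    -- specified by an equation against it.
    occurs : Atom → LRL → Bool
    occurs c (atom a)           = does (a ≟ₐ c)
    occurs c (lam a e)          = if does (a ≟ₐ c) then false else occurs c e
    occurs c (app f es)         = occurs* c es
    occurs c (letrec as u es e) = occursᵇ c as es (occurs c e)

    occurs* : Atom → Vec LRL n → Bool
    occurs* c []       = false
    occurs* c (e ∷ es) = occurs c e ∨ occurs* c es

    -- acc says whether c occurs free in the part of the letrec scanned so far.
    occursᵇ : Atom → Vec Atom n → Vec LRL n → Bool → Bool
    occursᵇ c []       []       acc = acc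
    occursᵇ c (a ∷ as) (e ∷ es) acc = if does (a ≟ₐ c) then false else occursᵇ c as es (acc ∨ occurs c e)

  occurs*⁻ : ∀ c (es : Vec LRL n) → occurs* c es ≡ true → ∃[ i ] occurs c (lookup es i) ≡ true
  occurs*⁻ c (e ∷ es) eq with occurs c e in p
  ... | true  = zero , p
  ... | false with occurs*⁻ c es eq
  ...   | i , q = suc i , q

  occurs*⁺ : ∀ c (es : Vec LRL n) i → occurs c (lookup es i) ≡ true → occurs* c es ≡ true
  occurs*⁺ c (e ∷ es) zero    p rewrite p = refl
  occurs*⁺ c (e ∷ es) (suc i) p with occurs c e
  ... | true  = refl
  ... | false = occurs*⁺ c es i p

  occursᵇ⁻ : ∀ c (as : Vec Atom n) es acc → occursᵇ c as es acc ≡ true →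
             c ∉ᵥ as × (acc ≡ true ⊎ ∃[ i ] occurs c (lookup es i) ≡ true)
  occursᵇ⁻ c []       []       acc eq = (λ ()) , inj₁ eq
  occursᵇ⁻ c (a ∷ as) (e ∷ es) acc eq with a ≟ₐ c
  ... | no a≢c with occursᵇ⁻ c as es (acc ∨ occurs c e) eq
  ...   | c∉ , inj₂ (i , p) = (λ { (Anyᵥ.here refl) → a≢c refl ; (Anyᵥ.there c∈) → c∉ c∈ }) , inj₂ (suc i , p)
  ...   | c∉ , inj₁ p with acc
  ...     | true  = (λ { (Anyᵥ.here refl) → a≢c refl ; (Anyᵥ.there c∈) → c∉ c∈ }) , inj₁ refl
  ...     | false = (λ { (Anyᵥ.here refl) → a≢c refl ; (Anyᵥ.there c∈) → c∉ c∈ }) , inj₂ (zero , p)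

  occursᵇ⁺ : ∀ c (as : Vec Atom n) es acc → c ∉ᵥ as → acc ≡ true ⊎ ∃[ i ] occurs c (lookup es i) ≡ true →
             occursᵇ c as es acc ≡ true
  occursᵇ⁺ c []       []       acc c∉ (inj₁ p) = p
  occursᵇ⁺ c (a ∷ as) (e ∷ es) acc c∉ p with a ≟ₐ c
  ... | yes refl = contradiction (Anyᵥ.here refl) c∉
  ... | no  _    = occursᵇ⁺ c as es _ (c∉ ∘ Anyᵥ.there) (next p)
    where
    next : acc ≡ true ⊎ ∃[ i ] occurs c (lookup (e ∷ es) i) ≡ true →
           acc ∨ occurs c e ≡ true ⊎ ∃[ i ] occurs c (lookup es i) ≡ true
    next (inj₁ refl)        = inj₁ refl
    next (inj₂ (zero  , q)) rewrite q = inj₁ (Bool.∨-zeroʳ acc)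
    next (inj₂ (suc i , q)) = inj₂ (i , q)

  occurs⇒∈FA : ∀ {c} e → occurs c e ≡ true → c ∈FA e
  occurs⇒∈FA {c} = exp-elim _ atom-case lam-case
    (λ f {es} IH p → let i , q = occurs*⁻ c es p in app i (IH i q))
    (λ as u {es} {e} IHs IH p → letrec-case as u IHs IH (occursᵇ⁻ c as es _ p))
    (λ ()) (λ _ ())
    where
    atom-case : ∀ a → occurs c (atom a) ≡ true → c ∈FA atom a
    atom-case a p with a ≟ₐ c
    ... | yes refl = atom
    lam-case : ∀ a {e} → (occurs c e ≡ true → c ∈FA e) → occurs c (lam a e) ≡ true → c ∈FA lam a e
    lam-case a IH p with a ≟ₐ c
    ... | no a≢c = lam (a≢c ∘ sym) (IH p)
    letrec-case : ∀ {n} (as : Vec Atom n) .(u : Uniqueᵥ as) {es e} →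
      (∀ i → occurs c (lookup es i) ≡ true → c ∈FA lookup es i) → (occurs c e ≡ true → c ∈FA e) →
      c ∉ᵥ as × (occurs c e ≡ true ⊎ ∃[ i ] occurs c (lookup es i) ≡ true) → c ∈FA letrec as u es e
    letrec-case as u IHs IH (c∉ , inj₁ p)       = inside c∉ (IH p)
    letrec-case as u IHs IH (c∉ , inj₂ (i , p)) = letrec c∉ i (IHs i p)

  ∈FA⇒occurs : ∀ {c e} → c ∈FA e → occurs c e ≡ true
  ∈FA⇒occurs {c} atom with c ≟ₐ c
  ... | yes _ = refl
  ... | no ¬p = contradiction refl ¬p
  ∈FA⇒occurs {c} (lam {a} c≢a c∈) with a ≟ₐ c
  ... | yes refl = contradiction refl c≢a
  ... | no  _    = ∈FA⇒occurs c∈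
  ∈FA⇒occurs (app {es = es} i c∈) = occurs*⁺ _ es i (∈FA⇒occurs c∈)
  ∈FA⇒occurs (letrec {as = as} {es = es} c∉ i c∈) = occursᵇ⁺ _ as es _ c∉ (inj₂ (i , ∈FA⇒occurs c∈))
  ∈FA⇒occurs (inside {as = as} {es = es} c∉ c∈)   = occursᵇ⁺ _ as es _ c∉ (inj₁ (∈FA⇒occurs c∈))

  _∈FA?_ : ∀ c e → Dec (c ∈FA e)
  c ∈FA? e = map′ (occurs⇒∈FA e) ∈FA⇒occurs (occurs c e Bool.≟ true)

-- Matchers and rules

module Rules (S : Signature) where
  open Decidability S public

  private variable
    n : ℕ
    A B C : Set
    Γ Γ′ Δ : Problem
    σ τ : Subst
    q : Equation

  All-toList⁺ : ∀ {P : A → Set} (v : Vec A n) → (∀ i → P (lookup v i)) → All P (toList v)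
  All-toList⁺ []      h = []
  All-toList⁺ (x ∷ v) h = h zero ∷ All-toList⁺ v (h ∘ suc)

  All-toList⁻ : ∀ {P : A → Set} (v : Vec A n) → All P (toList v) → ∀ i → P (lookup v i)
  All-toList⁻ (x ∷ v) (p ∷ ps) zero    = p
  All-toList⁻ (x ∷ v) (p ∷ ps) (suc i) = All-toList⁻ v ps i

  Any-toList⁺ : ∀ {P : A → Set} (v : Vec A n) i → P (lookup v i) → Any P (toList v)
  Any-toList⁺ (x ∷ v) zero    p = here p
  Any-toList⁺ (x ∷ v) (suc i) p = there (Any-toList⁺ v i p)

  map-just : ∀ {f : A → B} {m y} → mapMaybe f m ≡ just y → ∃[ x ] m ≡ just x × f x ≡ y
  map-just {m = just x} refl = x , refl , refl

  zipWith-just : ∀ {f : A → B → C} {m m′ z} → zipWith f m m′ ≡ just z →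
                 ∃[ x ] ∃[ y ] m ≡ just x × m′ ≡ just y × f x y ≡ z
  zipWith-just {m = just x} {just y} refl = x , y , refl , refl , refl

  ⟨⟩*-just⁻ : ∀ (ss : Vec LRLX n) {es} → ss ⟨ σ ⟩* ≡ just es → ∀ i → lookup ss i ⟨ σ ⟩ ≡ just (lookup es i)
  ⟨⟩*-just⁻ {σ = σ} (s ∷ ss) eq i with zipWith-just {m = s ⟨ σ ⟩} {ss ⟨ σ ⟩*} eq
  ⟨⟩*-just⁻ (s ∷ ss) eq zero    | _ , _ , p , _ , refl = p
  ⟨⟩*-just⁻ (s ∷ ss) eq (suc i) | _ , _ , _ , p , refl = ⟨⟩*-just⁻ ss p i

  ⟨⟩*-just⁺ : ∀ (ss : Vec LRLX n) (es : Fin n → LRL) → (∀ i → lookup ss i ⟨ σ ⟩ ≡ just (es i)) →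
              ss ⟨ σ ⟩* ≡ just (tabulate es)
  ⟨⟩*-just⁺ []       es h = refl
  ⟨⟩*-just⁺ (s ∷ ss) es h rewrite h zero | ⟨⟩*-just⁺ ss (es ∘ suc) (h ∘ suc) = refl

  Matches : Subst → Equation → Set
  Matches σ q = ∃[ e ] lhs q ⟨ σ ⟩ ≡ just e × e ∼ rhs q

  matches-app⁺ : ∀ {f} {ss : Vec LRLX (ar f)} {ts} → (∀ i → Matches σ (lookup ss i ⊴ lookup ts i)) →
                 Matches σ (app f ss ⊴ app f ts)
  matches-app⁺ {σ = σ} {f} {ss} {ts} h = app f (tabulate (proj₁ ∘ h)) ,
    cong (mapMaybe (app f)) (⟨⟩*-just⁺ ss (proj₁ ∘ h) (proj₁ ∘ proj₂ ∘ h)) ,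
    app λ i → subst (_∼ lookup ts i) (sym (Vec.lookup∘tabulate _ i)) (proj₂ (proj₂ (h i)))

  matches-app⁻ : ∀ {f} {ss : Vec LRLX (ar f)} {ts} → Matches σ (app f ss ⊴ app f ts) →
                 ∀ i → Matches σ (lookup ss i ⊴ lookup ts i)
  matches-app⁻ {σ = σ} {ss = ss} (_ , eq , e∼) with map-just {m = ss ⟨ σ ⟩*} eq
  matches-app⁻ {ss = ss} (_ , eq , app ps) | es , p , refl = λ i → lookup es i , ⟨⟩*-just⁻ ss p i , ps i

  matches-letrecEqs⁺ : ∀ (ρ : Permutation′ n) π ss {r ts r′} → Matches σ (r ⊴ π · r′) →
                       (∀ i → Matches σ (lookup ss i ⊴ π · lookup ts (ρ ⟨$⟩ʳ i))) →
                       Matcher (letrecEqs ρ π ss r ts r′) σ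
  matches-letrecEqs⁺ {σ = σ} ρ π ss m ms =
    m ∷ All-toList⁺ _ (λ i → subst (Matches σ) (sym (Vec.lookup∘tabulate _ i)) (ms i))

  matches-letrec⁺ : ∀ {as bs : Vec Atom n} .{u v} {ss r ts r′} ρ π → Renames ρ π as bs → as #* letrec bs v ts r′ →
                    Matcher (letrecEqs ρ π ss r ts r′) σ → Matches σ (letrec as u ss r ⊴ letrec bs v ts r′)
  matches-letrec⁺ {σ = σ} {as} {u = u} {ss = ss} {r} {ts} {r′} ρ π ren as# ((e , eq , e∼) ∷ ms) =
    letrec as u (tabulate (proj₁ ∘ ms′)) e ,
    trans (cong (λ m → zipWith (letrec as u) m (r ⟨ σ ⟩)) (⟨⟩*-just⁺ ss (proj₁ ∘ ms′) (proj₁ ∘ proj₂ ∘ ms′)))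
          (cong (zipWith (letrec as u) (just _)) eq) ,
    letrec ρ π ren as# (λ i → subst (_∼ _) (sym (Vec.lookup∘tabulate _ i)) (proj₂ (proj₂ (ms′ i)))) e∼
    where
    ms′ : ∀ i → Matches σ (lookup ss i ⊴ π · lookup ts (ρ ⟨$⟩ʳ i))
    ms′ i = subst (Matches σ) (Vec.lookup∘tabulate _ i) (All-toList⁻ _ ms i)

  -- The permutation ρ is read off the derivation of `_∼_`. The conclusion is general in ρ′ and π
  -- because an enumeration offers ρ only up to pointwise equality and the algorithm chooses its own
  -- renaming. On a bound atom both renamings are prescribed; an atom free in the right-hand side
  -- lies outside `as` by freshness, so both fix it.
  matches-letrec⁻ : ∀ {as bs : Vec Atom n} .{u v} {ss r ts r′} → Matches σ (letrec as u ss r ⊴ letrec bs v ts r′) →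
                    as #* letrec bs v ts r′ ×
                    ∃[ ρ ] (∀ ρ′ π → ρ ≈ₚ ρ′ → Renames ρ′ π as bs → Matcher (letrecEqs ρ′ π ss r ts r′) σ)
  matches-letrec⁻ {σ = σ} {ss = ss} {r} (_ , eq , e∼) with zipWith-just {m = ss ⟨ σ ⟩*} {r ⟨ σ ⟩} eq
  matches-letrec⁻ {σ = σ} {as} {bs} {u} {v} {ss} {r} {ts} {r′} (_ , eq , letrec ρ π ren as# ps p)
    | es , e , eqs , eq′ , refl = as# , ρ , λ ρ′ π′ ρ≈ ren′ → matches-letrecEqs⁺ {σ = σ} ρ′ π′ ss {r} {ts} {r′}
      (e , eq′ , ∼-trans p (·-local π π′ λ c∈ → agree ρ′ π′ ρ≈ ren′ (λ c∉ → inside c∉ c∈)))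
      (λ i → lookup es i , ⟨⟩*-just⁻ ss eqs i ,
        subst (λ k → lookup es i ∼ π′ · lookup ts k) (ρ≈ i)
          (∼-trans (ps i) (·-local π π′ λ c∈ → agree ρ′ π′ ρ≈ ren′ (λ c∉ → letrec c∉ (ρ ⟨$⟩ʳ i) c∈))))
    where
    agree : ∀ ρ′ π′ → ρ ≈ₚ ρ′ → Renames ρ′ π′ as bs → ∀ {c} → (c ∉ᵥ bs → c ∈FA letrec bs v ts r′) →
            π ·ₐ c ≡ π′ ·ₐ c
    agree ρ′ π′ ρ≈ ren′ {c} c∈ with bound? (lookup bs ∘ (ρ ⟨$⟩ʳ_)) c
    ... | bound i = trans (proj₁ ren i)
      (sym (trans (cong (λ k → π′ ·ₐ lookup bs k) (ρ≈ i)) (proj₁ ren′ i)))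
    ... | free c∉ = trans (fixes-others {π = π} (proj₂ ren c) outside)
                          (sym (fixes-others {π = π′} (proj₂ ren′ c) outside))
      where
      c∉bs : c ∉ᵥ bs
      c∉bs = c∉ ∘ permute-free bs ρ ∘ ∈ᵥ⇒index
      outside : ¬ (c ∈ᵥ as ⊎ c ∈ᵥ bs)
      outside (inj₂ c∈bs) = c∉bs c∈bs
      outside (inj₁ c∈as) with ∈ᵥ⇒index c∈as
      ... | k , refl = as# k (c∈ c∉bs)

  ≐⇒matches : ∀ {s t} → s ≐ t → Matches σ (s ⊴ t)
  ≐⇒matches atom = _ , refl , atom
  ≐⇒matches {σ = σ} (lam {a} p) with ≐⇒matches {σ = σ} p
  ... | e , eq , e∼ = lam a e , cong (mapMaybe (lam a)) eq , lam e∼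
  ≐⇒matches {σ = σ} (app {f} {ss} {ts} ps) = matches-app⁺ {σ = σ} {f} {ss} {ts} (λ i → ≐⇒matches {σ = σ} (ps i))
  ≐⇒matches {σ = σ} (letrec {as = as} {bs} {u} {v} {ss} {ts} {r} {r′} ρ eqs ps p) =
    -- The binders agree up to order, so the empty list of swappings is a renaming, and they are
    -- fresh because they are bound on the right as well.
    matches-letrec⁺ {σ = σ} {ss = ss} {r} {ts} {r′} ρ [] ((λ i → sym (eqs i)) , λ c neq → contradiction refl neq)
      (λ i a∈ → not-free (sym (eqs i)) a∈)
      (matches-letrecEqs⁺ {σ = σ} ρ [] ss {r} {ts} {r′} (id-instance {r} (≐⇒matches p))
        (λ i → id-instance {lookup ss i} (≐⇒matches (ps i))))
    where
    id-instance : ∀ {s t} → Matches σ (s ⊴ t) → Matches σ (s ⊴ [] · t)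
    id-instance {t = t} (e , eq , e∼) = e , eq , ∼-trans e∼ (≈⇒∼ t {f = id} id (≈-· t [] λ _ → refl))
    not-free : ∀ {i a} → lookup bs i ≡ a → a # letrec bs v ts r′
    not-free {i} refl (letrec c∉ _ _) = c∉ (∈ᵥ.∈-lookup i bs)
    not-free {i} refl (inside c∉ _)   = c∉ (∈ᵥ.∈-lookup i bs)

  zipWith-tabulate : ∀ {f : A → B → C} (xs : Vec A n) ys →
                     Vec.zipWith f xs ys ≡ tabulate (λ i → f (lookup xs i) (lookup ys i))
  zipWith-tabulate []       []       = refl
  zipWith-tabulate (x ∷ xs) (y ∷ ys) = cong (_ ∷_) (zipWith-tabulate xs ys)

  Matcher-zip⁺ : ∀ (ss : Vec LRLX n) ts → (∀ i → Matches σ (lookup ss i ⊴ lookup ts i)) →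
                 Matcher (toList (Vec.zipWith _⊴_ ss ts)) σ
  Matcher-zip⁺ {σ = σ} ss ts h = All-toList⁺ _ λ i → subst (Matches σ) (sym (Vec.lookup-zipWith _⊴_ i ss ts)) (h i)

  Matcher-zip⁻ : ∀ (ss : Vec LRLX n) ts → Matcher (toList (Vec.zipWith _⊴_ ss ts)) σ →
                 (∀ i → Matches σ (lookup ss i ⊴ lookup ts i))
  Matcher-zip⁻ {σ = σ} ss ts ms i = subst (Matches σ) (Vec.lookup-zipWith _⊴_ i ss ts) (All-toList⁻ _ ms i)

  matches-lam⁻ : ∀ {a b s t} → Matches σ (lam a s ⊴ lam b t) →
                 (a ≡ b × Matches σ (s ⊴ t)) ⊎ (a # t × Matches σ (s ⊴ ((a , b) ∷ []) · t))
  matches-lam⁻ {σ = σ} {s = s} (_ , eq , e∼) with map-just {m = s ⟨ σ ⟩} eq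
  matches-lam⁻ (_ , eq , lam e∼)      | e , p , refl = inj₁ (refl , e , p , e∼)
  matches-lam⁻ (_ , eq , lam-α a# e∼) | e , p , refl = inj₂ (a# , e , p , e∼)

  matches-lam≡ : ∀ {a s t} → Matches σ (lam a s ⊴ lam a t) → Matches σ (s ⊴ t)
  matches-lam≡ {σ = σ} {s = s} m with matches-lam⁻ {σ = σ} {s = s} m
  ... | inj₁ (_ , m′)           = m′
  -- The rule `lam-α` admits equal binders; swapping an atom with itself acts as the identity.
  matches-lam≡ {a = a} {t = t} _ | inj₂ (_ , e , eq , e∼) =
    e , eq , ∼-trans e∼ (≈⇒∼ _ {f = id} id (≈-sym (≈-· t ((a , a) ∷ []) λ {c} _ → sym (swap-same a c))))
    where
    swap-same : ∀ a c → swap a a c ≡ c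
    swap-same a c with c ≟ₐ a
    ... | yes p = sym p
    ... | no  _ = refl

  matches-susp⁺ : ∀ {π X e} → Matches σ (var X ⊴ π ⁻¹ · e) → Matches σ (susp π X ⊴ e)
  matches-susp⁺ {π = π} (d , eq , d∼) = π · d , cong (mapMaybe (π ·_)) eq , ·-⁻¹ˡ π d∼

  matches-susp⁻ : ∀ {π X e} → Matches σ (susp π X ⊴ e) → Matches σ (var X ⊴ π ⁻¹ · e)
  matches-susp⁻ {σ = σ} {π} {X} (_ , eq , e∼) with map-just {m = σ ‼ X} eq
  ... | d , p , refl = d , p , ·-⁻¹ʳ π e∼

  ⟶ˢ-sound : Γ ⟶ˢ Γ′ → Matcher Γ′ σ → Matcher Γ σ
  ⟶ˢ-sound (delete p s≐t) ms = ↭.All-resp-↭ (↭-sym p) (≐⇒matches s≐t ∷ ms)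
  ⟶ˢ-sound (app {ss = ss} {ts} p) ms with All.++⁻ (toList (Vec.zipWith _⊴_ ss ts)) ms
  ... | ms₁ , ms₂ = ↭.All-resp-↭ (↭-sym p) (matches-app⁺ {ss = ss} {ts} (Matcher-zip⁻ ss ts ms₁) ∷ ms₂)
  ⟶ˢ-sound (lam p) ((e , eq , e∼) ∷ ms) =
    ↭.All-resp-↭ (↭-sym p) ((lam _ e , cong (mapMaybe (lam _)) eq , lam e∼) ∷ ms)
  ⟶ˢ-sound (lam-α p _ a#) ((e , eq , e∼) ∷ ms) =
    ↭.All-resp-↭ (↭-sym p) ((lam _ e , cong (mapMaybe (lam _)) eq , lam-α a# e∼) ∷ ms)
  ⟶ˢ-sound {σ = σ} (susp {π = π} {X} p) (m ∷ ms) =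
    ↭.All-resp-↭ (↭-sym p) (matches-susp⁺ {σ = σ} {π} {X} m ∷ ms)
  ⟶ˢ-sound (merge p e₁∼e₂) (m@(e , eq , e∼) ∷ ms) =
    ↭.All-resp-↭ (↭-sym p) (m ∷ (e , eq , ∼-trans e∼ e₁∼e₂) ∷ ms)

  ⟶-sound : Γ ⟶ Γ′ → Matcher Γ′ σ → Matcher Γ σ
  ⟶-sound (simplify st) ms = ⟶ˢ-sound st ms
  ⟶-sound {σ = σ} (letrec {ss = ss} {r} {ts} {r′} p as# ρ π ren) ms with All.++⁻ (letrecEqs ρ π ss r ts r′) ms
  ... | ms₁ , ms₂ = ↭.All-resp-↭ (↭-sym p) (matches-letrec⁺ {σ = σ} {ss = ss} {r} ρ π ren as# ms₁ ∷ ms₂)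

  ⟶ˢ-complete : Γ ⟶ˢ Γ′ → Matcher Γ σ → Matcher Γ′ σ
  ⟶ˢ-complete (delete p _) ms with ↭.All-resp-↭ p ms
  ... | _ ∷ ms′ = ms′
  ⟶ˢ-complete (app {ss = ss} {ts} p) ms with ↭.All-resp-↭ p ms
  ... | m ∷ ms′ = All.++⁺ (Matcher-zip⁺ ss ts (matches-app⁻ {ss = ss} m)) ms′
  ⟶ˢ-complete {σ = σ} (lam {s = s} p) ms with ↭.All-resp-↭ p ms
  ... | m ∷ ms′ = matches-lam≡ {σ = σ} {s = s} m ∷ ms′
  ⟶ˢ-complete {σ = σ} (lam-α {s = s} p a≢b _) ms with ↭.All-resp-↭ p ms
  ... | m ∷ ms′ with matches-lam⁻ {σ = σ} {s = s} m
  ...   | inj₁ (a≡b , _) = contradiction a≡b a≢b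
  ...   | inj₂ (_ , m′)  = m′ ∷ ms′
  ⟶ˢ-complete {σ = σ} (susp {π = π} {X} p) ms with ↭.All-resp-↭ p ms
  ... | m ∷ ms′ = matches-susp⁻ {σ = σ} {π} {X} m ∷ ms′
  ⟶ˢ-complete (merge p _) ms with ↭.All-resp-↭ p ms
  ... | m ∷ _ ∷ ms′ = m ∷ ms′

  fails-unmatchable : Fails Γ → ¬ Matcher Γ σ
  fails-unmatchable {σ = σ} (letrec {ss = ss} {r} q∈ (i , ¬a#)) ms =
    ¬a# (proj₁ (matches-letrec⁻ {σ = σ} {ss = ss} {r} (All.lookup ms q∈)) i)
  fails-unmatchable {σ = σ} (clash {s} q∈ ps pt x≢y) ms = clash-unmatchable {s} ps pt x≢y (All.lookup ms q∈)
    where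
    clash-unmatchable : ∀ {s t x y} → top s ≡ just x → top t ≡ just y → x ≢ y → ¬ Matches σ (s ⊴ t)
    clash-unmatchable {s = atom a} refl refl x≢y (_ , refl , atom) = x≢y refl
    clash-unmatchable {s = lam a s} ps pt x≢y (_ , eq , e∼) with map-just {m = s ⟨ σ ⟩} eq
    clash-unmatchable {s = lam a s} refl refl x≢y (_ , _ , lam _) | _ , _ , refl = x≢y refl
    clash-unmatchable {s = lam a s} refl refl x≢y (_ , _ , lam-α _ _) | _ , _ , refl = x≢y refl
    clash-unmatchable {s = app f ss} ps pt x≢y (_ , eq , e∼) with map-just {m = ss ⟨ σ ⟩*} eq
    clash-unmatchable {s = app f ss} refl refl x≢y (_ , _ , app _) | _ , _ , refl = x≢y refl
    clash-unmatchable {s = letrec as u ss r} ps pt x≢y (_ , eq , e∼)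
      with zipWith-just {m = ss ⟨ σ ⟩*} {r ⟨ σ ⟩} eq
    clash-unmatchable {s = letrec as u ss r} refl refl x≢y (_ , _ , letrec _ _ _ _ _ _) | _ , _ , _ , _ , refl =
      x≢y refl
  fails-unmatchable {σ = σ} (lam {s = s} q∈ a≢b ¬a#) ms with matches-lam⁻ {σ = σ} {s = s} (All.lookup ms q∈)
  ... | inj₁ (a≡b , _) = a≢b a≡b
  ... | inj₂ (a# , _)  = ¬a# a#
  fails-unmatchable (merge q∈ q∈′ ¬∼) ms with All.lookup ms q∈ | All.lookup ms q∈′
  ... | e , eq , e∼ | e′ , eq′ , e′∼ with trans (sym eq) eq′
  ...   | refl = ¬∼ (∼-trans (∼-sym e∼) e′∼)

  ‼-lookup : Unique (map proj₁ σ) → All (λ (X , e) → σ ‼ X ≡ just e) σ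
  ‼-lookup {[]}          _        = []
  ‼-lookup {(Y , d) ∷ σ} (p ∷ ps) = head ∷ All.map (λ {x} → rest x) (All.zip (All.map⁻ p , ‼-lookup ps))
    where
    head : ((Y , d) ∷ σ) ‼ Y ≡ just d
    head with Y ≟ᵥ Y
    ... | yes _ = refl
    ... | no ¬p = contradiction refl ¬p
    rest : ∀ x → Y ≢ proj₁ x × σ ‼ proj₁ x ≡ just (proj₂ x) → ((Y , d) ∷ σ) ‼ proj₁ x ≡ just (proj₂ x)
    rest (X , e) (Y≢X , eq) with X ≟ᵥ Y
    ... | yes refl = contradiction refl Y≢X
    ... | no _     = eq

  solved-matcher : Solved Γ σ → Matcher Γ σ
  solved-matcher (p , u) = ↭.All-resp-↭ (↭-sym p) (All.map⁺ (All.map (λ eq → _ , eq , ∼-refl) (‼-lookup u)))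

  solved-agrees : Solved Γ σ → Matcher Γ τ → AgreeOn Γ τ σ
  solved-agrees {σ = σ} {τ} (p , u) ms X X∈ = find σ (‼-lookup u) (All.map⁻ (↭.All-resp-↭ p ms)) (Any.map⁻ (↭.Any-resp-↭ p X∈))
    where
    find : ∀ σ′ → All (λ (Y , e) → σ ‼ Y ≡ just e) σ′ → All (λ (Y , e) → Matches τ (var Y ⊴ e)) σ′ →
           Any (λ (Y , e) → X occursIn var Y) σ′ → ∃[ d ] ∃[ e ] τ ‼ X ≡ just d × σ ‼ X ≡ just e × d ∼ e
    find (_ ∷ _) (eq ∷ _) ((d , eq′ , d∼) ∷ _) (here var) = d , _ , eq′ , eq , d∼
    find (_ ∷ σ′) (_ ∷ eqs) (_ ∷ ms) (there X∈) = find σ′ eqs ms X∈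

  output-sound : Sound
  output-sound Γ σ (Γ′ , steps , sol) = backwards steps (solved-matcher sol)
    where
    backwards : ∀ {Γ Γ′} → Star _⟶_ Γ Γ′ → Matcher Γ′ σ → Matcher Γ σ
    backwards ε         ms = ms
    backwards (st ◅ ss) ms = ⟶-sound st (backwards ss ms)

  occurs-zip : ∀ {X} (ss : Vec LRLX n) ts i → X occursIn lookup ss i →
               X ∈vars toList (Vec.zipWith _⊴_ ss ts)
  occurs-zip {X = X} ss ts i X∈ =
    Any-toList⁺ _ i (subst (λ q → X occursIn lhs q) (sym (Vec.lookup-zipWith _⊴_ i ss ts)) X∈)

  -- Completeness speaks of the variables of the initial problem, so no rule may lose one. The
  -- delicate rule is `delete`, where `_≐_` guarantees a left-hand side without variables.
  ⟶ˢ-vars : ∀ {X} → Γ ⟶ˢ Γ′ → X ∈vars Γ → X ∈vars Γ′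
  ⟶ˢ-vars (delete p s≐t) X∈ with ↭.Any-resp-↭ p X∈
  ... | here X∈s = contradiction X∈s (≐-closed s≐t)
    where
    ≐-closed : ∀ {X s t} → s ≐ t → ¬ X occursIn s
    ≐-closed (lam p) (lam X∈) = ≐-closed p X∈
    ≐-closed (app ps) (app i X∈) = ≐-closed (ps i) X∈
    ≐-closed (letrec _ _ ps _) (letrec i X∈) = ≐-closed (ps i) X∈
    ≐-closed (letrec _ _ _ p) (inside X∈) = ≐-closed p X∈
  ... | there X∈Δ = X∈Δ
  ⟶ˢ-vars (app {ss = ss} {ts} p) X∈ with ↭.Any-resp-↭ p X∈
  ... | here (app i X∈s) = Any.++⁺ˡ (occurs-zip ss ts i X∈s)
  ... | there X∈Δ        = Any.++⁺ʳ (toList (Vec.zipWith _⊴_ ss ts)) X∈Δ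
  ⟶ˢ-vars (lam p) X∈ with ↭.Any-resp-↭ p X∈
  ... | here (lam X∈s) = here X∈s
  ... | there X∈Δ      = there X∈Δ
  ⟶ˢ-vars (lam-α p _ _) X∈ with ↭.Any-resp-↭ p X∈
  ... | here (lam X∈s) = here X∈s
  ... | there X∈Δ      = there X∈Δ
  ⟶ˢ-vars (susp p) X∈ with ↭.Any-resp-↭ p X∈
  ... | here susp = here var
  ... | there X∈Δ = there X∈Δ
  ⟶ˢ-vars (merge p _) X∈ with ↭.Any-resp-↭ p X∈
  ... | here X∈₁          = here X∈₁
  ... | there (here X∈₂)  = here (rename X∈₂)
    where
    rename : ∀ {X Y} → X occursIn var Y → X occursIn var Y
    rename var = var
  ... | there (there X∈Δ) = there X∈Δ

  letrec-vars : ∀ {X} {as bs : Vec Atom n} .{u v} {ss r ts r′} ρ π →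
                X ∈vars ((letrec as u ss r ⊴ letrec bs v ts r′) ∷ Δ) → X ∈vars (letrecEqs ρ π ss r ts r′ ++ Δ)
  letrec-vars ρ π (here (inside X∈)) = here X∈
  letrec-vars {X = X} {ss = ss} {ts = ts} ρ π (here (letrec i X∈)) =
    there (Any.++⁺ˡ (Any-toList⁺ (tabulate λ j → lookup ss j ⊴ π · lookup ts (ρ ⟨$⟩ʳ j)) i (subst (λ q → X occursIn lhs q) (sym (Vec.lookup∘tabulate _ i)) X∈)))
  letrec-vars {ss = ss} {r} {ts} {r′} ρ π (there X∈) = Any.++⁺ʳ (letrecEqs ρ π ss r ts r′) X∈

-- Termination, progress, and the bounds for the collecting version

module Runs (S : Signature) where
  open Rules S public

  private variable
    n : ℕ
    V : Set
    Γ Γ′ Δ : Problem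
    σ τ : Subst
    q : Equation

  lhsSize : Problem → ℕ
  lhsSize Γ = sum (map (λ q → ∣ lhs q ∣) Γ)

  lhsSize-↭ : Γ ↭ Δ → lhsSize Γ ≡ lhsSize Δ
  lhsSize-↭ p = sum-↭ (↭.map⁺ _ p)

  lhsSize-++ : ∀ Γ Δ → lhsSize (Γ ++ Δ) ≡ lhsSize Γ + lhsSize Δ
  lhsSize-++ Γ Δ = trans (cong sum (List.map-++ (λ q → ∣ lhs q ∣) Γ Δ))
                         (sum-++ (map (λ q → ∣ lhs q ∣) Γ) (map (λ q → ∣ lhs q ∣) Δ))

  lhsSize-toList : ∀ (v : Vec Equation n) ss → (∀ i → lhs (lookup v i) ≡ lookup ss i) → lhsSize (toList v) ≡ ∣ ss ∣*
  lhsSize-toList []      []       h = refl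
  lhsSize-toList (q ∷ v) (s ∷ ss) h = cong₂ (λ s k → ∣ s ∣ + k) (h zero) (lhsSize-toList v ss (h ∘ suc))

  lhsSize-zip : ∀ (ss : Vec LRLX n) ts → lhsSize (toList (Vec.zipWith _⊴_ ss ts)) ≡ ∣ ss ∣*
  lhsSize-zip ss ts = lhsSize-toList (Vec.zipWith _⊴_ ss ts) ss (λ i → cong lhs (Vec.lookup-zipWith _⊴_ i ss ts))

  lhsSize-letrecEqs : ∀ (ρ : Permutation′ n) π ss r ts r′ → lhsSize (letrecEqs ρ π ss r ts r′) ≡ ∣ ss ∣* + ∣ r ∣
  lhsSize-letrecEqs ρ π ss r ts r′ = trans
    (cong (∣ r ∣ +_) (lhsSize-toList (tabulate λ i → lookup ss i ⊴ π · lookup ts (ρ ⟨$⟩ʳ i)) ss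
      (λ i → cong lhs (Vec.lookup∘tabulate _ i))))
    (ℕ.+-comm ∣ r ∣ ∣ ss ∣*)

  size-positive : (e : Exp V) → 1 ≤ ∣ e ∣
  size-positive (atom _)         = s≤s z≤n
  size-positive (lam _ _)        = s≤s z≤n
  size-positive (app _ _)        = s≤s z≤n
  size-positive (letrec _ _ _ _) = s≤s z≤n
  size-positive (var _)          = s≤s z≤n
  size-positive (susp _ _)       = s≤s z≤n

  -- For `susp` the decrease rests on the size function: a suspension counts at least two even when
  -- its permutation is empty, a variable one.
  ⟶ˢ-lhsSize : Γ ⟶ˢ Γ′ → lhsSize Γ′ < lhsSize Γ
  ⟶ˢ-lhsSize (delete {s = s} p _) rewrite lhsSize-↭ p = +-monoˡ-≤ _ (size-positive s)
  ⟶ˢ-lhsSize (app {Δ = Δ} {ss = ss} {ts} p)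
    rewrite lhsSize-↭ p | lhsSize-++ (toList (Vec.zipWith _⊴_ ss ts)) Δ | lhsSize-zip ss ts = ≤-refl
  ⟶ˢ-lhsSize (lam p)         rewrite lhsSize-↭ p = n≤1+n _
  ⟶ˢ-lhsSize (lam-α p _ _)   rewrite lhsSize-↭ p = n≤1+n _
  ⟶ˢ-lhsSize (susp {Δ = Δ} {π} p) rewrite lhsSize-↭ p = s≤s (s≤s (m≤n+m (lhsSize Δ) (2 * length π)))
  ⟶ˢ-lhsSize (merge p _)     rewrite lhsSize-↭ p = ≤-refl

  -- An exact equation: it shows that all branches at one `letrec` have the same measure, whatever ρ
  -- and π, and it leaves n free to pay for the branching.
  letrec-lhsSize : ∀ {as bs : Vec Atom n} .{u v} {ss r ts r′} ρ π → Γ ↭ (letrec as u ss r ⊴ letrec bs v ts r′) ∷ Δ →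
                   lhsSize Γ ≡ suc (n + lhsSize (letrecEqs ρ π ss r ts r′ ++ Δ))
  letrec-lhsSize {n} {Δ = Δ} {ss = ss} {r} {ts} {r′} ρ π p
    rewrite lhsSize-↭ p | lhsSize-++ (letrecEqs ρ π ss r ts r′) Δ | lhsSize-letrecEqs ρ π ss r ts r′
    = cong suc (ℕ.+-assoc n (∣ ss ∣* + ∣ r ∣) (lhsSize Δ))

  ⟶-lhsSize : Γ ⟶ Γ′ → lhsSize Γ′ < lhsSize Γ
  ⟶-lhsSize (simplify st)           = ⟶ˢ-lhsSize st
  ⟶-lhsSize (letrec {n = n} {ss = ss} {r} {ts} {r′} p _ ρ π _) rewrite letrec-lhsSize {ss = ss} {r} {ts} {r′} ρ π p =
    s≤s (m≤n+m _ n)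

  iter-lhsSize : ∀ {k} → Iter _⟶_ k Γ Γ′ → k + lhsSize Γ′ ≤ lhsSize Γ
  iter-lhsSize stop                = ≤-refl
  iter-lhsSize {Γ′ = Γ′} (step {n = k} st sts) =
    ≤-trans (s≤s (iter-lhsSize sts)) (⟶-lhsSize st)

  lhsSize≤problemSize : ∀ Γ → lhsSize Γ ≤ problemSize Γ
  lhsSize≤problemSize []            = z≤n
  lhsSize≤problemSize ((s ⊴ t) ∷ Γ) = m≤n⇒m≤1+n
    (+-mono-≤ (m≤m+n ∣ s ∣ ∣ t ∣) (lhsSize≤problemSize Γ))

  toProblem : Subst → Problem
  toProblem = map (λ (X , e) → var X ⊴ e)

  -- The `letrec` case leaves ρ and π open: `polynomial-runs` takes one choice of ρ, `collect` takes
  -- all of them.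
  data Progress (Γ : Problem) : Set where
    failed   : Fails Γ → Progress Γ
    solved   : Solved Γ σ → Progress Γ
    simplify : Γ ⟶ˢ Γ′ → Progress Γ
    letrec   : ∀ {as bs : Vec Atom n} .{u v} {ss r ts r′} → Γ ↭ (letrec as u ss r ⊴ letrec bs v ts r′) ∷ Δ →
               as #* letrec bs v ts r′ → Progress Γ

  private
    member : Γ ↭ q ∷ Δ → q ∈ Γ
    member p = ↭.∈-resp-↭ (↭-sym p) (here refl)

  nonvariable-progress : ∀ s t → (∀ X → s ≢ var X) → Γ ↭ (s ⊴ t) ∷ Δ → Progress Γ
  nonvariable-progress (var X) t ≢var p = contradiction refl (≢var X)
  nonvariable-progress (susp π X) t _ p = simplify (susp p)
  nonvariable-progress (atom a) (atom b) _ p with a ≟ₐ b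
  ... | yes refl = simplify (delete p atom)
  ... | no a≢b   = failed (clash (member p) refl refl λ { refl → a≢b refl })
  nonvariable-progress (lam a s) (lam b t) _ p with a ≟ₐ b | a ∈FA? t
  ... | yes refl | _     = simplify (lam p)
  ... | no a≢b | no a#   = simplify (lam-α p a≢b a#)
  ... | no a≢b | yes a∈  = failed (lam (member p) a≢b λ a# → a# a∈)
  nonvariable-progress (app f ss) (app g ts) _ p with f ≟f g
  ... | yes refl = simplify (app p)
  ... | no f≢g   = failed (clash (member p) refl refl λ { refl → f≢g refl })
  nonvariable-progress (letrec {n} as u ss r) (letrec {m} bs v ts r′) _ p with n ℕ.≟ m
  ... | no n≢m   = failed (clash (member p) refl refl λ { refl → n≢m refl })
  ... | yes refl with any? (λ i → lookup as i ∈FA? letrec bs v ts r′)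
  ...   | yes (i , a∈) = failed (letrec (member p) (i , λ a# → a# a∈))
  ...   | no as#       = letrec p (λ i a∈ → as# (i , a∈))
  nonvariable-progress (atom _)         (lam _ _)        _ p = failed (clash (member p) refl refl λ ())
  nonvariable-progress (atom _)         (app _ _)        _ p = failed (clash (member p) refl refl λ ())
  nonvariable-progress (atom _)         (letrec _ _ _ _) _ p = failed (clash (member p) refl refl λ ())
  nonvariable-progress (lam _ _)        (atom _)         _ p = failed (clash (member p) refl refl λ ())
  nonvariable-progress (lam _ _)        (app _ _)        _ p = failed (clash (member p) refl refl λ ())
  nonvariable-progress (lam _ _)        (letrec _ _ _ _) _ p = failed (clash (member p) refl refl λ ())
  nonvariable-progress (app _ _)        (atom _)         _ p = failed (clash (member p) refl refl λ ())
  nonvariable-progress (app _ _)        (lam _ _)        _ p = failed (clash (member p) refl refl λ ())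
  nonvariable-progress (app _ _)        (letrec _ _ _ _) _ p = failed (clash (member p) refl refl λ ())
  nonvariable-progress (letrec _ _ _ _) (atom _)         _ p = failed (clash (member p) refl refl λ ())
  nonvariable-progress (letrec _ _ _ _) (lam _ _)        _ p = failed (clash (member p) refl refl λ ())
  nonvariable-progress (letrec _ _ _ _) (app _ _)        _ p = failed (clash (member p) refl refl λ ())

  variables-or-not : ∀ Γ → (∃[ σ ] Γ ≡ toProblem σ) ⊎
                           (∃[ s ] ∃[ t ] ∃[ Δ ] (∀ X → s ≢ var X) × Γ ↭ (s ⊴ t) ∷ Δ)
  variables-or-not [] = inj₁ ([] , refl)
  variables-or-not ((s ⊴ t) ∷ Γ) with variables-or-not Γ
  ... | inj₂ (s′ , t′ , Δ , ≢var , p) =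
    inj₂ (s′ , t′ , (s ⊴ t) ∷ Δ , ≢var , ↭-trans (↭-prep _ p) (↭-swap _ _ ↭-refl))
  variables-or-not ((var X ⊴ t) ∷ Γ)            | inj₁ (σ , refl) = inj₁ ((X , t) ∷ σ , refl)
  variables-or-not ((atom _ ⊴ t) ∷ Γ)           | inj₁ _ = inj₂ (_ , _ , _ , (λ _ ()) , ↭-refl)
  variables-or-not ((lam _ _ ⊴ t) ∷ Γ)          | inj₁ _ = inj₂ (_ , _ , _ , (λ _ ()) , ↭-refl)
  variables-or-not ((app _ _ ⊴ t) ∷ Γ)          | inj₁ _ = inj₂ (_ , _ , _ , (λ _ ()) , ↭-refl)
  variables-or-not ((letrec _ _ _ _ ⊴ t) ∷ Γ)   | inj₁ _ = inj₂ (_ , _ , _ , (λ _ ()) , ↭-refl)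
  variables-or-not ((susp _ _ ⊴ t) ∷ Γ)         | inj₁ _ = inj₂ (_ , _ , _ , (λ _ ()) , ↭-refl)

  extract : ∀ {X} {σ : Subst} → Any (λ (Y , e) → X ≡ Y) σ →
            ∃[ e ] ∃[ σ′ ] toProblem σ ↭ (var X ⊴ e) ∷ toProblem σ′
  extract {σ = (_ , e) ∷ σ} (here refl) = e , σ , ↭-refl
  extract {σ = x ∷ σ} (there X∈) with extract X∈
  ... | e , σ′ , p = e , x ∷ σ′ , ↭-trans (↭-prep _ p) (↭-swap _ _ ↭-refl)

  unique-or-repeated : ∀ σ → Unique (map proj₁ σ) ⊎
    (∃[ X ] ∃[ e₁ ] ∃[ e₂ ] ∃[ Δ ] toProblem σ ↭ (var X ⊴ e₁) ∷ (var X ⊴ e₂) ∷ Δ)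
  unique-or-repeated [] = inj₁ []
  unique-or-repeated ((X , e) ∷ σ) with unique-or-repeated σ | Any.any? (λ (Y , _) → X ≟ᵥ Y) σ
  ... | inj₂ (Y , e₁ , e₂ , Δ , p) | _ = inj₂ (Y , e₁ , e₂ , (var X ⊴ e) ∷ Δ ,
        ↭-trans (↭-prep _ p) (↭-trans (↭-swap _ _ ↭-refl) (↭-prep _ (↭-swap _ _ ↭-refl))))
  ... | inj₁ _ | yes X∈ = let e₂ , σ′ , p = extract X∈ in inj₂ (X , e , e₂ , toProblem σ′ , ↭-prep _ p)
  ... | inj₁ u | no X∉  = inj₁ (All.map⁺ (All.¬Any⇒All¬ σ X∉) ∷ u)

  progress : ∀ Γ → Progress Γ
  progress Γ with variables-or-not Γ
  ... | inj₂ (s , t , Δ , ≢var , p) = nonvariable-progress s t ≢var p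
  ... | inj₁ (σ , refl) with unique-or-repeated σ
  ...   | inj₁ u = solved (↭-refl , u)
  ...   | inj₂ (X , e₁ , e₂ , Δ , p) with e₁ ∼? e₂
  ...     | yes e₁∼e₂ = simplify (merge p e₁∼e₂)
  ...     | no  e₁≁e₂ = failed (merge (member p) (↭.∈-resp-↭ (↭-sym p) (there (here refl))) e₁≁e₂)

  polynomial-runs : PolynomialRuns
  -- The polynomial is the identity: a run has at most as many steps as the size of the left-hand
  -- sides.
  polynomial-runs = (λ Γ → next Γ (progress Γ)) , 0 ∷ 1 ∷ [] , λ Γ {n} {Γ′} sts →
    ≤-trans (m≤m+n n (lhsSize Γ′)) (≤-trans (iter-lhsSize sts) (≤-trans (lhsSize≤problemSize Γ)
      (≤-reflexive (sym (trans (cong (problemSize Γ *_) (cong suc (ℕ.*-zeroʳ (problemSize Γ)))) (ℕ.*-identityʳ _))))))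
    where
    next : ∀ Γ → Progress Γ → Fails Γ ⊎ (∃[ σ ] Solved Γ σ) ⊎ (∃[ Γ′ ] Γ ⟶ Γ′)
    next Γ (failed f)    = inj₁ f
    next Γ (solved s)    = inj₂ (inj₁ (_ , s))
    next Γ (simplify st) = inj₂ (inj₂ (_ , simplify st))
    next Γ (letrec {as = as} {bs} {u} {v} p as#) =
      inj₂ (inj₂ (_ , letrec p as# idₚ (aligning idₚ as bs) (aligning-renames idₚ as bs u v)))

  collect : ∀ k Γ → lhsSize Γ < k → ∃[ σs ] Collects Γ σs
  collect (suc k) Γ (s≤s size≤k) with progress Γ
  ... | failed f    = _ , failed f
  ... | solved s    = _ , solved s
  ... | simplify st with collect k _ (ℕ.<-≤-trans (⟶ˢ-lhsSize st) size≤k)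
  ...   | σs , c    = σs , simplify st c
  collect (suc k) Γ (s≤s size≤k) | letrec {n} {Δ} {as} {bs} {u} {v} {ss} {r} {ts} {r′} p as# =
    _ , letrec p as# (permutations-complete , permutations-distinct n) (proj₂ (branches (permutations n)))
    where
    branches : ∀ ρs → ∃[ σss ] Pointwise (λ ρ σs → ∃[ π ] Renames ρ π as bs ×
                                            Collects (letrecEqs ρ π ss r ts r′ ++ Δ) σs) ρs σss
    branches [] = [] , []
    branches (ρ ∷ ρs) with collect k (letrecEqs ρ (aligning ρ as bs) ss r ts r′ ++ Δ)
                             (ℕ.<-≤-trans (⟶-lhsSize (letrec p as# ρ (aligning ρ as bs) (aligning-renames ρ as bs u v))) size≤k)
                         | branches ρs
    ... | σs , c | σss , cs = σs ∷ σss , (aligning ρ as bs , aligning-renames ρ as bs u v , c) ∷ cs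

  ⟶-output : Γ ⟶ Γ′ → Output Γ′ σ → Output Γ σ
  ⟶-output st (Γ″ , sts , sol) = Γ″ , st ◅ sts , sol

  Branches : (as bs : Vec Atom n) → Vec LRLX n → LRLX → Vec LRL n → LRL → Problem →
             List (Permutation′ n) → List (List Subst) → Set
  Branches as bs ss r ts r′ Δ =
    Pointwise (λ ρ σs → ∃[ π ] Renames ρ π as bs × Collects (letrecEqs ρ π ss r ts r′ ++ Δ) σs)

  mutual
    collects-output : ∀ {σs} → Collects Γ σs → All (Output Γ) σs
    collects-output (solved s)                 = (_ , ε , s) ∷ []
    collects-output (failed _)                 = []
    collects-output (simplify st c)            = All.map (⟶-output (simplify st)) (collects-output c)
    collects-output (letrec {u = u} {v} {ss} {r} {ts} {r′} p as# _ branches) = All.concat⁺ (branches-output {u = u} {v} {ss} {r} {ts} {r′} p as# branches)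

    branches-output : ∀ {as bs : Vec Atom n} .{u v} {ss r ts r′} (p : Γ ↭ (letrec as u ss r ⊴ letrec bs v ts r′) ∷ Δ)
                      (as# : as #* letrec bs v ts r′) {ρs σss} → Branches as bs ss r ts r′ Δ ρs σss →
                      All (All (Output Γ)) σss
    branches-output p as# [] = []
    branches-output {u = u} {v} {ss} {r} {ts} {r′} p as# {ρ ∷ _} ((π , ren , c) ∷ cs) =
      All.map (⟶-output (letrec {u = u} {v} p as# ρ π ren)) (collects-output c) ∷
      branches-output {u = u} {v} {ss} {r} {ts} {r′} p as# cs

  mutual
    collects-complete : ∀ {σs} → Collects Γ σs → Matcher Γ τ → Any (AgreeOn Γ τ) σs
    collects-complete {τ = τ} (solved s) ms      = here (solved-agrees {τ = τ} s ms)
    collects-complete {τ = τ} (failed f) ms = contradiction ms (fails-unmatchable {σ = τ} f)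
    collects-complete {τ = τ} (simplify st c) ms =
      Any.map (λ agree X X∈ → agree X (⟶ˢ-vars st X∈)) (collects-complete {τ = τ} c (⟶ˢ-complete {σ = τ} st ms))
    collects-complete {τ = τ} (letrec {u = u} {v} {ss} {r} {ts} {r′} p as# (enum , _) branches) ms
      with ↭.All-resp-↭ p ms
    ... | m ∷ ms′ with matches-letrec⁻ {σ = τ} {ss = ss} {r} m
    ...   | _ , ρ , expand = Any.concat⁺ (branches-complete {τ = τ} {u = u} {v} {ss} {r} {ts} {r′} p as# {ρ} branches (enum ρ) expand ms′)

    branches-complete : ∀ {as bs : Vec Atom n} .{u v} {ss r ts r′} (p : Γ ↭ (letrec as u ss r ⊴ letrec bs v ts r′) ∷ Δ)
                        (as# : as #* letrec bs v ts r′) {ρ ρs σss} → Branches as bs ss r ts r′ Δ ρs σss →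
                        Any (ρ ≈ₚ_) ρs →
                        (∀ ρ′ π → ρ ≈ₚ ρ′ → Renames ρ′ π as bs → Matcher (letrecEqs ρ′ π ss r ts r′) τ) →
                        Matcher Δ τ → Any (Any (AgreeOn Γ τ)) σss
    branches-complete {τ = τ} {u = u} {v} {ss} {r} {ts} {r′} p as# {ρs = ρ′ ∷ _} ((π , ren , c) ∷ cs) (here eq) expand ms =
      here (Any.map (λ agree X X∈ → agree X (letrec-vars {u = u} {v} {ss} {r} {ts} {r′} ρ′ π (↭.Any-resp-↭ p X∈)))
                    (collects-complete {τ = τ} c (All.++⁺ (expand ρ′ π eq ren) ms)))
    branches-complete {τ = τ} {u = u} {v} {ss} {r} {ts} {r′} p as# {ρ} (_ ∷ cs) (there ρ∈) expand ms =
      there (branches-complete {τ = τ} {u = u} {v} {ss} {r} {ts} {r′} p as# {ρ} cs ρ∈ expand ms)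

  -- The number of results is bounded with the square of the measure as exponent. At a `letrec` the
  -- measure drops from `suc (n + w)` to w, and the gap between the squares absorbs the factor
  -- `2 ^ (n * n)`.
  squares : ∀ n w → n * n + w * w ≤ suc (n + w) * suc (n + w)
  squares n w = ≤-trans (+-mono-≤ (ℕ.*-monoʳ-≤ n {n} {suc (n + w)} (m≤n⇒m≤1+n (m≤m+n n w)))
                                       (ℕ.*-monoʳ-≤ w {w} {suc (n + w)} (m≤n⇒m≤1+n (m≤n+m w n))))
    (≤-trans (≤-reflexive (sym (ℕ.*-distribʳ-+ (suc (n + w)) n w))) (*-monoˡ-≤ (suc (n + w)) (n≤1+n (n + w))))

  mutual
    collects-length : ∀ {σs} → Collects Γ σs → length σs ≤ 2 ^ (lhsSize Γ * lhsSize Γ)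
    collects-length {Γ} (solved _) = ℕ.m^n>0 2 (lhsSize Γ * lhsSize Γ)
    collects-length (failed _)     = z≤n
    collects-length (simplify st c) = ≤-trans (collects-length c)
      (ℕ.^-monoʳ-≤ 2 (ℕ.*-mono-≤ (<⇒≤ (⟶ˢ-lhsSize st)) (<⇒≤ (⟶ˢ-lhsSize st))))
    collects-length {Γ} (letrec {Δ = Δ} {n = n} {u = u} {v} {ss} {r} {ts} {r′} {ρs} {σss} p as# (_ , distinct) branches) = begin
      length (concat σss)          ≤⟨ branches-length {u = u} {v} {ss} {r} {ts} {r′} p as# branches ⟩
      length ρs * 2 ^ (w * w)      ≤⟨ *-monoˡ-≤ _ (distinct-permutations-length distinct) ⟩
      2 ^ (n * n) * 2 ^ (w * w)    ≡⟨ sym (ℕ.^-distribˡ-+-* 2 (n * n) (w * w)) ⟩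
      2 ^ (n * n + w * w)          ≤⟨ ℕ.^-monoʳ-≤ 2 (squares n w) ⟩
      2 ^ (suc (n + w) * suc (n + w)) ≡⟨ cong (λ k → 2 ^ (k * k)) (sym (letrec-lhsSize {ss = ss} {r} idₚ [] p)) ⟩
      2 ^ (lhsSize Γ * lhsSize Γ)  ∎
      where
      open ℕ.≤-Reasoning
      -- The choices `idₚ` and `[]` are representatives: the measure is the same for every branch.
      w = lhsSize (letrecEqs idₚ [] ss r ts r′ ++ Δ)

    branches-length : ∀ {as bs : Vec Atom n} .{u v} {ss r ts r′} (p : Γ ↭ (letrec as u ss r ⊴ letrec bs v ts r′) ∷ Δ)
                      (as# : as #* letrec bs v ts r′) {ρs σss} → Branches as bs ss r ts r′ Δ ρs σss →
                      let w = lhsSize (letrecEqs idₚ [] ss r ts r′ ++ Δ) in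
                      length (concat σss) ≤ length ρs * 2 ^ (w * w)
    branches-length p as# [] = z≤n
    branches-length {n} {Γ} {Δ} {u = u} {v} {ss} {r} {ts} {r′} p as# {ρ ∷ _} {σs ∷ σss} ((π , ren , c) ∷ cs) =
      ≤-trans (≤-reflexive (List.length-++ σs)) (+-mono-≤
        (subst (λ w → length σs ≤ 2 ^ (w * w)) same (collects-length c)) (branches-length {u = u} {v} {ss} {r} {ts} {r′} p as# cs))
      where
      same : lhsSize (letrecEqs ρ π ss r ts r′ ++ Δ) ≡ lhsSize (letrecEqs idₚ [] ss r ts r′ ++ Δ)
      same = ℕ.+-cancelˡ-≡ n _ _ (ℕ.suc-injective
        (trans (sym (letrec-lhsSize {ss = ss} {r} {ts} {r′} ρ π p)) (letrec-lhsSize {ss = ss} {r} {ts} {r′} idₚ [] p)))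

  mutual
    ∣·∣ : ∀ π e → ∣ π · e ∣ ≡ ∣ e ∣
    ∣·∣ π (atom a)           = refl
    ∣·∣ π (lam a e)          = cong (λ k → suc (suc k)) (∣·∣ π e)
    ∣·∣ π (app f es)         = cong suc (∣·∣* π es)
    ∣·∣ π (letrec {n} as u es e) = cong (λ k → suc (n + k)) (cong₂ _+_ (∣·∣* π es) (∣·∣ π e))

    ∣·∣* : ∀ π (es : Vec LRL n) → ∣ π ·* es ∣* ≡ ∣ es ∣*
    ∣·∣* π []       = refl
    ∣·∣* π (e ∷ es) = cong₂ _+_ (∣·∣ π e) (∣·∣* π es)

  lookup-size : ∀ (es : Vec (Exp V) n) i → ∣ lookup es i ∣ ≤ ∣ es ∣*
  lookup-size (e ∷ es) zero    = m≤m+n ∣ e ∣ ∣ es ∣*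
  lookup-size (e ∷ es) (suc i) = ≤-trans (lookup-size es i) (m≤n+m ∣ es ∣* ∣ e ∣)

  Rhs≤ : ℕ → Equation → Set
  Rhs≤ B q = ∣ rhs q ∣ ≤ B

  permuted≤ : ∀ {B} π e {k} → ∣ e ∣ ≤ k → k ≤ B → ∣ π · e ∣ ≤ B
  permuted≤ π e e≤k k≤B = ≤-trans (≤-reflexive (∣·∣ π e)) (≤-trans e≤k k≤B)

  -- Each new right-hand side is a permuted subexpression of an old one, and permuting keeps sizes.
  -- The bound concerns single right-hand sides; the number of bindings in an output is controlled
  -- by `lhsSize`.
  ⟶-rhs : ∀ {B} → Γ ⟶ Γ′ → All (Rhs≤ B) Γ → All (Rhs≤ B) Γ′
  ⟶-rhs (simplify (delete p _)) bs with ↭.All-resp-↭ p bs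
  ... | _ ∷ bs′ = bs′
  ⟶-rhs {B = B} (simplify (app {ss = ss} {ts} p)) bs with ↭.All-resp-↭ p bs
  ... | b ∷ bs′ = All.++⁺ (All-toList⁺ _ λ i → subst (Rhs≤ B) (sym (Vec.lookup-zipWith _⊴_ i ss ts))
                    (≤-trans (lookup-size ts i) (≤-trans (n≤1+n _) b))) bs′
  ⟶-rhs (simplify (lam p)) bs with ↭.All-resp-↭ p bs
  ... | b ∷ bs′ = ≤-trans (m≤n+m _ 2) b ∷ bs′
  ⟶-rhs (simplify (lam-α {a = a} {b} {t = t} p _ _)) bs with ↭.All-resp-↭ p bs
  ... | b≤ ∷ bs′ = permuted≤ ((a , b) ∷ []) t (m≤n+m _ 2) b≤ ∷ bs′
  ⟶-rhs (simplify (susp {π = π} {e = e} p)) bs with ↭.All-resp-↭ p bs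
  ... | b ∷ bs′ = permuted≤ (π ⁻¹) e ≤-refl b ∷ bs′
  ⟶-rhs (simplify (merge p _)) bs with ↭.All-resp-↭ p bs
  ... | b ∷ _ ∷ bs′ = b ∷ bs′
  ⟶-rhs {B = B} (letrec {n = n} {ss = ss} {r} {ts} {r′} p _ ρ π _) bs with ↭.All-resp-↭ p bs
  ... | b ∷ bs′ = permuted≤ π r′ (≤-trans (m≤n+m _ ∣ ts ∣*) (m≤n+m _ (suc n))) b ∷
    All.++⁺ (All-toList⁺ _ λ i → subst (Rhs≤ B) (sym (Vec.lookup∘tabulate _ i))
      (permuted≤ π (lookup ts (ρ ⟨$⟩ʳ i))
        (≤-trans (lookup-size ts (ρ ⟨$⟩ʳ i)) (≤-trans (m≤m+n _ ∣ r′ ∣) (m≤n+m _ (suc n)))) b)) bs′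

  rhs≤problemSize : ∀ Γ → All (Rhs≤ (problemSize Γ)) Γ
  rhs≤problemSize [] = []
  rhs≤problemSize ((s ⊴ t) ∷ Γ) = m≤n⇒m≤1+n (≤-trans (m≤n+m ∣ t ∣ ∣ s ∣) (m≤m+n _ (problemSize Γ))) ∷
    All.map (λ b → ≤-trans b (m≤n⇒m≤1+n (m≤n+m _ (∣ s ∣ + ∣ t ∣)))) (rhs≤problemSize Γ)

  substSize≤ : ∀ {B} σ → All (Rhs≤ B) (toProblem σ) → substSize σ ≤ lhsSize (toProblem σ) * (2 + B)
  substSize≤ []            []       = z≤n
  substSize≤ ((X , e) ∷ σ) (b ∷ bs) = s≤s (s≤s (+-mono-≤ b (substSize≤ σ bs)))

  output-size : ∀ Γ {B} → All (Rhs≤ B) Γ → Output Γ σ → substSize σ ≤ lhsSize Γ * (2 + B)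
  output-size {σ} Γ bs (Γ′ , ε , p , _) = ≤-trans (substSize≤ σ (↭.All-resp-↭ p bs))
    (≤-reflexive (cong (_* _) (sym (lhsSize-↭ p))))
  output-size Γ bs (Γ′ , st ◅ sts , sol) =
    ≤-trans (output-size _ (⟶-rhs st bs) (Γ′ , sts , sol)) (*-monoˡ-≤ _ (<⇒≤ (⟶-lhsSize st)))

  collects-all : CollectsAll
  collects-all = (λ Γ → collect (suc (lhsSize Γ)) Γ ≤-refl) ,
    -- With x the problem size, these are x squared, the exponent of `collects-length`, and x times
    -- 2 + x, the bound of `output-size` for right-hand sides of size at most x.
    0 ∷ 0 ∷ 1 ∷ [] , 0 ∷ 2 ∷ 1 ∷ [] , λ Γ σs c →
      let B = problemSize Γ in
      All.map (output-sound Γ _) (collects-output c) ,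
      (λ τ ms → let agree = collects-complete {τ = τ} c ms in
        _ , ∈ₚ.∈-lookup (Any.index agree) , Any.lookup-result agree) ,
      ≤-trans (collects-length c) (ℕ.^-monoʳ-≤ 2 (≤-trans
        (ℕ.*-mono-≤ (lhsSize≤problemSize Γ) (lhsSize≤problemSize Γ))
        (≤-reflexive (cong (B *_) (sym (unit B)))))) ,
      All.map (λ out → ≤-trans (output-size Γ (rhs≤problemSize Γ) out)
        (≤-trans (*-monoˡ-≤ (2 + B) (lhsSize≤problemSize Γ))
          (≤-reflexive (cong (λ k → B * (2 + k)) (sym (unit B)))))) (collects-output c)
    where
    unit : ∀ B → B * (1 + B * 0) ≡ B
    unit B = trans (cong (λ k → B * suc k) (ℕ.*-zeroʳ B)) (ℕ.*-identityʳ B)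

  -- A run with the right guesses is a branch of the collecting version, so completeness is read off
  -- any one of its executions.
  complete : Complete
  complete Γ τ ms with collect (suc (lhsSize Γ)) Γ ≤-refl
  ... | σs , c with collects-complete {τ = τ} c ms
  ...   | agree = _ , All.lookup (collects-output c) (∈ₚ.∈-lookup (Any.index agree)) , Any.lookup-result agree

-- Decomposition steps that leave only ρ to choose

module Expansion (S : Signature) where
  open Runs S public

  private variable
    n : ℕ
    q : Equation
    Γ Δ : Problem
    σ : Subst

  letrec-cong : ∀ {as as′ : Vec Atom n} .{u u′} {es es′ : Vec LRL n} {e e′} → as ≡ as′ → es ≡ es′ → e ≡ e′ →
                letrec as u es e ≡ letrec as′ u′ es′ e′
  letrec-cong refl refl refl = refl

  mutual
    -- Propositional equality instead of `_∼_`, because the equation produced by the program has to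
    -- be literally the one produced by a rule.
    ·-identity : ∀ {π} → (∀ c → π ·ₐ c ≡ c) → ∀ e → π · e ≡ e
    ·-identity h (atom a)           = cong atom (h a)
    ·-identity h (lam a e)          = cong₂ lam (h a) (·-identity h e)
    ·-identity h (app f es)         = cong (app f) (·*-identity h es)
    ·-identity h (letrec as u es e) =
      letrec-cong (trans (Vec.map-cong h as) (Vec.map-id as)) (·*-identity h es) (·-identity h e)

    ·*-identity : ∀ {π} → (∀ c → π ·ₐ c ≡ c) → ∀ (es : Vec LRL n) → π ·* es ≡ es
    ·*-identity h []       = refl
    ·*-identity h (e ∷ es) = cong₂ _∷_ (·-identity h e) (·*-identity h es)

  swap-same : ∀ a t → ((a , a) ∷ []) · t ≡ t
  swap-same a = ·-identity trivial
    where
    trivial : ∀ c → swap a a c ≡ c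
    trivial c with c ≟ₐ a
    ... | yes p = sym p
    ... | no  _ = refl

  -- The steps of the program: it swaps also equal binders, and renames by aligning.
  data Expands : Equation → Problem → Set where
    atom   : ∀ {a} → Expands (atom a ⊴ atom a) []
    lam    : ∀ {a b s t} → a # lam b t → Expands (lam a s ⊴ lam b t) ((s ⊴ ((a , b) ∷ []) · t) ∷ [])
    app    : ∀ {f ss ts} → Expands (app f ss ⊴ app f ts) (toList (Vec.zipWith _⊴_ ss ts))
    letrec : ∀ {n} {as bs : Vec Atom n} .{u v} {ss r ts r′} → as #* letrec bs v ts r′ → ∀ ρ →
             Expands (letrec as u ss r ⊴ letrec bs v ts r′) (letrecEqs ρ (aligning ρ as bs) ss r ts r′)

  data Rigid : LRLX → Set where
    atom   : ∀ {a} → Rigid (atom a)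
    lam    : ∀ {a s} → Rigid (lam a s)
    app    : ∀ {f ss} → Rigid (app f ss)
    letrec : ∀ {n} {as : Vec Atom n} .{u} {ss s} → Rigid (letrec as u ss s)

  -- The single test `a # lam b t` covers both abstraction rules: for equal binders it always holds
  -- and the swapping is trivial, for different ones it amounts to `a # t`.
  expands-⟶ : Expands q Δ → q ∷ Γ ⟶ Δ ++ Γ
  expands-⟶ atom = simplify (delete ↭-refl atom)
  expands-⟶ {Γ = Γ} (lam {a} {b} {s} {t} a#) with a ≟ₐ b
  ... | yes refl = subst (λ t′ → (lam a s ⊴ lam a t) ∷ Γ ⟶ (s ⊴ t′) ∷ Γ) (sym (swap-same a t)) (simplify (lam ↭-refl))
  ... | no a≢b   = simplify (lam-α ↭-refl a≢b (a# ∘ lam a≢b))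
  expands-⟶ app = simplify (app ↭-refl)
  expands-⟶ (letrec {as = as} {bs} {u} {v} as# ρ) =
    letrec ↭-refl as# ρ (aligning ρ as bs) (aligning-renames ρ as bs u v)

  matches-expands : ∀ {s t} → Rigid s → Matches σ (s ⊴ t) → ∃[ Δ ] Expands (s ⊴ t) Δ × Matcher Δ σ
  matches-expands atom (_ , refl , atom) = _ , atom , []
  matches-expands {σ} {t = atom _} (lam {s = s}) (_ , eq , e∼) with map-just {m = s ⟨ σ ⟩} eq
  matches-expands {σ} {t = atom _} (lam {s = s}) (_ , eq , ()) | _ , _ , refl
  matches-expands {σ} {t = app _ _} (lam {s = s}) (_ , eq , e∼) with map-just {m = s ⟨ σ ⟩} eq
  matches-expands {σ} {t = app _ _} (lam {s = s}) (_ , eq , ()) | _ , _ , refl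
  matches-expands {σ} {t = letrec _ _ _ _} (lam {s = s}) (_ , eq , e∼) with map-just {m = s ⟨ σ ⟩} eq
  matches-expands {σ} {t = letrec _ _ _ _} (lam {s = s}) (_ , eq , ()) | _ , _ , refl
  matches-expands {σ} {t = lam b t} (lam {a} {s}) m with matches-lam⁻ {σ = σ} {s = s} m
  ... | inj₂ (a# , m′) = _ , lam (λ { (lam _ a∈) → a# a∈ }) , m′ ∷ []
  ... | inj₁ (refl , m′) = _ , lam (λ { (lam a≢a _) → a≢a refl }) ,
        subst (λ t′ → Matches σ (s ⊴ t′)) (sym (swap-same a t)) m′ ∷ []
  matches-expands {σ} (app {ss = ss}) (_ , eq , e∼) with map-just {m = ss ⟨ σ ⟩*} eq
  matches-expands {σ} (app {f} {ss}) m@(_ , eq , app {es′ = ts} _) | _ , _ , refl =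
    _ , app , Matcher-zip⁺ ss ts (matches-app⁻ {f = f} {ss} m)
  matches-expands {σ} (letrec {ss = ss} {r}) (_ , eq , e∼) with zipWith-just {m = ss ⟨ σ ⟩*} {r ⟨ σ ⟩} eq
  matches-expands {σ} (letrec {as = as} {u} {ss} {r}) m@(_ , eq , letrec {bs = bs} {v = v} _ _ _ _ _ _) | _ , _ , _ , _ , refl
    with matches-letrec⁻ {σ = σ} {ss = ss} {r} m
  ... | as# , ρ , expand = _ , letrec as# ρ , expand ρ (aligning ρ as bs) (λ _ → refl) (aligning-renames ρ as bs u v)

-- Reachability up to reordering, and ground expressions as left-hand sides

module Reachability (S : Signature) where
  open Expansion S public

  private variable
    n : ℕ
    Γ Γ′ Δ : Problem
    σ : Subst

  infix 4 _⇝_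

  -- The program splits a problem into a worklist and a list of bindings, each in a definite order.
  -- Reorderings are therefore steps of their own, later absorbed by the `_↭_` premise of the next
  -- rule or of `Solved`.
  _⇝_ : Problem → Problem → Set
  _⇝_ = Star (λ Γ Γ′ → Γ ↭ Γ′ ⊎ Γ ⟶ Γ′)

  ↭-⟶ : Γ ↭ Γ′ → Γ′ ⟶ Δ → Γ ⟶ Δ
  ↭-⟶ p (simplify (delete q s≐t))    = simplify (delete (↭-trans p q) s≐t)
  ↭-⟶ p (simplify (app q))           = simplify (app (↭-trans p q))
  ↭-⟶ p (simplify (lam q))           = simplify (lam (↭-trans p q))
  ↭-⟶ p (simplify (lam-α q a≢b a#))  = simplify (lam-α (↭-trans p q) a≢b a#)
  ↭-⟶ p (simplify (susp q))          = simplify (susp (↭-trans p q))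
  ↭-⟶ p (simplify (merge q e₁∼e₂))   = simplify (merge (↭-trans p q) e₁∼e₂)
  ↭-⟶ p (letrec q as# ρ π ren)       = letrec (↭-trans p q) as# ρ π ren

  ↭-output : Γ ↭ Γ′ → Output Γ′ σ → Output Γ σ
  ↭-output p (_ , ε , q , u)         = _ , ε , ↭-trans p q , u
  ↭-output p (_ , st ◅ sts , sol)    = _ , ↭-⟶ p st ◅ sts , sol

  ⇝-output : Γ ⇝ Γ′ → Output Γ′ σ → Output Γ σ
  ⇝-output ε                out = out
  ⇝-output (inj₁ p ◅ sts)  out = ↭-output p (⇝-output sts out)
  ⇝-output (inj₂ st ◅ sts) out = ⟶-output st (⇝-output sts out)

  ⇝-sound : Γ ⇝ Γ′ → Matcher Γ′ σ → Matcher Γ σ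
  ⇝-sound ε                ms = ms
  ⇝-sound (inj₁ p ◅ sts)  ms = ↭.All-resp-↭ (↭-sym p) (⇝-sound sts ms)
  ⇝-sound (inj₂ st ◅ sts) ms = ⟶-sound st (⇝-sound sts ms)

  ⇝-lhsSize : Γ ⇝ Γ′ → lhsSize Γ′ ≤ lhsSize Γ
  ⇝-lhsSize ε                = ≤-refl
  ⇝-lhsSize (inj₁ p ◅ sts)  = ≤-trans (⇝-lhsSize sts) (≤-reflexive (sym (lhsSize-↭ p)))
  ⇝-lhsSize (inj₂ st ◅ sts) = ≤-trans (⇝-lhsSize sts) (<⇒≤ (⟶-lhsSize st))

  mutual
    embed : LRL → LRLX
    embed (atom a)           = atom a
    embed (lam a e)          = lam a (embed e)
    embed (app f es)         = app f (embed* es)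
    embed (letrec as u es e) = letrec as u (embed* es) (embed e)

    embed* : Vec LRL n → Vec LRLX n
    embed* []       = []
    embed* (e ∷ es) = embed e ∷ embed* es

  mutual
    embed-instance : ∀ e → embed e ⟨ σ ⟩ ≡ just e
    embed-instance (atom a)   = refl
    embed-instance {σ} (lam a e)  rewrite embed-instance {σ} e = refl
    embed-instance {σ} (app f es) rewrite embed*-instance {σ = σ} es = refl
    embed-instance {σ} (letrec as u es e) rewrite embed*-instance {σ = σ} es | embed-instance {σ} e = refl

    embed*-instance : ∀ (es : Vec LRL n) → embed* es ⟨ σ ⟩* ≡ just es
    embed*-instance []       = refl
    embed*-instance {σ = σ} (e ∷ es) rewrite embed-instance {σ} e | embed*-instance {σ = σ} es = refl

  mutual
    embed-size : ∀ e → ∣ embed e ∣ ≡ ∣ e ∣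
    embed-size (atom a)               = refl
    embed-size (lam a e)              = cong (λ k → suc (suc k)) (embed-size e)
    embed-size (app f es)             = cong suc (embed*-size es)
    embed-size (letrec {n} as u es e) = cong (λ k → suc (n + k)) (cong₂ _+_ (embed*-size es) (embed-size e))

    embed*-size : ∀ (es : Vec LRL n) → ∣ embed* es ∣* ≡ ∣ es ∣*
    embed*-size []       = refl
    embed*-size (e ∷ es) = cong₂ _+_ (embed-size e) (embed*-size es)

  data LhsView : LRLX → Set where
    isVar   : ∀ X → LhsView (var X)
    isSusp  : ∀ π X → LhsView (susp π X)
    isRigid : ∀ {s} → Rigid s → LhsView s

  lhsView : ∀ s → LhsView s
  lhsView (atom _)         = isRigid atom
  lhsView (lam _ _)        = isRigid lam
  lhsView (app _ _)        = isRigid app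
  lhsView (letrec _ _ _ _) = isRigid letrec
  lhsView (var X)          = isVar X
  lhsView (susp π X)       = isSusp π X

-- Execution of programs

module MachineLogic (P : Program) where
  open Program P
  open Machine P

  private variable
    n m k : ℕ
    c : Config
    Φ Ψ : Config → Set

  -- The branching-time modality "on every path, eventually", with a bound on the number of steps.
  -- `later` also asks for a successor, so a stuck configuration does not qualify vacuously and
  -- `inevitably-reachable` can extract a run.
  data Inevitably (Φ : Config → Set) : ℕ → Config → Set where
    now   : Φ c → Inevitably Φ n c
    later : ∃ (c ↦_) → (∀ {c′} → c ↦ c′ → Inevitably Φ n c′) → Inevitably Φ (suc n) c

  inevitably-mono : n ≤ m → (∀ {c} → Φ c → Ψ c) → Inevitably Φ n c → Inevitably Ψ m c
  inevitably-mono n≤m       h (now φ)         = now (h φ)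
  inevitably-mono (s≤s n≤m) h (later ∃c next) = later ∃c (λ st → inevitably-mono n≤m h (next st))

  inevitably-trans : Inevitably Φ n c → (∀ {c} → Φ c → Inevitably Ψ m c) → Inevitably Ψ (n + m) c
  inevitably-trans {n = n} {m = m} (now φ) h = inevitably-mono (m≤n+m m n) id (h φ)
  inevitably-trans (later ∃c next) h = later ∃c (λ st → inevitably-trans (next st) h)

  inevitably-reachable : Inevitably Φ n c → ∃[ c′ ] Star _↦_ c c′ × Φ c′
  inevitably-reachable (now φ) = _ , ε , φ
  inevitably-reachable (later (c′ , st) next) with inevitably-reachable (next st)
  ... | c″ , sts , φ = c″ , st ◅ sts , φ

  -- Counts the transitions caused by each constructor: three for `_∙_`, two for `bind` and `match`,
  -- one for `choose` and `call`. Entering the called body is charged to `callCost`. Alternatives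
  -- are added rather than maximised.
  weight : ∀ {m n} → Term m n → ℕ
  weight (var x)           = 1
  weight leaf              = 1
  weight (e₁ ∙ e₂)         = 3 + (weight e₁ + weight e₂)
  weight (bind e₁ e₂)      = 2 + (weight e₁ + weight e₂)
  weight (match e e₀ e₁)   = 2 + (weight e + (weight e₀ + weight e₁))
  weight (call f e)        = 1 + weight e
  weight (choose e₁ e₂)    = 1 + (weight e₁ + weight e₂)

  -- One call pays for evaluating a whole body once, so that only calls need to be counted.
  callCost : ℕ
  callCost = suc (sum (Data.List.tabulate (weight ∘ body)))

  private
    body-weight : ∀ f → suc (weight (body f)) ≤ callCost
    body-weight f = s≤s (term≤sum (weight ∘ body) f)
      where
      term≤sum : ∀ {m} (h : Fin m → ℕ) i → h i ≤ sum (Data.List.tabulate h)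
      term≤sum h zero    = m≤m+n _ _
      term≤sum h (suc i) = ≤-trans (term≤sum (h ∘ suc) i) (m≤n+m _ (h zero))

  data Returns (U : Tree → Set) (K : List Frame) : Config → Set where
    returns : ∀ {w} → U w → Returns U K (return w K)

  -- n counts calls; weight e pays for the rest of the evaluation of e.
  record Must (e : Code m) (ρ : Env m) (n : ℕ) (U : Tree → Set) : Set where
    constructor must
    field run : ∀ K → Inevitably (Returns U K) (weight e + callCost * n) (eval e ρ K)
  open Must public

  record MustCall (f : Fin (suc others)) (v : Tree) (n : ℕ) (U : Tree → Set) : Set where
    constructor mustCall
    field runCall : ∀ K → Inevitably (Returns U K) (callCost * n) (return v (callᶠ f ∷ K))
  open MustCall public

  private variable
    e e₀ e₁ e₂ : Code m
    ρ : Env m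
    f : Fin (suc others)
    v w l r : Tree
    n₁ n₂ : ℕ
    U U₁ U₂ : Tree → Set
    K : List Frame

  -- A Boolean, so that on concrete code the implicit argument `T (pure e)` is found by computation.
  pure : Code m → Bool
  pure (var x)   = true
  pure leaf      = true
  pure (e₁ ∙ e₂) = pure e₁ ∧ pure e₂
  pure _         = false

  -- Meaningful on pure terms only.
  value : Code m → Env m → Tree
  value (var x)   ρ = lookup ρ x
  value (e₁ ∙ e₂) ρ = value e₁ ρ ∙ value e₂ ρ
  value _         ρ = leaf

  private
    T-∧ˡ : ∀ {x y} → T (x ∧ y) → T x
    T-∧ˡ {true} _ = tt

    T-∧ʳ : ∀ {x y} → T (x ∧ y) → T y
    T-∧ʳ {true} t = t

    forced : ∀ {c′} → c ↦ c′ → (∀ {c″} → c ↦ c″ → c″ ≡ c′) → Inevitably Φ n c′ → Inevitably Φ (suc n) c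
    forced st unique run = later (_ , st) λ st′ → subst (Inevitably _ _) (sym (unique st′)) run

    pure-run : ∀ (e : Code m) → T (pure e) → ∀ K → Inevitably (_≡ return (value e ρ) K) (weight e) (eval e ρ K)
    pure-run (var x) p K = forced var (λ { var → refl }) (now refl)
    pure-run leaf    p K = forced leaf (λ { leaf → refl }) (now refl)
    pure-run {ρ = ρ} (e₁ ∙ e₂) p K = forced cons (λ { cons → refl }) (inevitably-mono (≤-reflexive arith) id
      (inevitably-trans (pure-run e₁ (T-∧ˡ p) _) λ { refl → forced consˡ (λ { consˡ → refl })
        (inevitably-trans (pure-run e₂ (T-∧ʳ {pure e₁} p) _) λ { refl → forced {n = 0} consʳ (λ { consʳ → refl }) (now refl) }) }))
      where
      arith : weight e₁ + suc (weight e₂ + 1) ≡ 2 + (weight e₁ + weight e₂)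
      arith = trans (+-suc (weight e₁) (weight e₂ + 1))
        (cong suc (trans (cong (weight e₁ +_) (ℕ.+-comm (weight e₂) 1)) (+-suc (weight e₁) (weight e₂))))

    split : ∀ x y n₁ n₂ → x + callCost * n₁ + (y + callCost * n₂) ≡ (x + y) + callCost * (n₁ + n₂)
    split x y n₁ n₂ = trans (ℕ.+-assoc x _ _) (trans (cong (x +_) (trans (sym (ℕ.+-assoc (callCost * n₁) y _))
      (trans (cong (_+ callCost * n₂) (ℕ.+-comm (callCost * n₁) y)) (ℕ.+-assoc y _ _))))
      (trans (sym (ℕ.+-assoc x y _)) (cong ((x + y) +_) (sym (ℕ.*-distribˡ-+ callCost n₁ n₂)))))

  weaken : n₁ ≤ n₂ → Must e ρ n₁ U → Must e ρ n₂ U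
  weaken {e = e} n≤ p .run K = inevitably-mono (+-monoʳ-≤ (weight e) (ℕ.*-monoʳ-≤ callCost n≤)) id (p .run K)

  weakenCall : n₁ ≤ n₂ → MustCall f v n₁ U → MustCall f v n₂ U
  weakenCall n≤ p .runCall K = inevitably-mono (ℕ.*-monoʳ-≤ callCost n≤) id (p .runCall K)

  must-⊆ : (∀ {w} → U₁ w → U₂ w) → Must e ρ n U₁ → Must e ρ n U₂
  must-⊆ h p .run K = inevitably-mono ≤-refl (λ { (returns u) → returns (h u) }) (p .run K)

  call-⊆ : (∀ {w} → U₁ w → U₂ w) → MustCall f v n U₁ → MustCall f v n U₂
  call-⊆ h p .runCall K = inevitably-mono ≤-refl (λ { (returns u) → returns (h u) }) (p .runCall K)

  must-return : {e : Code m} {_ : T (pure e)} → U (value e ρ) → Must e ρ 0 U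
  must-return {e = e} {p} u .run K =
    inevitably-mono (m≤m+n _ _) (λ { refl → returns u }) (pure-run e p K)

  must-call : {e : Code m} {_ : T (pure e)} → MustCall f (value e ρ) n U → Must (call f e) ρ n U
  must-call {e = e} {p} c .run K = forced call (λ { call → refl })
    (inevitably-trans (pure-run e p _) λ { refl → c .runCall K })

  must-bind : Must e₁ ρ n₁ U₁ → (∀ {w} → U₁ w → Must e₂ (w ∷ ρ) n₂ U) → Must (bind e₁ e₂) ρ (n₁ + n₂) U
  must-bind {e₁ = e₁} {n₁ = n₁} {e₂ = e₂} {n₂ = n₂} p q .run K = forced bind (λ { bind → refl })
    (inevitably-mono (≤-reflexive (trans (+-suc _ _) (cong suc (split (weight e₁) (weight e₂) n₁ n₂)))) id
      (inevitably-trans (p .run _) λ { (returns u) → forced bindᶠ (λ { bindᶠ → refl }) (q u .run K) }))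

  must-match : Must e ρ n₁ U₁ → (U₁ leaf → Must e₀ ρ n₂ U) → (∀ {l r} → U₁ (l ∙ r) → Must e₁ (l ∷ r ∷ ρ) n₂ U) →
               Must (match e e₀ e₁) ρ (n₁ + n₂) U
  must-match {e = e} {n₁ = n₁} {e₀ = e₀} {n₂ = n₂} {e₁ = e₁} p q₀ q₁ .run K = forced match (λ { match → refl })
    (inevitably-mono (≤-reflexive (trans (+-suc _ _) (cong suc (split (weight e) (weight e₀ + weight e₁) n₁ n₂)))) id
      (inevitably-trans (p .run _) λ
        { (returns {leaf} u)  → forced matchˡ (λ { matchˡ → refl })
            (inevitably-mono (+-monoˡ-≤ (callCost * n₂) (m≤m+n (weight e₀) (weight e₁))) id (q₀ u .run K))
        ; (returns {l ∙ r} u) → forced matchⁿ (λ { matchⁿ → refl })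
            (inevitably-mono (+-monoˡ-≤ (callCost * n₂) (m≤n+m (weight e₁) (weight e₀))) id (q₁ u .run K)) }))

  must-choose : Must e₁ ρ n U → Must e₂ ρ n U → Must (choose e₁ e₂) ρ n U
  must-choose {e₁ = e₁} {n = n} {e₂ = e₂} p q .run K = later (_ , choose₁) λ
    { choose₁ → inevitably-mono (+-monoˡ-≤ (callCost * n) (m≤m+n (weight e₁) (weight e₂))) id (p .run K)
    ; choose₂ → inevitably-mono (+-monoˡ-≤ (callCost * n) (m≤n+m (weight e₂) (weight e₁))) id (q .run K) }

  -- The only rule that spends a call: `callCost` exceeds the weight of every body by one, which
  -- pays for the transition `callᶠ`.
  must-body : Must (body f) (v ∷ []) n U → MustCall f v (suc n) U
  must-body {f = f} {n = n} p .runCall K = inevitably-mono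
    (≤-trans (+-monoˡ-≤ (callCost * n) (body-weight f)) (≤-reflexive (sym (ℕ.*-suc callCost n)))) id
    (forced callᶠ (λ { callᶠ → refl }) (p .run K))

  must-bind≡ : Must e₁ ρ n₁ (_≡ w) → Must e₂ (w ∷ ρ) n₂ U → Must (bind e₁ e₂) ρ (n₁ + n₂) U
  must-bind≡ p q = must-bind p λ { refl → q }

  must-leaf : Must e ρ n₁ (_≡ leaf) → Must e₀ ρ n₂ U → Must (match e e₀ e₁) ρ (n₁ + n₂) U
  must-leaf p q = must-match p (λ _ → q) λ ()

  must-node : Must e ρ n₁ (_≡ l ∙ r) → Must e₁ (l ∷ r ∷ ρ) n₂ U → Must (match e e₀ e₁) ρ (n₁ + n₂) U
  must-node p q = must-match p (λ ()) λ { refl → q }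

  on-leaf : {e : Code m} {_ : T (pure e)} → value e ρ ≡ leaf → Must e₀ ρ n U → Must (match e e₀ e₁) ρ n U
  on-leaf {e = e} {p} eq q = must-leaf (must-return {e = e} {p} eq) q

  on-node : {e : Code m} {_ : T (pure e)} → value e ρ ≡ l ∙ r → Must e₁ (l ∷ r ∷ ρ) n U → Must (match e e₀ e₁) ρ n U
  on-node {e = e} {p} eq q = must-node (must-return {e = e} {p} eq) q

  infix 4 _,_⇓ₑ_

  _,_⇓ₑ_ : Code m → Env m → Tree → Set
  e , ρ ⇓ₑ w = ∀ K → Star _↦_ (eval e ρ K) (return w K)

  MayCall : Fin (suc others) → Tree → Tree → Set
  MayCall f v w = ∀ K → Star _↦_ (return v (callᶠ f ∷ K)) (return w K)

  -- Deterministic subprograms are specified once: a `Must` statement with a single possible result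
  -- already yields a run.
  must⇒may : Must e ρ n (_≡ w) → e , ρ ⇓ₑ w
  must⇒may p K with inevitably-reachable (p .run K)
  ... | _ , sts , returns refl = sts

  mustCall⇒may : MustCall f v n (_≡ w) → MayCall f v w
  mustCall⇒may p K with inevitably-reachable (p .runCall K)
  ... | _ , sts , returns refl = sts

  pure-may : (e : Code m) → {_ : T (pure e)} → e , ρ ⇓ₑ value e ρ
  pure-may e {p} = must⇒may (must-return {e = e} {p} refl)

  may-call : {e : Code m} {_ : T (pure e)} → MayCall f (value e ρ) w → call f e , ρ ⇓ₑ w
  may-call {e = e} {p} c K = call ◅ (pure-may e {p} _ ◅◅ c K)

  may-body : body f , (v ∷ []) ⇓ₑ w → MayCall f v w
  may-body p K = callᶠ ◅ p K

  may-bind : e₁ , ρ ⇓ₑ v → e₂ , (v ∷ ρ) ⇓ₑ w → bind e₁ e₂ , ρ ⇓ₑ w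
  may-bind p q K = bind ◅ (p _ ◅◅ (bindᶠ ◅ q K))

  may-choose₁ : e₁ , ρ ⇓ₑ w → choose e₁ e₂ , ρ ⇓ₑ w
  may-choose₁ p K = choose₁ ◅ p K

  may-choose₂ : e₂ , ρ ⇓ₑ w → choose e₁ e₂ , ρ ⇓ₑ w
  may-choose₂ p K = choose₂ ◅ p K

  may-leaf : e , ρ ⇓ₑ leaf → e₀ , ρ ⇓ₑ w → match e e₀ e₁ , ρ ⇓ₑ w
  may-leaf p q K = match ◅ (p _ ◅◅ (matchˡ ◅ q K))

  may-node : e , ρ ⇓ₑ l ∙ r → e₁ , (l ∷ r ∷ ρ) ⇓ₑ w → match e e₀ e₁ , ρ ⇓ₑ w
  may-node p q K = match ◅ (p _ ◅◅ (matchⁿ ◅ q K))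

  may-on-leaf : {e : Code m} {_ : T (pure e)} → value e ρ ≡ leaf → e₀ , ρ ⇓ₑ w → match e e₀ e₁ , ρ ⇓ₑ w
  may-on-leaf {e = e} {p} eq = may-leaf (must⇒may (must-return {e = e} {p} eq))

  may-on-node : {e : Code m} {_ : T (pure e)} → value e ρ ≡ l ∙ r → e₁ , (l ∷ r ∷ ρ) ⇓ₑ w → match e e₀ e₁ , ρ ⇓ₑ w
  may-on-node {e = e} {p} eq = may-node (must⇒may (must-return {e = e} {p} eq))

  inevitably-bounded : ∀ {U} → Inevitably (Returns U []) n c → ∀ {k c′} → Iter _↦_ k c c′ → k ≤ n
  inevitably-bounded p               stop         = z≤n
  inevitably-bounded (later _ next)  (step st sts) = s≤s (inevitably-bounded (next st) sts)
  inevitably-bounded (now (returns _)) (step () _)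

  inevitably-final : ∀ {U} → Inevitably (Returns U []) n c → Star _↦_ c (return w []) → U w
  inevitably-final (now (returns u)) ε          = u
  inevitably-final (now (returns u)) (() ◅ _)
  inevitably-final (later (_ , ()) _) ε
  inevitably-final (later _ next)     (st ◅ sts) = inevitably-final (next st) sts

  must-runs-within : Must (body zero) (v ∷ []) n U → RunsWithin v (weight (body zero) + callCost * n)
  must-runs-within p = inevitably-bounded (p .run [])

  must-final : Must (body zero) (v ∷ []) n U → v ⇓ w → U w
  must-final p = inevitably-final (p .run [])

-- The matching program

-- Variables are de Bruijn indices; a binding or a match pushes what it binds on top.  Lists are encoded as
-- in Encoding, failure and falsity as leaf.
module LetrecMatch where

  Code : ℕ → Set
  Code = Term 23

  pattern mainᶠ    = zero
  pattern equalᶠ   = suc zero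
  pattern renameᶠ  = suc equalᶠ
  pattern applyᶠ   = suc renameᶠ
  pattern apply*ᶠ  = suc applyᶠ
  pattern applyᵇᶠ  = suc apply*ᶠ
  pattern occursᶠ  = suc applyᵇᶠ
  pattern occurs*ᶠ = suc occursᶠ
  pattern occursᵇᶠ = suc occurs*ᶠ
  pattern reverseᶠ = suc occursᵇᶠ
  pattern alignᶠ   = suc reverseᶠ
  pattern insertᶠ  = suc alignᶠ
  pattern shuffleᶠ = suc insertᶠ
  pattern freshᶠ   = suc shuffleᶠ
  pattern zipᵇᶠ    = suc freshᶠ
  pattern zipᶠ     = suc zipᵇᶠ
  pattern lamᶠ     = suc zipᶠ
  pattern appᶠ     = suc lamᶠ
  pattern letrecᶠ  = suc appᶠ
  pattern stepᶠ    = suc letrecᶠ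
  pattern decompᶠ  = suc stepᶠ
  pattern lookupᶠ  = suc decompᶠ
  pattern mergeᶠ   = suc lookupᶠ

  private
    v : ∀ {n} (i : ℕ) {i< : T (i <ᵇ n)} → Code n
    v i {i<} = var (Data.Fin.fromℕ< (ℕ.<ᵇ⇒< i _ i<))

    -- A leaf is answered by a leaf. Applied to the result of a call, this propagates failure, or
    -- forms a conjunction of tests.
    unpair : ∀ {n} → Code n → Code (suc (suc n)) → Code n
    unpair e = match e leaf

  yes′ : ∀ {n} → Code n
  yes′ = leaf ∙ leaf

  -- Repeated variables are merged only after all equations have become bindings; `leaf` is the
  -- empty accumulator of either phase.
  mainBody : Code 1
  mainBody = unpair (call decompᶠ (v 0 ∙ leaf)) (call mergeᶠ (v 1 ∙ leaf))

  -- x ∙ y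
  equalBody : Code 1
  equalBody = unpair (v 0) (match (v 0)
    (match (v 1) yes′ leaf)
    (unpair (v 3) (unpair (call equalᶠ (v 2 ∙ v 0)) (call equalᶠ (v 5 ∙ v 3)))))

  -- π ∙ c
  renameBody : Code 1
  renameBody = unpair (v 0) (match (v 0) (v 1) (unpair (v 0)
    (bind (call renameᶠ (v 3 ∙ v 5))
      (match (call equalᶠ (v 1 ∙ v 0))
        (match (call equalᶠ (v 2 ∙ v 0)) (v 0) (v 3))
        (v 4)))))

  -- π ∙ e
  applyBody : Code 1
  applyBody = unpair (v 0) (unpair (v 1) (match (v 0)
    (bind (call renameᶠ (v 2 ∙ v 1)) (leaf ∙ v 0))
    (match (v 1)
      (unpair (v 3) (bind (call renameᶠ (v 6 ∙ v 0)) (bind (call applyᶠ (v 7 ∙ v 2)) ((leaf ∙ leaf) ∙ v 1 ∙ v 0))))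
      (match (v 1)
        (unpair (v 5) (bind (call apply*ᶠ (v 8 ∙ v 1)) ((leaf ∙ leaf ∙ leaf) ∙ v 1 ∙ v 0)))
        (unpair (v 7) (bind (call applyᵇᶠ (v 10 ∙ v 0)) (bind (call applyᶠ (v 11 ∙ v 2))
          ((leaf ∙ leaf ∙ leaf ∙ leaf) ∙ v 1 ∙ v 0))))))))

  -- π ∙ es
  apply*Body : Code 1
  apply*Body = unpair (v 0) (unpair (v 1)
    (bind (call applyᶠ (v 2 ∙ v 0)) (bind (call apply*ᶠ (v 3 ∙ v 2)) (v 1 ∙ v 0))))

  -- π ∙ bs
  applyᵇBody : Code 1
  applyᵇBody = unpair (v 0) (unpair (v 1) (unpair (v 0)
    (bind (call renameᶠ (v 4 ∙ v 0)) (bind (call applyᶠ (v 5 ∙ v 2)) (bind (call applyᵇᶠ (v 6 ∙ v 5))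
      ((v 2 ∙ v 1) ∙ v 0))))))

  -- c ∙ e
  occursBody : Code 1
  occursBody = unpair (v 0) (unpair (v 1) (match (v 0)
    (call equalᶠ (v 1 ∙ v 2))
    (match (v 1)
      (unpair (v 3) (match (call equalᶠ (v 0 ∙ v 6)) (call occursᶠ (v 6 ∙ v 1)) leaf))
      (match (v 1)
        (unpair (v 5) (call occurs*ᶠ (v 8 ∙ v 1)))
        (unpair (v 7) (bind (call occursᶠ (v 10 ∙ v 1)) (call occursᵇᶠ (v 11 ∙ v 1 ∙ v 0))))))))

  -- c ∙ es
  occurs*Body : Code 1
  occurs*Body = unpair (v 0) (unpair (v 1)
    (match (call occursᶠ (v 2 ∙ v 0)) (call occurs*ᶠ (v 2 ∙ v 1)) yes′))

  -- c ∙ bs ∙ acc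
  occursᵇBody : Code 1
  occursᵇBody = unpair (v 0) (unpair (v 1) (match (v 0) (v 1) (unpair (v 0)
    (match (call equalᶠ (v 0 ∙ v 6))
      (match (v 5)
        (bind (call occursᶠ (v 6 ∙ v 1)) (call occursᵇᶠ (v 7 ∙ v 4 ∙ v 0)))
        (call occursᵇᶠ (v 8 ∙ v 5 ∙ yes′)))
      leaf))))

  -- π ∙ acc
  reverseBody : Code 1
  reverseBody = unpair (v 0) (match (v 0) (v 1) (call reverseᶠ (v 1 ∙ v 0 ∙ v 3)))

  -- as ∙ bs ∙ π
  alignBody : Code 1
  alignBody = unpair (v 0) (unpair (v 1) (match (v 2)
    (match (v 0) (leaf ∙ v 1) leaf)
    (unpair (v 2) (unpair (v 2) (unpair (v 2)
      (bind (call renameᶠ (v 9 ∙ v 0)) (call alignᶠ (v 8 ∙ v 6 ∙ (v 3 ∙ v 0) ∙ v 10))))))))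

  -- x ∙ ys
  insertBody : Code 1
  insertBody = unpair (v 0) (choose (v 0 ∙ v 1)
    (match (v 1) (v 0 ∙ leaf) (bind (call insertᶠ (v 2 ∙ v 1)) (v 1 ∙ v 0))))

  -- Inserting every element at a guessed position reaches every order. The leaf returned by
  -- `unpair` is here the empty list.
  shuffleBody : Code 1
  shuffleBody = unpair (v 0) (bind (call shuffleᶠ (v 1)) (call insertᶠ (v 1 ∙ v 0)))

  -- as ∙ e
  freshBody : Code 1
  freshBody = unpair (v 0) (match (v 0) yes′ (unpair (v 0)
    (match (call occursᶠ (v 0 ∙ v 5)) (call freshᶠ (v 3 ∙ v 5)) leaf)))

  -- as ∙ bs ∙ π ∙ Γ
  zipᵇBody : Code 1
  zipᵇBody = unpair (v 0) (unpair (v 1) (unpair (v 1) (match (v 4) (v 1)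
    (unpair (v 4) (unpair (v 2) (unpair (v 2)
      (bind (call applyᶠ (v 8 ∙ v 1)) (bind (call zipᵇᶠ (v 8 ∙ v 6 ∙ v 9 ∙ v 10)) ((v 5 ∙ v 1) ∙ v 0)))))))))

  -- ss ∙ ts ∙ Γ
  zipBody : Code 1
  zipBody = unpair (v 0) (unpair (v 1) (match (v 2) (v 1)
    (unpair (v 2) (bind (call zipᶠ (v 3 ∙ v 1 ∙ v 5)) ((v 3 ∙ v 1) ∙ v 0)))))

  -- (a ∙ s) ∙ t ∙ Γ
  lamBody : Code 1
  lamBody = unpair (v 0) (unpair (v 1) (unpair (v 2) (unpair (v 2) (unpair (v 1)
    (match (call occursᶠ (v 4 ∙ v 6))
      (bind (call applyᶠ (((v 4 ∙ v 0) ∙ leaf) ∙ v 1)) (leaf ∙ (v 6 ∙ v 0) ∙ v 8))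
      leaf)))))

  -- (f ∙ ss) ∙ (g ∙ ts) ∙ Γ
  appBody : Code 1
  appBody = unpair (v 0) (unpair (v 1) (unpair (v 2) (unpair (v 2)
    (unpair (call equalᶠ (v 2 ∙ v 0)) (bind (call zipᶠ (v 5 ∙ v 3 ∙ v 7)) (leaf ∙ v 0))))))

  -- What follows the guess, which is deterministic. Left and right numbers of bindings are compared
  -- only here: `alignᶠ` returns a leaf when they differ.
  shuffledBody : Code 12
  shuffledBody = unpair (call freshᶠ (v 5 ∙ v 7)) (unpair (call alignᶠ (v 7 ∙ v 2 ∙ leaf))
    (bind (call applyᶠ (v 1 ∙ v 6)) (bind (call zipᵇᶠ (v 10 ∙ v 5 ∙ v 2 ∙ v 13)) (leaf ∙ (v 12 ∙ v 1) ∙ v 0))))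

  -- (as ∙ r) ∙ t ∙ Γ
  letrecBody : Code 1
  letrecBody = unpair (v 0) (unpair (v 1) (unpair (v 2) (unpair (v 2) (unpair (v 1)
    (bind (call shuffleᶠ (v 0)) shuffledBody)))))

  -- (s ∙ t) ∙ Γ
  stepBody : Code 1
  stepBody = unpair (v 0) (unpair (v 0) (unpair (v 0) (unpair (v 3)
    (unpair (call equalᶠ (v 2 ∙ v 0)) (match (v 4)
      (unpair (call equalᶠ (v 5 ∙ v 3)) (leaf ∙ v 11))
      (match (v 1)
        (call lamᶠ (v 7 ∙ v 9 ∙ v 11))
        (match (v 1)
          (call appᶠ (v 9 ∙ v 7 ∙ v 13))
          (call letrecᶠ (v 11 ∙ v 13 ∙ v 15)))))))))

  -- Γ ∙ σ
  decompBody : Code 1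
  decompBody = unpair (v 0) (match (v 0) (leaf ∙ v 1) (unpair (v 0) (unpair (v 0)
    -- The constants on this line and the next are the numerals 4 and 5, the tags of variables and
    -- suspensions.
    (match (call equalᶠ (v 0 ∙ (leaf ∙ leaf ∙ leaf ∙ leaf ∙ leaf)))
      (match (call equalᶠ (v 0 ∙ (leaf ∙ leaf ∙ leaf ∙ leaf ∙ leaf ∙ leaf)))
        (unpair (call stepᶠ (v 4 ∙ v 5)) (call decompᶠ (v 1 ∙ v 9)))
        (unpair (v 3) (bind (call reverseᶠ (v 0 ∙ leaf)) (bind (call applyᶠ (v 0 ∙ v 8))
          (call decompᶠ (v 11 ∙ (v 3 ∙ v 0) ∙ v 13))))))
      (call decompᶠ (v 7 ∙ (v 3 ∙ v 5) ∙ v 9))))))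

  -- X ∙ σ
  lookupBody : Code 1
  lookupBody = unpair (v 0) (unpair (v 1) (unpair (v 0)
    (match (call equalᶠ (v 4 ∙ v 0)) (call lookupᶠ (v 4 ∙ v 3)) (leaf ∙ v 3))))

  -- σ ∙ τ
  mergeBody : Code 1
  mergeBody = unpair (v 0) (match (v 0) (leaf ∙ v 1) (unpair (v 0)
    (match (call lookupᶠ (v 0 ∙ v 5))
      (call mergeᶠ (v 3 ∙ v 2 ∙ v 5))
      -- The expression found in τ becomes the left-hand side of a problem with one equation. It is
      -- ground, so a successful decomposition leaves no bindings.
      (unpair (call decompᶠ (((v 1 ∙ v 3) ∙ leaf) ∙ leaf)) (match (v 1) (call mergeᶠ (v 7 ∙ v 9)) leaf)))))

  program : Program
  program = record { others = 22 ; body = lookup (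
    mainBody ∷ equalBody ∷ renameBody ∷ applyBody ∷ apply*Body ∷ applyᵇBody ∷ occursBody ∷ occurs*Body ∷ occursᵇBody ∷ reverseBody ∷ alignBody ∷
    insertBody ∷ shuffleBody ∷ freshBody ∷ zipᵇBody ∷ zipBody ∷ lamBody ∷ appBody ∷ letrecBody ∷ stepBody ∷ decompBody ∷ lookupBody ∷ mergeBody ∷ []) }

-- Equality of trees

module _ where
  open LetrecMatch
  open MachineLogic program

  boolean : Bool → Tree
  boolean true  = leaf ∙ leaf
  boolean false = leaf

  equalᵗ : Tree → Tree → Bool
  equalᵗ leaf    leaf      = true
  equalᵗ leaf    (_ ∙ _)   = false
  equalᵗ (_ ∙ _) leaf      = false
  equalᵗ (l ∙ r) (l′ ∙ r′) = equalᵗ l l′ ∧ equalᵗ r r′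

  equalᵗ-refl : ∀ x → equalᵗ x x ≡ true
  equalᵗ-refl leaf    = refl
  equalᵗ-refl (l ∙ r) rewrite equalᵗ-refl l = equalᵗ-refl r

  equalᵗ-sound : ∀ x y → equalᵗ x y ≡ true → x ≡ y
  equalᵗ-sound leaf    leaf      eq = refl
  equalᵗ-sound (l ∙ r) (l′ ∙ r′) eq with equalᵗ l l′ in eqˡ
  ... | true = cong₂ _∙_ (equalᵗ-sound l l′ eqˡ) (equalᵗ-sound r r′ eq)

  must-if : ∀ {n} {e e₀ : Code n} {e₁ ρ n₁ n₂ U} b → Must e ρ n₁ (_≡ boolean b) →
            (b ≡ true → Must e₁ (leaf ∷ leaf ∷ ρ) n₂ U) → (b ≡ false → Must e₀ ρ n₂ U) →
            Must (match e e₀ e₁) ρ (n₁ + n₂) U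
  must-if true  p q q₀ = must-node p (q refl)
  must-if false p q q₀ = must-leaf p (q₀ refl)

  -- Every call consumes a node of x, so the first argument alone determines the bound and the
  -- second may be of any size.
  equal-spec : ∀ x y → MustCall equalᶠ (x ∙ y) ∣ x ∣ᵗ (_≡ boolean (equalᵗ x y))
  equal-spec leaf    leaf      = must-body (on-node refl (on-leaf refl (on-leaf refl (must-return refl))))
  equal-spec leaf    (_ ∙ _)   = must-body (on-node refl (on-leaf refl (on-node refl (must-return refl))))
  equal-spec (l ∙ r) leaf      = must-body (weaken z≤n (on-node refl (on-node refl (on-leaf refl (must-return refl)))))
  equal-spec (l ∙ r) (l′ ∙ r′) = must-body (on-node refl (on-node refl (on-node refl
    (must-if (equalᵗ l l′) (must-call (equal-spec l l′))
      (λ eq → must-⊆ (λ p → trans p (cong (λ b → boolean (b ∧ equalᵗ r r′)) (sym eq))) (must-call (equal-spec r r′)))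
      (λ eq → weaken z≤n (must-return (cong (λ b → boolean (b ∧ equalᵗ r r′)) (sym eq))))))))

-- Numbers of calls, when the sizes of names, expressions and substitutions are at most B.
module Costs (B : ℕ) where

  renameCost : ℕ → ℕ
  renameCost n = suc (n * suc (B + B))

  -- Pays for a comparison of names as well as for a renaming, so that the occurrence test and the
  -- action of a permutation share the bound `traverse`.
  atomCost : ℕ
  atomCost = B + renameCost B

  perNode traversal : ℕ
  perNode   = 3 + atomCost
  traversal = perNode * B

  lamCost appCost freshCost alignCost zipCost shuffledCost letrecCost stepCost : ℕ
  lamCost      = suc (traversal + traversal)
  appCost      = suc (B + suc B)
  freshCost    = suc (B * suc traversal)
  alignCost    = suc (B * suc atomCost)
  zipCost      = suc (B * suc traversal)
  shuffledCost = freshCost + (alignCost + (traversal + zipCost))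
  letrecCost   = suc (suc B * suc B + shuffledCost)
  -- The size of the numeral 3, the largest tag of a non-variable expression, is 7. The costs of all
  -- alternatives are added.
  stepCost     = suc (7 + (B + (lamCost + (appCost + letrecCost))))

  unfoldCost : ℕ
  -- Two tag tests of at most 11 calls, 11 being the size of the numeral 5; then a step, or the
  -- reversal and application of a permutation.
  unfoldCost = 22 + (stepCost + (suc B + traversal))

  decompCost : ℕ → ℕ
  decompCost k = suc (k * suc unfoldCost)

  lookupCost mergeStepCost : ℕ
  lookupCost    = suc (B * suc B)
  mergeStepCost = lookupCost + decompCost B

  mergeCost : ℕ → ℕ
  mergeCost k = suc (k * suc mergeStepCost)

  mainCost : ℕ
  mainCost = decompCost B + mergeCost B

-- Specifications of renaming and of the occurrence test

module Specifications (S : Signature) (N : Matching.Naming S) (B : ℕ) where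
  open Reachability S public
  open Naming N public
  open Encoding N public renaming (subst to bindingList)
  open LetrecMatch public
  open MachineLogic program public
  open Costs B public

  private variable
    n : ℕ
    V : Set

  nameₐ : Atom → Tree
  nameₐ = Injection.to atoms

  namef : Fun → Tree
  namef = Injection.to funs

  nameᵥ : Var → Tree
  nameᵥ = Injection.to vars

  name-test : ∀ {A : Set} (name : A ↣ Tree) {x y : A} (d : Dec (x ≡ y)) →
              equalᵗ (Injection.to name x) (Injection.to name y) ≡ does d
  name-test name (yes refl) = equalᵗ-refl (Injection.to name _)
  name-test name {x} {y} (no x≢y) with equalᵗ (Injection.to name x) (Injection.to name y) in eq
  ... | true  = contradiction (Injection.injective name (equalᵗ-sound _ _ eq)) x≢y
  ... | false = refl

  equal-names : ∀ {A : Set} (name : A ↣ Tree) {x y : A} → ∣ Injection.to name x ∣ᵗ ≤ B → (d : Dec (x ≡ y)) →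
                MustCall equalᶠ (Injection.to name x ∙ Injection.to name y) B (_≡ boolean (does d))
  equal-names name x≤ d = weakenCall x≤ (call-⊆ (λ p → trans p (cong boolean (name-test name d))) (equal-spec _ _))

  Smallₐ : Atom → Set
  Smallₐ a = ∣ nameₐ a ∣ᵗ ≤ B

  Smallᵥ : Var → Set
  Smallᵥ X = ∣ nameᵥ X ∣ᵗ ≤ B

  SmallPerm : Perm → Set
  SmallPerm = All (λ (a , b) → Smallₐ a × Smallₐ b)

  mutual
    -- The size of an expression counts every name as one, so the sizes of names need a bound of
    -- their own.
    Small : (V → Set) → Exp V → Set
    Small Q (atom a)           = Smallₐ a
    Small Q (lam a e)          = Smallₐ a × Small Q e
    Small Q (app f es)         = ∣ namef f ∣ᵗ ≤ B × Small* Q es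
    Small Q (letrec as _ es e) = Allᵥ.All Smallₐ as × Small* Q es × Small Q e
    Small Q (var X)            = Q X
    Small Q (susp π X)         = SmallPerm π × Q X

    Small* : (V → Set) → Vec (Exp V) n → Set
    Small* Q []       = ⊤
    Small* Q (e ∷ es) = Small Q e × Small* Q es

  Smallᵍ : LRL → Set
  Smallᵍ = Small λ ()

  rename-spec : ∀ π c → SmallPerm π → MustCall renameᶠ (swappings π ∙ nameₐ c) (renameCost (length π)) (_≡ nameₐ (π ·ₐ c))
  rename-spec []            c [] = must-body (on-node refl (on-leaf refl (must-return refl)))
  rename-spec ((a , b) ∷ π) c ((a≤ , b≤) ∷ small) = must-body (on-node refl (on-node refl (on-node refl
    (weaken (≤-reflexive arith) (must-bind≡ (must-call (rename-spec π c small))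
      (must-if (does (a ≟ₐ d)) (must-call (equal-names atoms a≤ (a ≟ₐ d)))
        (λ eq → weaken z≤n (must-return (result (cong (λ x → if x then b else if does (b ≟ₐ d) then a else d) eq))))
        (λ eq → weaken (≤-reflexive (+-identityʳ B)) (must-if (does (b ≟ₐ d)) (must-call (equal-names atoms b≤ (b ≟ₐ d)))
          (λ eq′ → must-return (result (cong₂ (λ x y → if x then b else if y then a else d) eq eq′)))
          (λ eq′ → must-return (result (cong₂ (λ x y → if x then b else if y then a else d) eq eq′)))))))))))
    where
    d : Atom
    d = π ·ₐ c
    arith : suc (length π * suc (B + B)) + (B + B) ≡ suc (B + B) + length π * suc (B + B)
    arith = cong suc (ℕ.+-comm (length π * suc (B + B)) (B + B))
    -- The program puts the name from the swapping first, because its size is the one known to be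
    -- bounded; hence the tests are turned around with respect to `swap`.
    swap-test : swap a b d ≡ (if does (a ≟ₐ d) then b else if does (b ≟ₐ d) then a else d)
    swap-test with d ≟ₐ a | d ≟ₐ b | a ≟ₐ d | b ≟ₐ d
    ... | yes _   | _        | yes _   | _       = refl
    ... | yes d≡a | _        | no a≢d  | _       = contradiction (sym d≡a) a≢d
    ... | no d≢a  | _        | yes a≡d | _       = contradiction (sym a≡d) d≢a
    ... | no _    | yes _    | no _    | yes _   = refl
    ... | no _    | yes d≡b  | no _    | no b≢d  = contradiction (sym d≡b) b≢d
    ... | no _    | no d≢b   | no _    | yes b≡d = contradiction (sym b≡d) d≢b
    ... | no _    | no _     | no _    | no _    = refl
    result : ∀ {x} → (if does (a ≟ₐ d) then b else if does (b ≟ₐ d) then a else d) ≡ x → nameₐ x ≡ nameₐ (swap a b d)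
    result eq = cong nameₐ (trans (sym eq) (sym swap-test))

  rename-spec′ : ∀ π c → SmallPerm π → length π ≤ B → MustCall renameᶠ (swappings π ∙ nameₐ c) atomCost (_≡ nameₐ (π ·ₐ c))
  rename-spec′ π c small len = weakenCall
    (≤-trans (s≤s (*-monoˡ-≤ (suc (B + B)) len)) (m≤n+m (renameCost B) B)) (rename-spec π c small)

  mutual
    -- Calls made on an expression by the occurrence test or by the action of a permutation. Only
    -- ground expressions are traversed, hence zero at variables.
    traverse : Exp V → ℕ
    traverse (atom _)           = suc atomCost
    traverse (lam _ e)          = suc (atomCost + traverse e)
    traverse (app _ es)         = suc (traverse* es)
    traverse (letrec _ _ es e)  = suc (traverseᵇ es + traverse e)
    traverse (var _)            = 0
    traverse (susp _ _)         = 0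

    traverse* : Vec (Exp V) n → ℕ
    traverse* []       = 1
    traverse* (e ∷ es) = suc (traverse e + traverse* es)

    traverseᵇ : Vec (Exp V) n → ℕ
    traverseᵇ []       = 1
    traverseᵇ (e ∷ es) = suc (atomCost + (traverse e + traverseᵇ es))

  mutual
    apply-spec : ∀ π (e : LRL) → SmallPerm π → length π ≤ B →
                 MustCall applyᶠ (swappings π ∙ ground e) (traverse e) (_≡ ground (π · e))
    apply-spec π (atom a) small len = must-body (on-node refl (on-node refl (on-leaf refl
      (weaken (≤-reflexive (+-identityʳ _)) (must-bind≡ (must-call (rename-spec′ π a small len)) (must-return refl))))))
    apply-spec π (lam a e) small len = must-body (on-node refl (on-node refl (on-node refl (on-leaf refl (on-node refl
      (weaken (≤-reflexive (cong (atomCost +_) (+-identityʳ _)))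
        (must-bind≡ (must-call (rename-spec′ π a small len)) (must-bind≡ (must-call (apply-spec π e small len)) (must-return refl)))))))))
    apply-spec π (app f es) small len = must-body (on-node refl (on-node refl (on-node refl (on-node refl (on-leaf refl (on-node refl
      (weaken (≤-reflexive (+-identityʳ _)) (must-bind≡ (must-call (apply*-spec π es small len)) (must-return refl)))))))))
    apply-spec π (letrec as u es e) small len = must-body (on-node refl (on-node refl (on-node refl (on-node refl (on-node refl (on-node refl
      (weaken (≤-reflexive (cong (traverseᵇ es +_) (+-identityʳ _)))
        (must-bind≡ (must-call (applyᵇ-spec π as es small len)) (must-bind≡ (must-call (apply-spec π e small len)) (must-return refl))))))))))

    apply*-spec : ∀ π (es : Vec LRL n) → SmallPerm π → length π ≤ B →
                  MustCall apply*ᶠ (swappings π ∙ exps ⊥-elim es) (traverse* es) (_≡ exps ⊥-elim (π ·* es))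
    apply*-spec π []       small len = must-body (on-node refl (on-leaf refl (must-return refl)))
    apply*-spec π (e ∷ es) small len = must-body (on-node refl (on-node refl
      (weaken (≤-reflexive (cong (traverse e +_) (+-identityʳ _)))
        (must-bind≡ (must-call (apply-spec π e small len)) (must-bind≡ (must-call (apply*-spec π es small len)) (must-return refl))))))

    applyᵇ-spec : ∀ π (as : Vec Atom n) (es : Vec LRL n) → SmallPerm π → length π ≤ B →
                  MustCall applyᵇᶠ (swappings π ∙ bindings ⊥-elim as es) (traverseᵇ es)
                           (_≡ bindings ⊥-elim (Vec.map (π ·ₐ_) as) (π ·* es))
    applyᵇ-spec π []       []       small len = must-body (on-node refl (on-leaf refl (must-return refl)))
    applyᵇ-spec π (a ∷ as) (e ∷ es) small len = must-body (on-node refl (on-node refl (on-node refl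
      (weaken (≤-reflexive (cong (λ k → atomCost + (traverse e + k)) (+-identityʳ _)))
        (must-bind≡ (must-call (rename-spec′ π a small len)) (must-bind≡ (must-call (apply-spec π e small len))
          (must-bind≡ (must-call (applyᵇ-spec π as es small len)) (must-return refl))))))))

  equal-atoms : ∀ {a} c → Smallₐ a → MustCall equalᶠ (nameₐ a ∙ nameₐ c) atomCost (_≡ boolean (does (a ≟ₐ c)))
  equal-atoms {a} c a≤ = weakenCall (m≤m+n B (renameCost B)) (equal-names atoms a≤ (a ≟ₐ c))

  mutual
    occurs-spec : ∀ c (e : LRL) → Smallᵍ e → MustCall occursᶠ (nameₐ c ∙ ground e) (traverse e) (_≡ boolean (occurs c e))
    occurs-spec c (atom a) a≤ = must-body (on-node refl (on-node refl (on-leaf refl (must-call (equal-atoms c a≤)))))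
    occurs-spec c (lam a e) (a≤ , e≤) = must-body (on-node refl (on-node refl (on-node refl (on-leaf refl (on-node refl
      (must-if (does (a ≟ₐ c)) (must-call (equal-atoms c a≤))
        (λ eq → weaken z≤n (must-return (cong (λ b → boolean (if b then false else occurs c e)) (sym eq))))
        (λ eq → must-⊆ (λ p → trans p (cong (λ b → boolean (if b then false else occurs c e)) (sym eq)))
                       (must-call (occurs-spec c e e≤)))))))))
    occurs-spec c (app f es) (_ , es≤) = must-body (on-node refl (on-node refl (on-node refl (on-node refl (on-leaf refl (on-node refl
      (must-call (occurs*-spec c es es≤))))))))
    occurs-spec c (letrec as u es e) (as≤ , es≤ , e≤) = must-body (on-node refl (on-node refl (on-node refl (on-node refl (on-node refl (on-node refl
      (weaken (≤-reflexive (ℕ.+-comm (traverse e) (traverseᵇ es)))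
        (must-bind≡ (must-call (occurs-spec c e e≤)) (must-call (occursᵇ-spec c as es (occurs c e) as≤ es≤))))))))))

    occurs*-spec : ∀ c (es : Vec LRL n) → Small* (λ ()) es →
                   MustCall occurs*ᶠ (nameₐ c ∙ exps ⊥-elim es) (traverse* es) (_≡ boolean (occurs* c es))
    occurs*-spec c []       _          = must-body (on-node refl (on-leaf refl (must-return refl)))
    occurs*-spec c (e ∷ es) (e≤ , es≤) = must-body (on-node refl (on-node refl
      (must-if (occurs c e) (must-call (occurs-spec c e e≤))
        (λ eq → weaken z≤n (must-return (cong (λ b → boolean (b ∨ occurs* c es)) (sym eq))))
        (λ eq → must-⊆ (λ p → trans p (cong (λ b → boolean (b ∨ occurs* c es)) (sym eq)))
                       (must-call (occurs*-spec c es es≤))))))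

    occursᵇ-spec : ∀ c (as : Vec Atom n) (es : Vec LRL n) acc → Allᵥ.All Smallₐ as → Small* (λ ()) es →
                   MustCall occursᵇᶠ (nameₐ c ∙ bindings ⊥-elim as es ∙ boolean acc) (traverseᵇ es)
                            (_≡ boolean (occursᵇ c as es acc))
    occursᵇ-spec c []       []       acc _ _ = must-body (on-node refl (on-node refl (on-leaf refl (must-return refl))))
    occursᵇ-spec c (a ∷ as) (e ∷ es) acc (a≤ Allᵥ.∷ as≤) (e≤ , es≤) =
      must-body (on-node refl (on-node refl (on-node refl (on-node refl
        (must-if (does (a ≟ₐ c)) (must-call (equal-atoms c a≤))
          (λ eq → weaken z≤n (must-return (result eq)))
          (λ eq → must-⊆ (λ p → trans p (result eq)) (must-if acc (must-return refl)
            (λ { refl → weaken (m≤n+m _ (traverse e)) (must-call (occursᵇ-spec c as es true as≤ es≤)) })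
            (λ { refl → must-bind≡ (must-call (occurs-spec c e e≤)) (must-call (occursᵇ-spec c as es (occurs c e) as≤ es≤)) }))))))))
      where
      result : ∀ {b} → does (a ≟ₐ c) ≡ b → boolean (if b then false else occursᵇ c as es (acc ∨ occurs c e)) ≡
                                         boolean (occursᵇ c (a ∷ as) (e ∷ es) acc)
      result eq = cong (λ b → boolean (if b then false else occursᵇ c as es (acc ∨ occurs c e))) (sym eq)

-- Reduces an inequality to an equation for the ring solver, with the difference d given explicitly.
slack : ∀ {m n} d → m + d ≡ n → m ≤ n
slack d eq = ≤-trans (m≤m+n _ d) (≤-reflexive eq)

insertAt-punchIn : ∀ {A : Set} {n} (xs : Vec A n) k (x : A) i → lookup (Vec.insertAt xs k x) (punchIn k i) ≡ lookup xs i
insertAt-punchIn xs       zero    x i       = refl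
insertAt-punchIn (y ∷ xs) (suc k) x zero    = refl
insertAt-punchIn (y ∷ xs) (suc k) x (suc i) = insertAt-punchIn xs k x i

-- Alignment, freshness, zipping and shuffling

module Steps (S : Signature) (N : Matching.Naming S) (B : ℕ) where
  open Specifications S N B public

  private variable
    n m : ℕ
    V : Set
    Q : V → Set
    A : Set

  private
    lam-arith : ∀ K E → K + (1 + (3 + K) * E) + (5 + K) ≡ (3 + K) * (2 + E)
    lam-arith = solve-∀
    app-arith : ∀ K E → 2 + (1 + (3 + K) * E) + K ≡ (3 + K) * (1 + E)
    app-arith = solve-∀
    letrec-arith : ∀ K n Es E → suc ((1 + n * K + (3 + K) * Es) + (3 + K) * E) + (1 + K + 3 * n) ≡ (3 + K) * suc (n + (Es + E))
    letrec-arith = solve-∀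
    cons-arith : ∀ k E Es → k * E + (1 + k * Es) ≡ 1 + k * (E + Es)
    cons-arith = solve-∀
    binding-arith : ∀ K n k E Es → K + (k * E + (1 + n * K + k * Es)) ≡ 1 + (suc n) * K + k * (E + Es)
    binding-arith = solve-∀

  mutual
    -- The extra `suc` pays for the list cell that holds e, so a list costs just one call more, at
    -- its end. This explains the 3 in `perNode`: the node's own call, its cell, and the end of its
    -- list. The binders of a `letrec` are paid for because `∣_∣` counts them.
    traverse≤ : ∀ (e : Exp V) → suc (traverse e) ≤ perNode * ∣ e ∣
    traverse≤ (atom _) = slack 1 (trans (ℕ.+-comm (2 + atomCost) 1) (sym (ℕ.*-identityʳ perNode)))
    traverse≤ (lam _ e) = ≤-trans (≤-reflexive (trans (cong suc (sym (+-suc atomCost (traverse e)))) (sym (+-suc atomCost (suc (traverse e))))))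
      (≤-trans (+-monoʳ-≤ atomCost (s≤s (traverse≤ e))) (slack (5 + atomCost) (lam-arith atomCost ∣ e ∣)))
    traverse≤ (app _ es) = ≤-trans (s≤s (s≤s (traverse*≤ es))) (slack atomCost (app-arith atomCost ∣ es ∣*))
    traverse≤ (letrec {n} _ _ es e) = ≤-trans
      (s≤s (≤-trans (≤-reflexive (sym (+-suc (traverseᵇ es) (traverse e)))) (+-mono-≤ (traverseᵇ≤ es) (traverse≤ e))))
      (slack (1 + atomCost + 3 * n) (letrec-arith atomCost n ∣ es ∣* ∣ e ∣))
    traverse≤ (var _)    = s≤s z≤n
    traverse≤ (susp _ _) = s≤s z≤n

    traverse*≤ : ∀ (es : Vec (Exp V) n) → traverse* es ≤ 1 + perNode * ∣ es ∣*
    traverse*≤ []       = s≤s z≤n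
    traverse*≤ (e ∷ es) = ≤-trans (+-mono-≤ (traverse≤ e) (traverse*≤ es))
      (≤-reflexive (cons-arith perNode ∣ e ∣ ∣ es ∣*))

    traverseᵇ≤ : ∀ (es : Vec (Exp V) n) → traverseᵇ es ≤ 1 + n * atomCost + perNode * ∣ es ∣*
    traverseᵇ≤ []               = s≤s z≤n
    traverseᵇ≤ {n = suc n} (e ∷ es) = ≤-trans (≤-reflexive (sym (+-suc atomCost _)))
      (≤-trans (+-monoʳ-≤ atomCost (+-mono-≤ (traverse≤ e) (traverseᵇ≤ es)))
        (≤-reflexive (binding-arith atomCost n perNode ∣ e ∣ ∣ es ∣*)))

  swap-small : ∀ {a b c} → Smallₐ a → Smallₐ b → Smallₐ c → Smallₐ (swap a b c)
  swap-small {a} {b} {c} a≤ b≤ c≤ with c ≟ₐ a | c ≟ₐ b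
  ... | yes _ | _     = b≤
  ... | no  _ | yes _ = a≤
  ... | no  _ | no  _ = c≤

  ·ₐ-small : ∀ {π c} → SmallPerm π → Smallₐ c → Smallₐ (π ·ₐ c)
  ·ₐ-small []                   c≤ = c≤
  ·ₐ-small ((a≤ , b≤) ∷ small)  c≤ = swap-small a≤ b≤ (·ₐ-small small c≤)

  mutual
    -- Every name in `π · e` comes from π or from e, so the bound B never has to grow along a run.
    ·-small : ∀ {π} → SmallPerm π → ∀ e → Smallᵍ e → Smallᵍ (π · e)
    ·-small sm (atom a)           a≤                 = ·ₐ-small sm a≤
    ·-small sm (lam a e)          (a≤ , e≤)          = ·ₐ-small sm a≤ , ·-small sm e e≤
    ·-small sm (app f es)         (f≤ , es≤)         = f≤ , ·*-small sm es es≤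
    ·-small sm (letrec as _ es e) (as≤ , es≤ , e≤)   = map-small sm as as≤ , ·*-small sm es es≤ , ·-small sm e e≤

    ·*-small : ∀ {π} → SmallPerm π → ∀ (es : Vec LRL n) → Small* (λ ()) es → Small* (λ ()) (π ·* es)
    ·*-small sm []       _          = tt
    ·*-small sm (e ∷ es) (e≤ , es≤) = ·-small sm e e≤ , ·*-small sm es es≤

    map-small : ∀ {π} → SmallPerm π → ∀ (as : Vec Atom n) → Allᵥ.All Smallₐ as → Allᵥ.All Smallₐ (Vec.map (π ·ₐ_) as)
    map-small sm []       Allᵥ.[]         = Allᵥ.[]
    map-small sm (a ∷ as) (a≤ Allᵥ.∷ as≤) = ·ₐ-small sm a≤ Allᵥ.∷ map-small sm as as≤

  small-lookup : ∀ (es : Vec (Exp V) n) → Small* Q es → ∀ i → Small Q (lookup es i)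
  small-lookup (e ∷ es) (e≤ , _)  zero    = e≤
  small-lookup (e ∷ es) (_ , es≤) (suc i) = small-lookup es es≤ i

  align-small : ∀ (as bs : Vec Atom n) π → Allᵥ.All Smallₐ as → Allᵥ.All Smallₐ bs → SmallPerm π → SmallPerm (align as bs π)
  align-small []       []       π Allᵥ.[]         Allᵥ.[]         sm = sm
  align-small (a ∷ as) (b ∷ bs) π (a≤ Allᵥ.∷ as≤) (b≤ Allᵥ.∷ bs≤) sm =
    align-small as bs _ as≤ bs≤ ((a≤ , ·ₐ-small sm b≤) ∷ sm)

  align-length : ∀ (as bs : Vec Atom n) π → length (align as bs π) ≡ n + length π
  align-length []       []       π = refl
  align-length {suc n} (a ∷ as) (b ∷ bs) π = trans (align-length as bs _) (+-suc n (length π))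

  reverse-spec : ∀ π ϖ → MustCall reverseᶠ (swappings π ∙ swappings ϖ) (suc (length π)) (_≡ swappings (π ʳ++ ϖ))
  reverse-spec []      ϖ = must-body (on-node refl (on-leaf refl (must-return refl)))
  reverse-spec (p ∷ π) ϖ = must-body (on-node refl (on-node refl (must-call (reverse-spec π (p ∷ ϖ)))))

  private
    bindingsX : Vec Atom n → Vec LRLX n → Tree
    bindingsX = bindings nameᵥ

    bindingsᵍ : Vec Atom n → Vec LRL n → Tree
    bindingsᵍ = bindings ⊥-elim

  -- Each step turns one remaining pair of binders into a swapping, so `n + length π` is constant
  -- and `rename-spec′` applies throughout.
  align-spec : ∀ (as bs : Vec Atom n) ss ts π → SmallPerm π → Allᵥ.All Smallₐ as → Allᵥ.All Smallₐ bs → n + length π ≤ B →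
               MustCall alignᶠ (bindingsX as ss ∙ bindingsᵍ bs ts ∙ swappings π) (suc (n * suc atomCost))
                        (_≡ leaf ∙ swappings (align as bs π))
  align-spec []       []       []       []       π sm _ _ _ =
    must-body (on-node refl (on-node refl (on-leaf refl (on-leaf refl (must-return refl)))))
  align-spec {suc n} (a ∷ as) (b ∷ bs) (s ∷ ss) (t ∷ ts) π sm (a≤ Allᵥ.∷ as≤) (b≤ Allᵥ.∷ bs≤) len =
    must-body (on-node refl (on-node refl (on-node refl (on-node refl (on-node refl (on-node refl
      (weaken (≤-reflexive (+-suc atomCost _)) (must-bind≡ (must-call (rename-spec′ π b sm (≤-trans (m≤n+m _ (suc n)) len)))
        (must-call (align-spec as bs ss ts _ ((a≤ , ·ₐ-small sm b≤) ∷ sm) as≤ bs≤ (≤-trans (≤-reflexive (+-suc n (length π))) len)))))))))))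

  align-mismatch : ∀ (as : Vec Atom n) (bs : Vec Atom m) ss ts π → n ≢ m → SmallPerm π → Allᵥ.All Smallₐ as → Allᵥ.All Smallₐ bs →
                   n + length π ≤ B →
                   MustCall alignᶠ (bindingsX as ss ∙ bindingsᵍ bs ts ∙ swappings π) (suc (n * suc atomCost)) (_≡ leaf)
  align-mismatch []       []       []       []       π n≢m sm _ _ _ = contradiction refl n≢m
  align-mismatch []       (_ ∷ _)  []       (_ ∷ _)  π n≢m sm _ _ _ =
    must-body (on-node refl (on-node refl (on-leaf refl (on-node refl (must-return refl)))))
  align-mismatch (_ ∷ _)  []       (_ ∷ _)  []       π n≢m sm _ _ _ =
    must-body (weaken z≤n (on-node refl (on-node refl (on-node refl (on-leaf refl (must-return refl))))))
  align-mismatch {suc n} (a ∷ as) (b ∷ bs) (s ∷ ss) (t ∷ ts) π n≢m sm (a≤ Allᵥ.∷ as≤) (b≤ Allᵥ.∷ bs≤) len =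
    must-body (on-node refl (on-node refl (on-node refl (on-node refl (on-node refl (on-node refl
      (weaken (≤-reflexive (+-suc atomCost _)) (must-bind≡ (must-call (rename-spec′ π b sm (≤-trans (m≤n+m _ (suc n)) len)))
        (must-call (align-mismatch as bs ss ts _ (n≢m ∘ cong suc) ((a≤ , ·ₐ-small sm b≤) ∷ sm) as≤ bs≤
          (≤-trans (≤-reflexive (+-suc n (length π))) len)))))))))))

  fresh : Vec Atom n → LRL → Bool
  fresh []       e = true
  fresh (a ∷ as) e = if occurs a e then false else fresh as e

  fresh⇒#* : ∀ (as : Vec Atom n) e → fresh as e ≡ true → as #* e
  fresh⇒#* (a ∷ as) e eq i a∈ with occurs a e in o
  fresh⇒#* (a ∷ as) e eq zero    a∈ | false = case trans (sym o) (∈FA⇒occurs a∈) of λ ()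
  fresh⇒#* (a ∷ as) e eq (suc i) a∈ | false = fresh⇒#* as e eq i a∈

  #*⇒fresh : ∀ (as : Vec Atom n) e → as #* e → fresh as e ≡ true
  #*⇒fresh []       e as# = refl
  #*⇒fresh (a ∷ as) e as# with occurs a e in o
  ... | true  = contradiction (occurs⇒∈FA e o) (as# zero)
  ... | false = #*⇒fresh as e (as# ∘ suc)

  fresh-spec : ∀ (as : Vec Atom n) ss e → Smallᵍ e →
               MustCall freshᶠ (bindingsX as ss ∙ ground e) (suc (n * suc (traverse e))) (_≡ boolean (fresh as e))
  fresh-spec []       []       e e≤ = must-body (on-node refl (on-leaf refl (must-return refl)))
  fresh-spec {suc n} (a ∷ as) (s ∷ ss) e e≤ = must-body (on-node refl (on-node refl (on-node refl
    (weaken (≤-reflexive (+-suc (traverse e) _)) (must-if (occurs a e) (must-call (occurs-spec a e e≤))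
      (λ eq → weaken z≤n (must-return (result eq)))
      (λ eq → must-⊆ (λ p → trans p (result eq)) (must-call (fresh-spec as ss e e≤))))))))
    where
    result : ∀ {b} → occurs a e ≡ b → boolean (if b then false else fresh as e) ≡ boolean (fresh (a ∷ as) e)
    result eq = cong (λ b → boolean (if b then false else fresh as e)) (sym eq)

  zipᵇ-spec : ∀ (as : Vec Atom n) ss (bs : Vec Atom n) ts π Γ → SmallPerm π → length π ≤ B →
              MustCall zipᵇᶠ (bindingsX as ss ∙ bindingsᵍ bs ts ∙ swappings π ∙ problem Γ) (traverse* ts)
                       (_≡ problem (toList (Vec.zipWith (λ s t → s ⊴ π · t) ss ts) ++ Γ))
  zipᵇ-spec []       []       []       []       π Γ sm len =
    must-body (on-node refl (on-node refl (on-node refl (on-leaf refl (must-return refl)))))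
  zipᵇ-spec (a ∷ as) (s ∷ ss) (b ∷ bs) (t ∷ ts) π Γ sm len =
    must-body (on-node refl (on-node refl (on-node refl (on-node refl (on-node refl (on-node refl (on-node refl
      (weaken (≤-reflexive (cong (traverse t +_) (+-identityʳ _)))
        (must-bind≡ (must-call (apply-spec π t sm len)) (must-bind≡ (must-call (zipᵇ-spec as ss bs ts π Γ sm len))
          (must-return refl)))))))))))

  zip-spec : ∀ (ss : Vec LRLX n) (ts : Vec LRL n) Γ →
             MustCall zipᶠ (exps nameᵥ ss ∙ exps ⊥-elim ts ∙ problem Γ) (suc n)
                      (_≡ problem (toList (Vec.zipWith _⊴_ ss ts) ++ Γ))
  zip-spec []       []       Γ = must-body (on-node refl (on-node refl (on-leaf refl (must-return refl))))
  zip-spec (s ∷ ss) (t ∷ ts) Γ = must-body (on-node refl (on-node refl (on-node refl (on-node refl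
    (weaken (≤-reflexive (+-identityʳ _)) (must-bind≡ (must-call (zip-spec ss ts Γ)) (must-return refl)))))))

  treeList : Vec Tree n → Tree
  treeList []       = leaf
  treeList (x ∷ xs) = x ∙ treeList xs

  insert-must : ∀ x (xs : Vec Tree n) →
                MustCall insertᶠ (x ∙ treeList xs) (suc n) (λ w → ∃[ k ] w ≡ treeList (Vec.insertAt xs k x))
  insert-must x []       = must-body (on-node refl (must-choose (must-return (zero , refl)) (on-leaf refl (must-return (zero , refl)))))
  insert-must x (y ∷ xs) = must-body (on-node refl (must-choose (weaken z≤n (must-return (zero , refl)))
    (on-node refl (weaken (≤-reflexive (+-identityʳ _)) (must-bind (must-call (insert-must x xs)) λ { (k , refl) → must-return (suc k , refl) })))))

  insert-may : ∀ x (xs : Vec Tree n) k → MayCall insertᶠ (x ∙ treeList xs) (treeList (Vec.insertAt xs k x))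
  insert-may x xs       zero    = may-body (may-on-node refl (may-choose₁ (pure-may (var zero ∙ var (suc zero)))))
  insert-may x (y ∷ xs) (suc k) = may-body (may-on-node refl (may-choose₂
    (may-on-node refl (may-bind (may-call (insert-may x xs k)) (pure-may (var (suc zero) ∙ var zero))))))

  -- The permutation `insert k zero ρ` sends k to the head and follows ρ around the gap at k, which
  -- is exactly what inserting x at k does to the reordered tail.
  insertAt-reorder : (x : A) (xs : Vec A n) → ∀ k ρ → Vec.insertAt (reorder xs ρ) k x ≡ reorder (x ∷ xs) (insert k zero ρ)
  insertAt-reorder x xs k ρ = trans (sym (Vec.tabulate∘lookup _)) (Vec.tabulate-cong pointwise)
    where
    open ≡-Reasoning
    pointwise : ∀ i → lookup (Vec.insertAt (reorder xs ρ) k x) i ≡ lookup (x ∷ xs) (insert k zero ρ ⟨$⟩ʳ i)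
    pointwise i with k ≟ᶠ i
    ... | yes refl = Vec.insertAt-lookup (reorder xs ρ) k x
    ... | no k≢i   = begin
      lookup (Vec.insertAt (reorder xs ρ) k x) i   ≡⟨ cong (lookup (Vec.insertAt (reorder xs ρ) k x)) (sym (punchIn-punchOut k≢i)) ⟩
      lookup (Vec.insertAt (reorder xs ρ) k x) (punchIn k (punchOut k≢i)) ≡⟨ insertAt-punchIn (reorder xs ρ) k x (punchOut k≢i) ⟩
      lookup (reorder xs ρ) (punchOut k≢i)         ≡⟨ lookup-reorder xs ρ (punchOut k≢i) ⟩
      lookup xs (ρ ⟨$⟩ʳ punchOut k≢i)              ∎

  reorder-≈ : ∀ (xs : Vec A n) {ρ ρ′ : Permutation′ n} → ρ ≈ₚ ρ′ → reorder xs ρ ≡ reorder xs ρ′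
  reorder-≈ xs eq = Vec.tabulate-cong (cong (lookup xs) ∘ eq)

  shuffleCost : ℕ → ℕ
  shuffleCost zero    = 1
  shuffleCost (suc n) = suc (shuffleCost n + suc n)

  shuffle-must : ∀ (xs : Vec Tree n) →
                 MustCall shuffleᶠ (treeList xs) (shuffleCost n) (λ w → ∃[ ρ ] w ≡ treeList (reorder xs ρ))
  shuffle-must []       = must-body (on-leaf refl (must-return (idₚ , refl)))
  shuffle-must (x ∷ xs) = must-body (on-node refl (must-bind (must-call (shuffle-must xs)) λ { (ρ , refl) →
    must-⊆ (λ (k , p) → insert k zero ρ , trans p (cong treeList (insertAt-reorder x xs k ρ)))
           (must-call (insert-must x (reorder xs ρ))) }))

  shuffle-may : ∀ (xs : Vec Tree n) ρ → MayCall shuffleᶠ (treeList xs) (treeList (reorder xs ρ))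
  shuffle-may []       ρ = mustCall⇒may (must-body (on-leaf refl (must-return refl)))
  shuffle-may (x ∷ xs) ρ = subst (λ w → MayCall shuffleᶠ (treeList (x ∷ xs)) (treeList w)) same
    (may-body (may-on-node refl (may-bind (may-call (shuffle-may xs (remove k ρ))) (may-call (insert-may x (reorder xs (remove k ρ)) k)))))
    where
    -- The place at which ρ wants the head; removing it leaves the permutation for the tail.
    k = ρ ⟨$⟩ˡ zero
    same : Vec.insertAt (reorder xs (remove k ρ)) k x ≡ reorder (x ∷ xs) ρ
    same = trans (insertAt-reorder x xs k (remove k ρ)) (reorder-≈ (x ∷ xs) {insert k zero (remove k ρ)} {ρ} λ i →
      trans (cong (λ j → insert k j (remove k ρ) ⟨$⟩ʳ i) (sym (inverseʳ ρ {zero}))) (insert-remove k ρ i))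

  treeList-bindings : ∀ (nm : V → Tree) (as : Vec Atom n) es → treeList (Vec.zipWith (λ a e → nameₐ a ∙ exp nm e) as es) ≡ bindings nm as es
  treeList-bindings nm []       []       = refl
  treeList-bindings nm (a ∷ as) (e ∷ es) = cong (_ ∙_) (treeList-bindings nm as es)

  bindings-reorder : ∀ (as : Vec Atom n) (es : Vec LRL n) ρ →
                     treeList (reorder (Vec.zipWith (λ a e → nameₐ a ∙ ground e) as es) ρ) ≡ bindingsᵍ (reorder as ρ) (reorder es ρ)
  bindings-reorder as es ρ = trans (cong treeList (begin
      reorder (Vec.zipWith f as es) ρ                           ≡⟨ Vec.tabulate-cong (λ i → Vec.lookup-zipWith f (ρ ⟨$⟩ʳ i) as es) ⟩
      tabulate (λ i → f (lookup as (ρ ⟨$⟩ʳ i)) (lookup es (ρ ⟨$⟩ʳ i)))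
        ≡⟨ Vec.tabulate-cong (λ i → sym (cong₂ f (lookup-reorder as ρ i) (lookup-reorder es ρ i))) ⟩
      tabulate (λ i → f (lookup (reorder as ρ) i) (lookup (reorder es ρ) i)) ≡⟨ sym (zipWith-tabulate (reorder as ρ) (reorder es ρ)) ⟩
      Vec.zipWith f (reorder as ρ) (reorder es ρ)               ∎))
    (treeList-bindings ⊥-elim (reorder as ρ) (reorder es ρ))
    where
    open ≡-Reasoning
    f : Atom → LRL → Tree
    f a e = nameₐ a ∙ ground e

-- Abstraction, function and letrec steps

module StepSpecifications (S : Signature) (N : Matching.Naming S) (B : ℕ) where
  open Steps S N B public

  private variable
    n m : ℕ
    q : Equation
    Γ Δ : Problem

  SmallEq : Equation → Set
  SmallEq (s ⊴ t) = (Small Smallᵥ s × ∣ s ∣ ≤ B) × (Smallᵍ t × ∣ t ∣ ≤ B)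

  vec-length≤size : ∀ {V} (es : Vec (Exp V) n) → n ≤ ∣ es ∣*
  vec-length≤size []       = z≤n
  vec-length≤size (e ∷ es) = +-mono-≤ (size-positive e) (vec-length≤size es)

  zip-small : ∀ (ss : Vec LRLX n) ts → (∀ i → SmallEq (lookup ss i ⊴ lookup ts i)) → All SmallEq (toList (Vec.zipWith _⊴_ ss ts))
  zip-small []       []       h = []
  zip-small (s ∷ ss) (t ∷ ts) h = h zero ∷ zip-small ss ts (h ∘ suc)

  aligning-small : (ρ : Permutation′ n) {as bs : Vec Atom n} → Allᵥ.All Smallₐ as → Allᵥ.All Smallₐ bs → SmallPerm (aligning ρ as bs)
  aligning-small ρ {as} {bs} as≤ bs≤ = align-small as (reorder bs ρ) [] as≤ (reorder-small bs≤) []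
    where
    reorder-small : Allᵥ.All Smallₐ bs → Allᵥ.All Smallₐ (reorder bs ρ)
    reorder-small bs≤ = Allᵥ.tabulate⁺ (λ i → Allᵥ.lookup⁺ bs≤ (ρ ⟨$⟩ʳ i))

  aligning-length : (ρ : Permutation′ n) (as bs : Vec Atom n) → length (aligning ρ as bs) ≡ n
  aligning-length {n} ρ as bs = trans (align-length as (reorder bs ρ) []) (+-identityʳ n)

  expands-small : Expands q Δ → SmallEq q → All SmallEq Δ
  expands-small atom _ = []
  expands-small (lam {a} {b} {s} {t} _) (((a≤ , s≤) , ∣s∣) , ((b≤ , t≤) , ∣t∣)) =
    ((s≤ , ≤-trans (m≤n+m _ 2) ∣s∣) ,
     (·-small ((a≤ , b≤) ∷ []) t t≤ , permuted≤ ((a , b) ∷ []) t (m≤n+m _ 2) ∣t∣)) ∷ []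
  expands-small (app {ss = ss} {ts}) (((_ , ss≤) , ∣ss∣) , ((_ , ts≤) , ∣ts∣)) = zip-small ss ts λ i →
    (small-lookup ss ss≤ i , ≤-trans (lookup-size ss i) (<⇒≤ ∣ss∣)) ,
    (small-lookup ts ts≤ i , ≤-trans (lookup-size ts i) (<⇒≤ ∣ts∣))
  expands-small (letrec {n} {as} {bs} {ss = ss} {r} {ts} {r′} _ ρ) (((as≤ , ss≤ , r≤) , ∣s∣) , ((bs≤ , ts≤ , r′≤) , ∣t∣)) =
    ((r≤ , ≤-trans (≤-trans (m≤n+m _ ∣ ss ∣*) (m≤n+m _ (suc n))) ∣s∣) ,
     (·-small π≤ r′ r′≤ , permuted≤ π r′ (≤-trans (m≤n+m _ ∣ ts ∣*) (m≤n+m _ (suc n))) ∣t∣)) ∷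
    All-toList⁺ _ λ i → subst SmallEq (sym (Vec.lookup∘tabulate _ i))
      ((small-lookup ss ss≤ i , ≤-trans (≤-trans (lookup-size ss i) (≤-trans (m≤m+n _ ∣ r ∣) (m≤n+m _ (suc n)))) ∣s∣) ,
       (·-small π≤ (lookup ts (ρ ⟨$⟩ʳ i)) (small-lookup ts ts≤ (ρ ⟨$⟩ʳ i)) ,
        permuted≤ π (lookup ts (ρ ⟨$⟩ʳ i))
          (≤-trans (lookup-size ts (ρ ⟨$⟩ʳ i)) (≤-trans (m≤m+n _ ∣ r′ ∣) (m≤n+m _ (suc n)))) ∣t∣))
    where
    π = aligning ρ as bs
    π≤ : SmallPerm π
    π≤ = aligning-small ρ as≤ bs≤

  traverse≤traversal : ∀ {V} (e : Exp V) → ∣ e ∣ ≤ B → traverse e ≤ traversal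
  traverse≤traversal e ∣e∣ = ≤-trans (n≤1+n _) (≤-trans (traverse≤ e) (ℕ.*-monoʳ-≤ perNode ∣e∣))

  traverse*≤traversals : ∀ {V} (es : Vec (Exp V) n) → (∀ i → ∣ lookup es i ∣ ≤ B) → traverse* es ≤ suc (n * suc traversal)
  traverse*≤traversals []       h = ≤-refl
  traverse*≤traversals {suc n} (e ∷ es) h = s≤s (≤-trans
    (+-mono-≤ (traverse≤traversal e (h zero)) (traverse*≤traversals es (h ∘ suc))) (≤-reflexive (+-suc traversal _)))

  shuffleCost≤ : ∀ n → shuffleCost n ≤ suc n * suc n
  shuffleCost≤ zero    = ≤-refl
  shuffleCost≤ (suc n) = ≤-trans (s≤s (+-monoˡ-≤ (suc n) (shuffleCost≤ n))) (slack (suc n) (arith n))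
    where
    arith : ∀ n → suc (suc n * suc n + suc n) + suc n ≡ suc (suc n) * suc (suc n)
    arith = solve-∀

  -- Keeping the outcome a function of the freshness test lets one deterministic specification serve
  -- both `step-must` and `step-may`.
  accepted : Bool → Problem → Tree
  accepted true  Δ = leaf ∙ problem Δ
  accepted false Δ = leaf

  lam-spec : ∀ {a b s t} → SmallEq (lam a s ⊴ lam b t) →
             MustCall lamᶠ ((nameₐ a ∙ exp nameᵥ s) ∙ ground (lam b t) ∙ problem Γ) lamCost
               (_≡ accepted (not (occurs a (lam b t))) ((s ⊴ ((a , b) ∷ []) · t) ∷ Γ))
  lam-spec {Γ = Γ} {a} {b} {s} {t} (((a≤ , s≤) , ∣s∣) , (t≤ , ∣t∣)) =
    must-body (on-node refl (on-node refl (on-node refl (on-node refl (on-node refl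
      (must-if (occurs a (lam b t)) (weaken (traverse≤traversal (lam b t) ∣t∣) (must-call (occurs-spec a (lam b t) t≤)))
        (λ eq → weaken z≤n (must-return (result eq)))
        (λ eq → weaken (≤-trans (≤-reflexive (+-identityʳ _)) (traverse≤traversal t (≤-trans (m≤n+m _ 2) ∣t∣)))
          (must-bind≡ (must-call (apply-spec ((a , b) ∷ []) t ((a≤ , proj₁ t≤) ∷ []) (≤-trans (s≤s z≤n) ∣s∣)))
            (must-return (result eq))))))))))
    where
    result : ∀ {c} → occurs a (lam b t) ≡ c →
             accepted (not c) ((s ⊴ ((a , b) ∷ []) · t) ∷ Γ) ≡ accepted (not (occurs a (lam b t))) ((s ⊴ ((a , b) ∷ []) · t) ∷ Γ)
    result eq = cong (λ c → accepted (not c) ((s ⊴ ((a , b) ∷ []) · t) ∷ Γ)) (sym eq)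

  app-match : ∀ {f ss ts} → SmallEq (app f ss ⊴ app f ts) →
              MustCall appᶠ ((namef f ∙ exps nameᵥ ss) ∙ (namef f ∙ exps ⊥-elim ts) ∙ problem Γ) appCost
                (_≡ leaf ∙ problem (toList (Vec.zipWith _⊴_ ss ts) ++ Γ))
  app-match {Γ = Γ} {f} {ss} {ts} (((f≤ , _) , ∣s∣) , _) = must-body (on-node refl (on-node refl (on-node refl (on-node refl
    (must-node (must-call (equal-names funs f≤ (yes refl)))
      (weaken (s≤s (≤-trans (≤-reflexive (+-identityʳ _)) (≤-trans (vec-length≤size ss) (<⇒≤ ∣s∣))))
        (must-bind≡ (must-call (zip-spec ss ts Γ)) (must-return refl))))))))

  app-clash : ∀ {f g x y z} → f ≢ g → ∣ namef f ∣ᵗ ≤ B →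
              MustCall appᶠ ((namef f ∙ x) ∙ (namef g ∙ y) ∙ z) appCost (_≡ leaf)
  app-clash f≢g f≤ = must-body (on-node refl (on-node refl (on-node refl (on-node refl
    (weaken (+-monoʳ-≤ B z≤n) (must-leaf (must-call (equal-names funs f≤ (no f≢g))) (must-return refl)))))))

  summand≤B : ∀ n {k} → suc (n + k) ≤ B → n ≤ B
  summand≤B n size = ≤-trans (m≤m+n n _) (<⇒≤ size)

  module _ {as : Vec Atom n} .{u} {ss r} {bs : Vec Atom m} .{v} {ts r′}
           (small : SmallEq (letrec as u ss r ⊴ letrec bs v ts r′)) where

    private
      E : LRL
      E = letrec bs v ts r′
      as≤ = proj₁ (proj₁ (proj₁ small))
      bs≤ = proj₁ (proj₁ (proj₂ small))
      E≤ = proj₂ (proj₂ small)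
      n≤B = summand≤B n (proj₂ (proj₁ small))
      m≤B = summand≤B m E≤

    fresh-spec′ : MustCall freshᶠ (bindings nameᵥ as ss ∙ ground E) freshCost (_≡ boolean (fresh as E))
    fresh-spec′ = weakenCall (s≤s (ℕ.*-mono-≤ n≤B (s≤s (traverse≤traversal E E≤)))) (fresh-spec as ss E (proj₁ (proj₂ small)))

    shuffled-mismatch : n ≢ m → ∀ ρ {x y z} {ε : Vec Tree 4} →
      Must shuffledBody (bindings ⊥-elim (reorder bs ρ) (reorder ts ρ) ∷ x ∷ ground r′ ∷ y ∷ z ∷
                         bindings nameᵥ as ss ∷ exp nameᵥ r ∷ ground E ∷ ε) shuffledCost (_≡ leaf)
    shuffled-mismatch n≢m ρ = must-if (fresh as E) (must-call fresh-spec′)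
      (λ _ → weaken (+-monoʳ-≤ alignCost z≤n) (must-leaf (must-call (weakenCall (s≤s (*-monoˡ-≤ (suc atomCost) n≤B))
        (align-mismatch as (reorder bs ρ) ss (reorder ts ρ) [] n≢m [] as≤
          (Allᵥ.tabulate⁺ (λ i → Allᵥ.lookup⁺ bs≤ (ρ ⟨$⟩ʳ i))) (≤-trans (≤-reflexive (+-identityʳ n)) n≤B))))
        (must-return refl)))
      (λ _ → weaken z≤n (must-return refl))

    -- The order ρ concerns the m right-hand bindings alone. Whether m equals n is left to the proof
    -- about `shuffledBody`.
    letrec-must : ∀ {U} → (∀ ρ {x y z t u v} →
      Must shuffledBody (bindings ⊥-elim (reorder bs ρ) (reorder ts ρ) ∷ bindings ⊥-elim bs ts ∷ ground r′ ∷ x ∷ y ∷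
                         bindings nameᵥ as ss ∷ exp nameᵥ r ∷ ground E ∷ problem Γ ∷ z ∷ t ∷ u ∷ v) shuffledCost U) →
      MustCall letrecᶠ ((bindings nameᵥ as ss ∙ exp nameᵥ r) ∙ ground E ∙ problem Γ) letrecCost U
    letrec-must h = must-body (on-node refl (on-node refl (on-node refl (on-node refl (on-node refl
      (must-bind (must-call (weakenCall (≤-trans (shuffleCost≤ m) (ℕ.*-mono-≤ (s≤s m≤B) (s≤s m≤B)))
        (subst (λ w → MustCall shuffleᶠ w (shuffleCost m) (λ w′ → ∃[ ρ ] w′ ≡ bindings ⊥-elim (reorder bs ρ) (reorder ts ρ)))
          (treeList-bindings ⊥-elim bs ts)
          (call-⊆ (λ (ρ , p) → ρ , trans p (bindings-reorder bs ts ρ))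
            (shuffle-must (Vec.zipWith (λ a e → nameₐ a ∙ ground e) bs ts))))))
        λ { (ρ , refl) → h ρ }))))))

  -- Once ρ has been guessed the result is unique, so this gives the bound on all runs and also the
  -- run needed by `letrec-may`.
  shuffled-match : ∀ {as bs : Vec Atom n} .{u v} {ss r ts r′} (small : SmallEq (letrec as u ss r ⊴ letrec bs v ts r′)) →
    ∀ ρ {x y z} {ε : Vec Tree 3} →
    Must shuffledBody (bindings ⊥-elim (reorder bs ρ) (reorder ts ρ) ∷ x ∷ ground r′ ∷ y ∷ z ∷
                       bindings nameᵥ as ss ∷ exp nameᵥ r ∷ ground (letrec bs v ts r′) ∷ problem Γ ∷ ε) shuffledCost
         (_≡ accepted (fresh as (letrec bs v ts r′)) (letrecEqs ρ (aligning ρ as bs) ss r ts r′ ++ Γ))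
  shuffled-match {n} {Γ} {as} {bs} {u} {v} {ss} {r} {ts} {r′} small ρ =
    must-if (fresh as E) (must-call (fresh-spec′ {u = u} {r = r} {v = v} small))
      (λ eq → must-node (must-call (weakenCall (s≤s (*-monoˡ-≤ (suc atomCost) n≤B))
          (align-spec as (reorder bs ρ) ss (reorder ts ρ) [] [] as≤
            (Allᵥ.tabulate⁺ (λ i → Allᵥ.lookup⁺ bs≤ (ρ ⟨$⟩ʳ i))) (≤-trans (≤-reflexive (+-identityʳ n)) n≤B))))
        (must-bind≡ (must-call (weakenCall (traverse≤traversal r′ r′≤B) (apply-spec π r′ π≤ ∣π∣)))
          (weaken (≤-reflexive (+-identityʳ zipCost))
            (must-bind≡ (must-call (weakenCall
                (≤-trans (traverse*≤traversals (reorder ts ρ) (λ i → ≤-trans (≤-reflexive (cong ∣_∣ (lookup-reorder ts ρ i))) (ts≤B (ρ ⟨$⟩ʳ i))))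
                  (s≤s (*-monoˡ-≤ (suc traversal) n≤B)))
                (zipᵇ-spec as ss (reorder bs ρ) (reorder ts ρ) π Γ π≤ ∣π∣)))
              (must-return (trans (cong (λ qs → leaf ∙ problem ((r ⊴ π · r′) ∷ toList qs ++ Γ)) equations) (result eq)))))))
      (λ eq → weaken z≤n (must-return (result eq)))
    where
    E = letrec bs v ts r′
    π = aligning ρ as bs
    as≤ = proj₁ (proj₁ (proj₁ small))
    bs≤ = proj₁ (proj₁ (proj₂ small))
    E≤ = proj₂ (proj₂ small)
    n≤B = summand≤B n E≤
    ts≤B : ∀ i → ∣ lookup ts i ∣ ≤ B
    ts≤B i = ≤-trans (lookup-size ts i) (≤-trans (m≤m+n _ ∣ r′ ∣) (≤-trans (m≤n+m _ (suc n)) E≤))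
    r′≤B : ∣ r′ ∣ ≤ B
    r′≤B = ≤-trans (m≤n+m _ ∣ ts ∣*) (≤-trans (m≤n+m _ (suc n)) E≤)
    π≤ : SmallPerm π
    π≤ = aligning-small ρ as≤ bs≤
    ∣π∣ : length π ≤ B
    ∣π∣ = ≤-trans (≤-reflexive (aligning-length ρ as bs)) n≤B
    equations : Vec.zipWith (λ s t → s ⊴ π · t) ss (reorder ts ρ) ≡ tabulate (λ i → lookup ss i ⊴ π · lookup ts (ρ ⟨$⟩ʳ i))
    equations = trans (zipWith-tabulate ss (reorder ts ρ)) (Vec.tabulate-cong λ i → cong (λ t → lookup ss i ⊴ π · t) (lookup-reorder ts ρ i))
    result : ∀ {b} → fresh as E ≡ b →
             accepted b (letrecEqs ρ π ss r ts r′ ++ Γ) ≡ accepted (fresh as E) (letrecEqs ρ π ss r ts r′ ++ Γ)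
    result eq = cong (λ b → accepted b (letrecEqs ρ π ss r ts r′ ++ Γ)) (sym eq)

  letrec-may : ∀ {as bs : Vec Atom n} .{u v} {ss r ts r′} → SmallEq (letrec as u ss r ⊴ letrec bs v ts r′) →
               as #* letrec bs v ts r′ → ∀ ρ →
               MayCall letrecᶠ ((bindings nameᵥ as ss ∙ exp nameᵥ r) ∙ ground (letrec bs v ts r′) ∙ problem Γ)
                       (leaf ∙ problem (letrecEqs ρ (aligning ρ as bs) ss r ts r′ ++ Γ))
  letrec-may {Γ = Γ} {as = as} {bs} {u} {v} {ss} {r} {ts} {r′} small as# ρ =
    may-body (may-on-node refl (may-on-node refl (may-on-node refl (may-on-node refl (may-on-node refl
      (may-bind (may-call (subst (λ w → MayCall shuffleᶠ w (bindings ⊥-elim (reorder bs ρ) (reorder ts ρ))) (treeList-bindings ⊥-elim bs ts)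
          (subst (MayCall shuffleᶠ (treeList (Vec.zipWith (λ a e → nameₐ a ∙ ground e) bs ts))) (bindings-reorder bs ts ρ) (shuffle-may (Vec.zipWith (λ a e → nameₐ a ∙ ground e) bs ts) ρ))))
        (must⇒may (must-⊆ (λ p → trans p (cong (λ b → accepted b (letrecEqs ρ (aligning ρ as bs) ss r ts r′ ++ Γ)) (#*⇒fresh as _ as#)))
          (shuffled-match {u = u} {v} {ss} {r} small ρ)))))))))

-- The decomposition step on encoded equations

module Execution (S : Signature) (N : Matching.Naming S) (B : ℕ) where
  open StepSpecifications S N B public

  private variable
    n m : ℕ
    Γ Δ : Problem

  mutual
    -- A ground expression has the same code on either side of an equation, so the merging test
    -- hands it to `decompᶠ` without any conversion.
    embed-encoding : ∀ e → exp nameᵥ (embed e) ≡ ground e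
    embed-encoding (atom a)           = refl
    embed-encoding (lam a e)          = cong (λ t → (leaf ∙ leaf) ∙ nameₐ a ∙ t) (embed-encoding e)
    embed-encoding (app f es)         = cong (λ t → (leaf ∙ leaf ∙ leaf) ∙ namef f ∙ t) (embed*-encoding es)
    embed-encoding (letrec as _ es e) =
      cong₂ (λ bs t → (leaf ∙ leaf ∙ leaf ∙ leaf) ∙ bs ∙ t) (embedᵇ-encoding as es) (embed-encoding e)

    embed*-encoding : ∀ (es : Vec LRL n) → exps nameᵥ (embed* es) ≡ exps ⊥-elim es
    embed*-encoding []       = refl
    embed*-encoding (e ∷ es) = cong₂ _∙_ (embed-encoding e) (embed*-encoding es)

    embedᵇ-encoding : ∀ (as : Vec Atom n) es → bindings nameᵥ as (embed* es) ≡ bindings ⊥-elim as es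
    embedᵇ-encoding []       []       = refl
    embedᵇ-encoding (a ∷ as) (e ∷ es) = cong₂ (λ t bs → (nameₐ a ∙ t) ∙ bs) (embed-encoding e) (embedᵇ-encoding as es)

  mutual
    embed-small : ∀ e → Smallᵍ e → Small Smallᵥ (embed e)
    embed-small (atom a)           a≤               = a≤
    embed-small (lam a e)          (a≤ , e≤)        = a≤ , embed-small e e≤
    embed-small (app f es)         (f≤ , es≤)       = f≤ , embed*-small es es≤
    embed-small (letrec as _ es e) (as≤ , es≤ , e≤) = as≤ , embed*-small es es≤ , embed-small e e≤

    embed*-small : ∀ (es : Vec LRL n) → Small* (λ ()) es → Small* Smallᵥ (embed* es)
    embed*-small []       _          = tt
    embed*-small (e ∷ es) (e≤ , es≤) = embed-small e e≤ , embed*-small es es≤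

  tag-test : ∀ x y → ∣ x ∣ᵗ ≤ 7 → MustCall equalᶠ (x ∙ y) 7 (_≡ boolean (equalᵗ x y))
  tag-test x y x≤ = weakenCall x≤ (equal-spec x y)

  -- Failure is allowed unconditionally, as the guessed order may be wrong; `step-may` provides the
  -- successful run.
  StepResult : Equation → Problem → Tree → Set
  StepResult q Γ w = w ≡ leaf ⊎ (∃[ Δ ] Expands q Δ × w ≡ leaf ∙ problem (Δ ++ Γ))

  private
    atom-cost : 7 + (B + 0) ≤ 7 + (B + (lamCost + (appCost + letrecCost)))
    atom-cost = +-monoʳ-≤ 7 (+-monoʳ-≤ B z≤n)

    lam-cost : lamCost ≤ B + (lamCost + (appCost + letrecCost))
    lam-cost = ≤-trans (m≤m+n lamCost _) (m≤n+m _ B)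

    app-cost : appCost ≤ B + (lamCost + (appCost + letrecCost))
    app-cost = ≤-trans (m≤m+n appCost _) (≤-trans (m≤n+m _ lamCost) (m≤n+m _ B))

    letrec-cost : letrecCost ≤ B + (lamCost + (appCost + letrecCost))
    letrec-cost = ≤-trans (m≤n+m letrecCost appCost) (≤-trans (m≤n+m _ lamCost) (m≤n+m _ B))

    mismatch : ∀ {x y p p′ z} → ∣ x ∣ᵗ ≤ 7 → equalᵗ x y ≡ false → ∀ {U : Tree → Set} → U leaf →
               MustCall stepᶠ (((x ∙ p) ∙ (y ∙ p′)) ∙ z) stepCost U
    mismatch {x} {y} x≤ x≢y u = must-body (on-node refl (on-node refl (on-node refl (on-node refl
      (weaken (+-monoʳ-≤ 7 z≤n) (must-leaf (must-⊆ (λ p → trans p (cong boolean x≢y)) (must-call (tag-test x y x≤)))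
        (must-return u)))))))

    size₀ : 1 ≤ 7
    size₀ = s≤s z≤n
    size₁ : 3 ≤ 7
    size₁ = s≤s (s≤s (s≤s z≤n))
    size₂ : 5 ≤ 7
    size₂ = s≤s (s≤s (s≤s (s≤s (s≤s z≤n))))
    size₃ : 7 ≤ 7
    size₃ = ≤-refl

  step-must : ∀ {s} → Rigid s → ∀ t → SmallEq (s ⊴ t) →
              MustCall stepᶠ ((exp nameᵥ s ∙ ground t) ∙ problem Γ) stepCost (StepResult (s ⊴ t) Γ)
  step-must (atom {a}) (atom b) ((a≤ , _) , _) with a ≟ₐ b
  ... | yes refl = must-body (on-node refl (on-node refl (on-node refl (on-node refl (weaken atom-cost
      (must-node (must-call (tag-test _ _ size₀)) (on-leaf refl
        (must-node (must-call (equal-names atoms a≤ (yes refl))) (must-return (inj₂ (_ , atom , refl)))))))))))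
  ... | no a≢b   = must-body (on-node refl (on-node refl (on-node refl (on-node refl (weaken atom-cost
      (must-node (must-call (tag-test _ _ size₀)) (on-leaf refl
        (must-leaf (must-call (equal-names atoms a≤ (no a≢b))) (must-return (inj₁ refl))))))))))
  step-must {Γ} (lam {a} {s}) (lam b t) small =
    must-body (on-node refl (on-node refl (on-node refl (on-node refl (weaken (+-monoʳ-≤ 7 lam-cost)
      (must-node (must-call (tag-test _ _ size₁)) (on-node refl (on-leaf refl
        (must-⊆ result (must-call (lam-spec {s = s} small)))))))))))
    where
    result : ∀ {w} → w ≡ accepted (not (occurs a (lam b t))) ((s ⊴ ((a , b) ∷ []) · t) ∷ Γ) → StepResult (lam a s ⊴ lam b t) Γ w
    result eq with occurs a (lam b t) in o
    ... | true  = inj₁ eq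
    ... | false = inj₂ (_ , lam (λ a∈ → case trans (sym o) (∈FA⇒occurs a∈) of λ ()) , eq)
  step-must (app {f} {ss}) (app g ts) small@(((f≤ , _) , _) , _) with f ≟f g
  ... | yes refl = must-body (on-node refl (on-node refl (on-node refl (on-node refl (weaken (+-monoʳ-≤ 7 app-cost)
      (must-node (must-call (tag-test _ _ size₂)) (on-node refl (on-node refl (on-leaf refl
        (must-⊆ (λ eq → inj₂ (_ , app , eq)) (must-call (app-match {ss = ss} {ts} small))))))))))))
  ... | no f≢g   = must-body (on-node refl (on-node refl (on-node refl (on-node refl (weaken (+-monoʳ-≤ 7 app-cost)
      (must-node (must-call (tag-test _ _ size₂)) (on-node refl (on-node refl (on-leaf refl
        (must-⊆ inj₁ (must-call (app-clash f≢g f≤))))))))))))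
  step-must {Γ} (letrec {n} {as} {u} {ss} {r}) (letrec {m} bs v ts r′) small =
    must-body (on-node refl (on-node refl (on-node refl (on-node refl (weaken (+-monoʳ-≤ 7 letrec-cost)
      (must-node (must-call (tag-test _ _ size₃)) (on-node refl (on-node refl (on-node refl
        (must-call (letrec-must {u = u} {ss} {r} {v = v} {ts} {r′} small shuffled)))))))))))
    where
    accept : ∀ {as bs : Vec Atom n} .{u v} {ss r ts r′ w} ρ →
             w ≡ accepted (fresh as (letrec bs v ts r′)) (letrecEqs ρ (aligning ρ as bs) ss r ts r′ ++ Γ) →
             StepResult (letrec as u ss r ⊴ letrec bs v ts r′) Γ w
    accept {as} {bs} {u} {v} {ss} {r} {ts} {r′} ρ eq with fresh as (letrec bs v ts r′) in f
    ... | false = inj₁ eq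
    ... | true  = inj₂ (_ , letrec {u = u} {v} (fresh⇒#* as _ f) ρ , eq)
    shuffled : ∀ ρ {x y z t a b} → Must shuffledBody (bindings ⊥-elim (reorder bs ρ) (reorder ts ρ) ∷ bindings ⊥-elim bs ts ∷
                 ground r′ ∷ x ∷ y ∷ bindings nameᵥ as ss ∷ exp nameᵥ r ∷ ground (letrec bs v ts r′) ∷ problem Γ ∷ z ∷ t ∷ a ∷ b)
                 shuffledCost (StepResult (letrec as u ss r ⊴ letrec bs v ts r′) Γ)
    shuffled ρ with n ℕ.≟ m
    ... | no n≢m   = must-⊆ inj₁ (shuffled-mismatch {u = u} {r = r} {v = v} small n≢m ρ)
    ... | yes refl = must-⊆ (accept {u = u} {v} ρ) (shuffled-match {u = u} {v} {ss} {r} small ρ)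
  step-must atom (lam _ _)        _ = mismatch size₀ refl (inj₁ refl)
  step-must atom (app _ _)        _ = mismatch size₀ refl (inj₁ refl)
  step-must atom (letrec _ _ _ _) _ = mismatch size₀ refl (inj₁ refl)
  step-must lam (atom _)          _ = mismatch size₁ refl (inj₁ refl)
  step-must lam (app _ _)         _ = mismatch size₁ refl (inj₁ refl)
  step-must lam (letrec _ _ _ _)  _ = mismatch size₁ refl (inj₁ refl)
  step-must app (atom _)          _ = mismatch size₂ refl (inj₁ refl)
  step-must app (lam _ _)         _ = mismatch size₂ refl (inj₁ refl)
  step-must app (letrec _ _ _ _)  _ = mismatch size₂ refl (inj₁ refl)
  step-must letrec (atom _)       _ = mismatch size₃ refl (inj₁ refl)
  step-must letrec (lam _ _)      _ = mismatch size₃ refl (inj₁ refl)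
  step-must letrec (app _ _)      _ = mismatch size₃ refl (inj₁ refl)

  private
    tags-agree : ∀ x → MayCall equalᶠ (x ∙ x) (leaf ∙ leaf)
    tags-agree x = mustCall⇒may (call-⊆ (λ p → trans p (cong boolean (equalᵗ-refl x))) (equal-spec x x))

  step-may : ∀ {s t} → Expands (s ⊴ t) Δ → SmallEq (s ⊴ t) →
             MayCall stepᶠ ((exp nameᵥ s ∙ ground t) ∙ problem Γ) (leaf ∙ problem (Δ ++ Γ))
  step-may (atom {a}) ((a≤ , _) , _) =
    may-body (may-on-node refl (may-on-node refl (may-on-node refl (may-on-node refl
      (may-node (may-call (tags-agree _)) (may-on-leaf refl
        (may-node (may-call (tags-agree (nameₐ a))) (must⇒may (must-return refl)))))))))
  step-may {Γ = Γ} (lam {a} {b} {s} {t} a#) small =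
    may-body (may-on-node refl (may-on-node refl (may-on-node refl (may-on-node refl
      (may-node (may-call (tags-agree _)) (may-on-node refl (may-on-leaf refl
        (may-call (mustCall⇒may (call-⊆ result (lam-spec {s = s} small)))))))))))
    where
    result : ∀ {w} → w ≡ accepted (not (occurs a (lam b t))) ((s ⊴ ((a , b) ∷ []) · t) ∷ Γ) →
             w ≡ leaf ∙ problem ((s ⊴ ((a , b) ∷ []) · t) ∷ Γ)
    result eq with occurs a (lam b t) in o
    ... | true  = contradiction (occurs⇒∈FA (lam b t) o) a#
    ... | false = eq
  step-may (app {f} {ss} {ts}) small =
    may-body (may-on-node refl (may-on-node refl (may-on-node refl (may-on-node refl
      (may-node (may-call (tags-agree _)) (may-on-node refl (may-on-node refl (may-on-leaf refl
        (may-call (mustCall⇒may (app-match {ss = ss} {ts} small)))))))))))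
  step-may (letrec {u = u} {v} {ss} {r} as# ρ) small =
    may-body (may-on-node refl (may-on-node refl (may-on-node refl (may-on-node refl
      (may-node (may-call (tags-agree _)) (may-on-node refl (may-on-node refl (may-on-node refl
        (may-call (letrec-may {u = u} {v} {ss} {r} small as# ρ))))))))))

-- The worklist, merging, and correctness of the program

module Decision (S : Signature) (N : Matching.Naming S) (B : ℕ) where
  open Execution S N B public

  private variable
    Γ Δ : Problem
    σ τ : Subst

  SmallBinding : Var × LRL → Set
  SmallBinding (X , e) = Smallᵥ X × Smallᵍ e × ∣ e ∣ ≤ B

  reverse-small : ∀ {π} → SmallPerm π → SmallPerm (π ⁻¹)
  reverse-small {π} sm = ↭.All-resp-↭ (↭-sym (↭.↭-reverse π)) sm

  -- What the four rigid shapes have in common as far as `decompBody` is concerned: a short tag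
  -- different from those of variables and suspensions.
  data RigidCode (s : LRLX) : Set where
    rigidCode : ∀ t u → exp nameᵥ s ≡ t ∙ u → ∣ t ∣ᵗ ≤ 7 →
                equalᵗ t (leaf ∙ leaf ∙ leaf ∙ leaf ∙ leaf) ≡ false →
                equalᵗ t (leaf ∙ leaf ∙ leaf ∙ leaf ∙ leaf ∙ leaf) ≡ false → RigidCode s

  rigid-code : ∀ {s} → Rigid s → RigidCode s
  rigid-code atom   = rigidCode _ _ refl (s≤s z≤n) refl refl
  rigid-code lam    = rigidCode _ _ refl (s≤s (s≤s (s≤s z≤n))) refl refl
  rigid-code app    = rigidCode _ _ refl (s≤s (s≤s (s≤s (s≤s (s≤s z≤n))))) refl refl
  rigid-code letrec = rigidCode _ _ refl ≤-refl refl refl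

  private
    tag≤11 : ∀ x y → ∣ x ∣ᵗ ≤ 11 → MustCall equalᶠ (x ∙ y) 11 (_≡ boolean (equalᵗ x y))
    tag≤11 x y x≤ = weakenCall x≤ (equal-spec x y)

    seven≤eleven : 7 ≤ 11
    seven≤eleven = slack 4 refl

    nine≤eleven : 9 ≤ 11
    nine≤eleven = slack 2 refl

    var-cost : ∀ k → 11 + decompCost k ≤ suc k * suc unfoldCost
    var-cost k = ≤-trans (≤-reflexive (+-suc 11 (k * suc unfoldCost)))
      (s≤s (+-monoˡ-≤ (k * suc unfoldCost) (≤-trans (slack 11 refl) (m≤m+n 22 (stepCost + (suc B + traversal))))))

    step-cost : ∀ k → 11 + (11 + (stepCost + decompCost k)) ≤ suc k * suc unfoldCost
    step-cost k = slack (suc B + traversal) (arith stepCost (k * suc unfoldCost) (suc B + traversal))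
      where
      arith : ∀ s d r → 11 + (11 + (s + suc d)) + r ≡ suc (22 + (s + r)) + d
      arith = solve-∀

    susp-cost : ∀ k → 11 + (11 + (suc B + (traversal + decompCost k))) ≤ suc k * suc unfoldCost
    susp-cost k = slack stepCost (arith stepCost (k * suc unfoldCost) B traversal)
      where
      arith : ∀ s d b t → 11 + (11 + (suc b + (t + suc d))) + s ≡ suc (22 + (s + (suc b + t))) + d
      arith = solve-∀

  -- The accumulated bindings count as part of the problem, so that worklist and accumulator
  -- together always form a problem reachable by the rules.
  DecompResult : Problem → Subst → Tree → Set
  DecompResult Γ σ w = w ≡ leaf ⊎
    (∃[ τ ] w ≡ leaf ∙ bindingList τ × All SmallBinding τ × Γ ++ toProblem σ ⇝ toProblem τ)

  private
    prefix : ∀ {Γ Γ′ σ σ′ w} → Γ ++ toProblem σ ⇝ Γ′ ++ toProblem σ′ →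
             DecompResult Γ′ σ′ w → DecompResult Γ σ w
    prefix sts (inj₁ eq)                    = inj₁ eq
    prefix sts (inj₂ (τ , eq , small , sts′)) = inj₂ (τ , eq , small , sts ◅◅ sts′)

    shift : ∀ {X e} Γ σ → (var X ⊴ e) ∷ Γ ++ toProblem σ ↭ Γ ++ toProblem ((X , e) ∷ σ)
    shift Γ σ = ↭-sym (↭.shift _ Γ (toProblem σ))

    susp-small : ∀ {π X t} → SmallEq (susp π X ⊴ t) → length π ≤ B × SmallBinding (X , (π ⁻¹) · t)
    susp-small {π} {X} {t} (((π≤ , X≤) , ∣s∣) , (t≤ , ∣t∣)) =
      ≤-trans (m≤m+n (length π) (length π + 0)) (≤-trans (m≤n+m _ 2) ∣s∣) ,
      X≤ , ·-small (reverse-small π≤) t t≤ , permuted≤ (π ⁻¹) t ≤-refl ∣t∣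

    reverse-length : ∀ π → length (π ⁻¹) ≡ length π
    reverse-length π = List.length-reverse π

    rest-size : ∀ {s t k} → lhsSize ((s ⊴ t) ∷ Γ) ≤ suc k → lhsSize Γ ≤ k
    rest-size {Γ} {s} size = ℕ.≤-pred (≤-trans (+-monoˡ-≤ (lhsSize Γ) (size-positive s)) size)

    no-size : ∀ {s t} → ¬ lhsSize ((s ⊴ t) ∷ Γ) ≤ 0
    no-size {Γ} {s} size with () ← ≤-trans (≤-trans (size-positive s) (m≤m+n ∣ s ∣ (lhsSize Γ))) size

  -- Each iteration lowers the total left-hand size, so k serves both as fuel for the recursion and
  -- as the number of iterations paid for.
  decomp-must : ∀ k Γ σ → lhsSize Γ ≤ k → All SmallEq Γ → All SmallBinding σ →
                MustCall decompᶠ (problem Γ ∙ bindingList σ) (decompCost k) (DecompResult Γ σ)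
  decomp-must k [] σ _ _ smallσ = must-body (weaken z≤n (on-node refl (on-leaf refl (must-return (inj₂ (σ , refl , smallσ , ε))))))
  decomp-must zero ((s ⊴ t) ∷ Γ) σ size _ _ = contradiction size (no-size {Γ} {s} {t})
  decomp-must (suc k) ((s ⊴ t) ∷ Γ) σ size (small ∷ smallΓ) smallσ with lhsView s
  ... | isVar X = must-body (on-node refl (on-node refl (on-node refl (on-node refl (weaken (var-cost k)
      (must-node (must-call (tag≤11 _ _ nine≤eleven)) (must-⊆ (prefix {(var X ⊴ t) ∷ Γ} {Γ} {σ} {(X , t) ∷ σ} (inj₁ (shift Γ σ) ◅ ε))
        (must-call (decomp-must k Γ ((X , t) ∷ σ) (rest-size {Γ} {s} {t} size) smallΓ
          ((proj₁ (proj₁ small) , proj₂ small) ∷ smallσ))))))))))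
  ... | isSusp π X = must-body (on-node refl (on-node refl (on-node refl (on-node refl (weaken (susp-cost k)
      (must-leaf (must-call (tag≤11 _ _ ≤-refl)) (must-node (must-call (tag≤11 _ _ ≤-refl)) (on-node refl
        (must-bind≡ (must-call (weakenCall (s≤s (proj₁ (susp-small {X = X} small))) (reverse-spec π [])))
          (must-bind≡ (must-call (weakenCall (traverse≤traversal t (proj₂ (proj₂ small)))
              (apply-spec (π ⁻¹) t (reverse-small (proj₁ (proj₁ (proj₁ small))))
                (≤-trans (≤-reflexive (reverse-length π)) (proj₁ (susp-small {X = X} small))))))
            (must-⊆ (prefix {(susp π X ⊴ t) ∷ Γ} {Γ} {σ} {(X , (π ⁻¹) · t) ∷ σ} (inj₂ (simplify (susp {π = π} ↭-refl)) ◅ inj₁ (shift Γ σ) ◅ ε))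
              (must-call (decomp-must k Γ ((X , (π ⁻¹) · t) ∷ σ) (rest-size {Γ} {s} {t} size) smallΓ
                (proj₂ (susp-small {X = X} small) ∷ smallσ))))))))))))))
  ... | isRigid rig with rigid-code rig
  ...   | rigidCode tg pl eq tg≤ ≢var ≢susp = must-body (on-node refl (on-node refl (on-node refl (on-node eq (weaken (step-cost k)
      (must-leaf (must-⊆ (λ p → trans p (cong boolean ≢var)) (must-call (tag≤11 _ _ (≤-trans tg≤ seven≤eleven))))
        (must-leaf (must-⊆ (λ p → trans p (cong boolean ≢susp)) (must-call (tag≤11 _ _ (≤-trans tg≤ seven≤eleven))))
          (must-match (must-call (step-must {Γ} rig t small))
            (λ _ → weaken z≤n (must-return (inj₁ refl)))
            λ { (inj₂ (Δ , exp , refl)) → must-⊆ (continue exp)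
              (must-call (decomp-must k (Δ ++ Γ) σ
                (ℕ.≤-pred (≤-trans (⟶-lhsSize (expands-⟶ {Γ = Γ} exp)) size))
                (All.++⁺ (expands-small exp small) smallΓ) smallσ)) }))))))))
    where
    continue : ∀ {Δ w} → Expands (s ⊴ t) Δ → DecompResult (Δ ++ Γ) σ w → DecompResult ((s ⊴ t) ∷ Γ) σ w
    continue {Δ} exp = prefix {(s ⊴ t) ∷ Γ} {Δ ++ Γ} {σ} {σ} (inj₂ (subst (λ Γ′ → (s ⊴ t) ∷ Γ ++ toProblem σ ⟶ Γ′)
      (sym (List.++-assoc Δ Γ (toProblem σ))) (expands-⟶ exp)) ◅ ε)

  private
    test-fails : ∀ {x y} → equalᵗ x y ≡ false → MayCall equalᶠ (x ∙ y) leaf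
    test-fails {x} {y} eq = mustCall⇒may (call-⊆ (λ p → trans p (cong boolean eq)) (equal-spec x y))

  -- The bound on the length keeps the substitution within B, as the merging phase requires.
  DecompOutcome : ℕ → Problem → Subst → Subst → Set
  DecompOutcome k Γ σ τ = ∃[ ϱ ] MayCall decompᶠ (problem Γ ∙ bindingList σ) (leaf ∙ bindingList ϱ) ×
    Matcher (toProblem ϱ) τ × All SmallBinding ϱ × length ϱ ≤ k + length σ

  -- The matcher τ directs the guesses: at a `letrec`, `matches-expands` extracts a ρ for which τ
  -- still matches the resulting equations.
  decomp-may : ∀ k Γ σ → lhsSize Γ ≤ k → All SmallEq Γ → All SmallBinding σ →
               Matcher Γ τ → Matcher (toProblem σ) τ → DecompOutcome k Γ σ τ
  decomp-may k [] σ _ _ smallσ _ msσ =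
    σ , may-body (may-on-node refl (may-on-leaf refl (must⇒may (must-return refl)))) , msσ , smallσ , m≤n+m _ k
  decomp-may zero ((s ⊴ t) ∷ Γ) σ size _ _ _ _ = contradiction size (no-size {Γ} {s} {t})
  decomp-may {τ} (suc k) ((s ⊴ t) ∷ Γ) σ size (small ∷ smallΓ) smallσ (ms ∷ msΓ) msσ with lhsView s
  ... | isVar X with decomp-may {τ} k Γ ((X , t) ∷ σ) (rest-size {Γ} {s} {t} size) smallΓ
                       ((proj₁ (proj₁ small) , proj₂ small) ∷ smallσ) msΓ (ms ∷ msσ)
  ...   | ϱ , may , msϱ , smallϱ , len = ϱ , may-body (may-on-node refl (may-on-node refl (may-on-node refl (may-on-node refl
      (may-node (may-call (mustCall⇒may (tag≤11 _ _ nine≤eleven))) (may-call may)))))) ,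
      msϱ , smallϱ , ≤-trans len (≤-reflexive (+-suc k (length σ)))
  decomp-may {τ} (suc k) ((s ⊴ t) ∷ Γ) σ size (small ∷ smallΓ) smallσ (ms ∷ msΓ) msσ | isSusp π X
    with decomp-may {τ} k Γ ((X , (π ⁻¹) · t) ∷ σ) (rest-size {Γ} {s} {t} size) smallΓ
           (proj₂ (susp-small {X = X} small) ∷ smallσ) msΓ (matches-susp⁻ {σ = τ} {π} {X} ms ∷ msσ)
  ...   | ϱ , may , msϱ , smallϱ , len = ϱ , may-body (may-on-node refl (may-on-node refl (may-on-node refl (may-on-node refl
      (may-leaf (may-call (mustCall⇒may (tag≤11 _ _ ≤-refl)))
        (may-node (may-call (mustCall⇒may (tag≤11 _ _ ≤-refl))) (may-on-node refl
          (may-bind (may-call (mustCall⇒may (reverse-spec π [])))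
            (may-bind (may-call (mustCall⇒may (apply-spec (π ⁻¹) t (reverse-small (proj₁ (proj₁ (proj₁ small))))
                (≤-trans (≤-reflexive (reverse-length π)) (proj₁ (susp-small {X = X} small))))))
              (may-call may)))))))))) ,
      msϱ , smallϱ , ≤-trans len (≤-reflexive (+-suc k (length σ)))
  decomp-may {τ} (suc k) ((s ⊴ t) ∷ Γ) σ size (small ∷ smallΓ) smallσ (ms ∷ msΓ) msσ | isRigid rig
    with rigid-code rig | matches-expands {σ = τ} rig ms
  ... | rigidCode tg pl eq tg≤ ≢var ≢susp | Δ , exp , msΔ
    with decomp-may {τ} k (Δ ++ Γ) σ (ℕ.≤-pred (≤-trans (⟶-lhsSize (expands-⟶ {Γ = Γ} exp)) size))
           (All.++⁺ (expands-small exp small) smallΓ) smallσ (All.++⁺ msΔ msΓ) msσ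
  ...   | ϱ , may , msϱ , smallϱ , len = ϱ , may-body (may-on-node refl (may-on-node refl (may-on-node refl (may-on-node eq
      (may-leaf (may-call (test-fails ≢var)) (may-leaf (may-call (test-fails ≢susp))
        (may-node (may-call (step-may {Γ = Γ} exp small)) (may-call may)))))))) ,
      msϱ , smallϱ , m≤n⇒m≤1+n len

  found : Maybe LRL → Tree
  found nothing  = leaf
  found (just e) = leaf ∙ ground e

  lookup-spec : ∀ X σ → Smallᵥ X → MustCall lookupᶠ (nameᵥ X ∙ bindingList σ) (suc (length σ * suc B)) (_≡ found (σ ‼ X))
  lookup-spec X []            X≤ = must-body (on-node refl (on-leaf refl (must-return refl)))
  lookup-spec X ((Y , e) ∷ σ) X≤ with X ≟ᵥ Y
  ... | yes refl = must-body (on-node refl (on-node refl (on-node refl (weaken (≤-trans (+-monoʳ-≤ B z≤n) (n≤1+n _))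
      (must-node (must-call (equal-names vars X≤ (yes refl))) (must-return refl))))))
  ... | no X≢Y   = must-body (on-node refl (on-node refl (on-node refl (weaken (≤-reflexive (+-suc B _))
      (must-leaf (must-call (equal-names vars X≤ (no X≢Y))) (must-call (lookup-spec X σ X≤)))))))

  ‼-just : ∀ {X e} σ → σ ‼ X ≡ just e → ∃[ σ′ ] toProblem σ ↭ (var X ⊴ e) ∷ toProblem σ′
  ‼-just {X} ((Y , d) ∷ σ) eq with X ≟ᵥ Y
  ‼-just ((Y , d) ∷ σ) refl | yes refl = σ , ↭-refl
  ‼-just ((Y , d) ∷ σ) eq   | no _ with ‼-just σ eq
  ... | σ′ , p = (Y , d) ∷ σ′ , ↭-trans (↭-prep _ p) (↭-swap _ _ ↭-refl)

  ‼-nothing : ∀ {X} σ → σ ‼ X ≡ nothing → All (λ Y → X ≢ Y) (map proj₁ σ)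
  ‼-nothing []            _  = []
  ‼-nothing {X} ((Y , d) ∷ σ) eq with X ≟ᵥ Y
  ... | no X≢Y = X≢Y ∷ ‼-nothing σ eq

  ‼-small : ∀ {X e} σ → σ ‼ X ≡ just e → All SmallBinding σ → Smallᵍ e × ∣ e ∣ ≤ B
  ‼-small {X} ((Y , d) ∷ σ) eq (small ∷ smalls) with X ≟ᵥ Y
  ‼-small ((Y , d) ∷ σ) refl (small ∷ _) | yes refl = proj₂ small
  ‼-small ((Y , d) ∷ σ) eq (_ ∷ smalls)  | no _     = ‼-small σ eq smalls

  comparison : LRL → LRL → Problem
  comparison d e = (embed d ⊴ e) ∷ []

  comparison-small : ∀ d e → Smallᵍ d × ∣ d ∣ ≤ B → Smallᵍ e × ∣ e ∣ ≤ B → All SmallEq (comparison d e)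
  comparison-small d e (d≤ , ∣d∣) e≤ = ((embed-small d d≤ , ≤-trans (≤-reflexive (embed-size d)) ∣d∣) , e≤) ∷ []

  comparison-size : ∀ d e → ∣ d ∣ ≤ B → lhsSize (comparison d e) ≤ B
  comparison-size d e ∣d∣ = ≤-trans (≤-reflexive (trans (+-identityʳ _) (embed-size d))) ∣d∣

  comparison-must : ∀ d e → Smallᵍ d × ∣ d ∣ ≤ B → Smallᵍ e × ∣ e ∣ ≤ B →
                    MustCall decompᶠ (((ground d ∙ ground e) ∙ leaf) ∙ leaf) (decompCost B) (DecompResult (comparison d e) [])
  comparison-must d e d≤ e≤ = subst (λ t → MustCall decompᶠ (((t ∙ ground e) ∙ leaf) ∙ leaf) (decompCost B) (DecompResult (comparison d e) []))
    (embed-encoding d) (decomp-must B (comparison d e) [] (comparison-size d e (proj₂ d≤)) (comparison-small d e d≤ e≤) [])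

  -- The empty substitution matches a ground comparison, hence also the bindings that remain; as it
  -- is undefined on every variable, none can remain.
  comparison-may : ∀ d e → Smallᵍ d × ∣ d ∣ ≤ B → Smallᵍ e × ∣ e ∣ ≤ B → d ∼ e →
                   MayCall decompᶠ (((ground d ∙ ground e) ∙ leaf) ∙ leaf) (leaf ∙ leaf)
  comparison-may d e d≤ e≤ d∼e
    with decomp-may {[]} B (comparison d e) [] (comparison-size d e (proj₂ d≤)) (comparison-small d e d≤ e≤) []
           ((d , embed-instance d , d∼e) ∷ []) []
  ... | [] , may , _ = subst (λ t → MayCall decompᶠ (((t ∙ ground e) ∙ leaf) ∙ leaf) (leaf ∙ leaf)) (embed-encoding d) may
  ... | _ ∷ _ , _ , (_ , () , _) ∷ _ , _

  MergeResult : Subst → Subst → Tree → Set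
  MergeResult σ τ w = w ≡ leaf ⊎
    (∃[ ϱ ] w ≡ leaf ∙ bindingList ϱ × Unique (map proj₁ ϱ) × toProblem σ ++ toProblem τ ⇝ toProblem ϱ)

  private
    merge-prefix : ∀ {σ σ′ τ τ′ w} → toProblem σ ++ toProblem τ ⇝ toProblem σ′ ++ toProblem τ′ →
                   MergeResult σ′ τ′ w → MergeResult σ τ w
    merge-prefix sts (inj₁ eq)                 = inj₁ eq
    merge-prefix sts (inj₂ (ϱ , eq , u , sts′)) = inj₂ (ϱ , eq , u , sts ◅◅ sts′)

    skip-cost : ∀ k → lookupCost + mergeCost k ≤ suc k * suc mergeStepCost
    skip-cost k = slack (decompCost B) (arith lookupCost (k * suc mergeStepCost) (decompCost B))
      where
      arith : ∀ l m d → l + suc m + d ≡ suc (l + d) + m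
      arith = solve-∀

    compare-cost : ∀ k → lookupCost + (decompCost B + mergeCost k) ≤ suc k * suc mergeStepCost
    compare-cost k = ≤-reflexive (arith lookupCost (k * suc mergeStepCost) (decompCost B))
      where
      arith : ∀ l m d → l + (d + suc m) ≡ suc (l + d) + m
      arith = solve-∀

    insertion : ∀ {X e d} σ τ τ′ → toProblem τ ↭ (var X ⊴ d) ∷ toProblem τ′ →
                (var X ⊴ e) ∷ toProblem σ ++ toProblem τ ↭
                (var X ⊴ d) ∷ (var X ⊴ e) ∷ toProblem σ ++ toProblem τ′
    insertion σ τ τ′ p = ↭-trans (↭-prep _ (↭-trans (↭.++⁺ˡ (toProblem σ) p) (↭.shift _ (toProblem σ) (toProblem τ′))))
                                 (↭-swap _ _ ↭-refl)

    looked-up : ∀ {X σ m} → Smallᵥ X → length σ ≤ B → σ ‼ X ≡ m → MustCall lookupᶠ (nameᵥ X ∙ bindingList σ) lookupCost (_≡ found m)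
    looked-up {X} {σ} X≤ len eq = weakenCall (s≤s (*-monoˡ-≤ (suc B) len))
      (call-⊆ (λ p → trans p (cong found eq)) (lookup-spec X σ X≤))

  merge-must : ∀ σ τ → length σ + length τ ≤ B → All SmallBinding σ → All SmallBinding τ → Unique (map proj₁ τ) →
               MustCall mergeᶠ (bindingList σ ∙ bindingList τ) (mergeCost (length σ)) (MergeResult σ τ)
  merge-must []            τ _ _ _ u = must-body (on-node refl (on-leaf refl (must-return (inj₂ (τ , refl , u , ε)))))
  merge-must ((X , e) ∷ σ) τ len (small ∷ smallσ) smallτ u with τ ‼ X in eq
  ... | nothing = must-body (on-node refl (on-node refl (on-node refl (weaken (skip-cost (length σ))
      (must-leaf (must-call (looked-up (proj₁ small) (ℕ.m+n≤o⇒n≤o (suc (length σ)) len) eq))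
        (must-⊆ (merge-prefix {(X , e) ∷ σ} {σ} {τ} {(X , e) ∷ τ} (inj₁ (shift (toProblem σ) τ) ◅ ε))
          (must-call (merge-must σ ((X , e) ∷ τ) (≤-trans (≤-reflexive (+-suc (length σ) (length τ))) len)
            smallσ (small ∷ smallτ) (‼-nothing τ eq ∷ u)))))))))
  ... | just d = must-body (on-node refl (on-node refl (on-node refl (weaken (compare-cost (length σ))
      (must-node (must-call (looked-up (proj₁ small) (ℕ.m+n≤o⇒n≤o (suc (length σ)) len) eq))
        (must-match (must-call (comparison-must d e (‼-small τ eq smallτ) (proj₂ small)))
          (λ _ → weaken z≤n (must-return (inj₁ refl)))
          λ { (inj₂ ([] , refl , _ , sts)) → on-leaf refl (must-⊆ (merge-prefix {(X , e) ∷ σ} {σ} {τ} {τ} (merged sts))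
                (must-call (merge-must σ τ (≤-trans (n≤1+n _) len) smallσ smallτ u)))
            ; (inj₂ (_ ∷ _ , refl , _ , _)) → weaken z≤n (on-node refl (must-return (inj₁ refl))) }))))))
    where
    -- The empty problem is matched by the empty substitution, so soundness of the rules yields
    -- `d ∼ e`, the premise of `merge`. The stored d is kept and e is dropped.
    merged : comparison d e ++ [] ⇝ [] →
             (var X ⊴ e) ∷ toProblem σ ++ toProblem τ ⇝ toProblem σ ++ toProblem τ
    merged sts with ⇝-sound {σ = []} sts [] | ‼-just τ eq
    ... | (d′ , eq′ , d′∼e) ∷ _ | τ′ , p with trans (sym (embed-instance d)) eq′
    ...   | refl = inj₂ (simplify (merge (insertion σ τ τ′ p) d′∼e)) ◅
      inj₁ (↭-sym (↭-trans (↭.++⁺ˡ (toProblem σ) p) (↭.shift _ (toProblem σ) (toProblem τ′)))) ◅ ε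

  -- A common matcher gives a repeated variable a single value, to which both of its expressions are
  -- α-equivalent; so the comparison has a successful run.
  merge-may : ∀ σ τ {ϱ} → length σ + length τ ≤ B → All SmallBinding σ → All SmallBinding τ →
              Matcher (toProblem σ) ϱ → Matcher (toProblem τ) ϱ →
              ∃[ σ′ ] MayCall mergeᶠ (bindingList σ ∙ bindingList τ) (leaf ∙ bindingList σ′)
  merge-may []            τ _ _ _ _ _ = τ , may-body (may-on-node refl (may-on-leaf refl (must⇒may (must-return refl))))
  merge-may ((X , e) ∷ σ) τ {ϱ} len (small ∷ smallσ) smallτ (ms ∷ msσ) msτ with τ ‼ X in eq
  ... | nothing with merge-may σ ((X , e) ∷ τ) {ϱ} (≤-trans (≤-reflexive (+-suc (length σ) (length τ))) len)
                       smallσ (small ∷ smallτ) msσ (ms ∷ msτ)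
  ...   | σ′ , may = σ′ , may-body (may-on-node refl (may-on-node refl (may-on-node refl
      (may-leaf (may-call (mustCall⇒may (looked-up (proj₁ small) (ℕ.m+n≤o⇒n≤o (suc (length σ)) len) eq))) (may-call may)))))
  merge-may ((X , e) ∷ σ) τ {ϱ} len (small ∷ smallσ) smallτ (ms ∷ msσ) msτ | just d
    with merge-may σ τ {ϱ} (≤-trans (n≤1+n _) len) smallσ smallτ msσ msτ
  ...   | σ′ , may = σ′ , may-body (may-on-node refl (may-on-node refl (may-on-node refl
      (may-node (may-call (mustCall⇒may (looked-up (proj₁ small) (ℕ.m+n≤o⇒n≤o (suc (length σ)) len) eq)))
        (may-node (may-call (comparison-may d e (‼-small τ eq smallτ) (proj₂ small) (agree ms))) (may-on-leaf refl (may-call may)))))))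
    where
    agree : Matches ϱ (var X ⊴ e) → d ∼ e
    agree (c , eq₁ , c∼e) with ↭.All-resp-↭ (proj₂ (‼-just τ eq)) msτ
    ... | (c′ , eq₂ , c′∼d) ∷ _ with trans (sym eq₁) eq₂
    ...   | refl = ∼-trans (∼-sym c′∼d) c∼e

  main-must : ∀ Γ → lhsSize Γ ≤ B → All SmallEq Γ →
              Must mainBody (problem Γ ∷ []) mainCost (λ w → w ≡ failure ⊎ (∃[ σ ] w ≡ success σ × Output Γ σ))
  main-must Γ size small = must-match (must-call (decomp-must B Γ [] size small []))
    (λ _ → weaken z≤n (must-return (inj₁ refl)))
    λ { (inj₂ (σ , refl , smallσ , sts)) → weaken (s≤s (*-monoˡ-≤ (suc mergeStepCost) (bounded σ sts)))
        (must-⊆ (output sts) (must-call (merge-must σ [] (≤-trans (≤-reflexive (+-identityʳ _)) (bounded σ sts)) smallσ [] []))) }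
    where
    length≡lhsSize : ∀ σ → lhsSize (toProblem σ) ≡ length σ
    length≡lhsSize []      = refl
    length≡lhsSize (_ ∷ σ) = cong suc (length≡lhsSize σ)
    bounded : ∀ σ → Γ ++ [] ⇝ toProblem σ → length σ ≤ B
    bounded σ sts = ≤-trans (≤-reflexive (sym (length≡lhsSize σ)))
      (≤-trans (⇝-lhsSize sts) (≤-trans (≤-reflexive (cong lhsSize (List.++-identityʳ Γ))) size))
    output : ∀ {σ w} → Γ ++ [] ⇝ toProblem σ → MergeResult σ [] w → w ≡ failure ⊎ (∃[ σ ] w ≡ success σ × Output Γ σ)
    output sts (inj₁ eq) = inj₁ eq
    output {σ} sts (inj₂ (ϱ , eq , u , sts′)) = inj₂ (ϱ , eq , subst (λ Γ′ → Output Γ′ ϱ) (List.++-identityʳ Γ)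
      (⇝-output sts (subst (λ Γ′ → Output Γ′ ϱ) (List.++-identityʳ (toProblem σ)) (⇝-output sts′ (_ , ε , ↭-refl , u)))))

  main-may : ∀ Γ → lhsSize Γ ≤ B → All SmallEq Γ → Matcher Γ τ → ∃[ σ ] mainBody , (problem Γ ∷ []) ⇓ₑ success σ
  main-may {τ} Γ size small ms with decomp-may {τ} B Γ [] size small [] ms []
  ... | σ , may , msσ , smallσ , len with merge-may σ [] {τ} (≤-trans (+-monoˡ-≤ 0 len)
      (≤-reflexive (trans (+-identityʳ _) (+-identityʳ B)))) smallσ [] msσ []
  ...   | σ′ , may′ = σ′ , may-node (may-call may) (may-call may′)

-- Polynomial bounds

-- The polynomial is assembled along the shape of f, so its coefficients never have to be written
-- down.
record PolynomiallyBounded (f : ℕ → ℕ) : Set where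
  constructor bounded
  field
    polynomial : Polynomial
    below      : ∀ n → f n ≤ ⟦ polynomial ⟧ n
open PolynomiallyBounded public

infixl 6 _⊕_ _+ᵇ_
infixl 7 _⊗_ _*ᵇ_

_⊕_ : Polynomial → Polynomial → Polynomial
[]       ⊕ q        = q
p        ⊕ []       = p
(c ∷ p) ⊕ (d ∷ q) = (c + d) ∷ (p ⊕ q)

⟦⊕⟧ : ∀ p q n → ⟦ p ⊕ q ⟧ n ≡ ⟦ p ⟧ n + ⟦ q ⟧ n
⟦⊕⟧ []      q       n = refl
⟦⊕⟧ (c ∷ p) []      n = sym (+-identityʳ _)
⟦⊕⟧ (c ∷ p) (d ∷ q) n rewrite ⟦⊕⟧ p q n = arith c d n (⟦ p ⟧ n) (⟦ q ⟧ n)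
  where
  arith : ∀ c d n x y → (c + d) + n * (x + y) ≡ (c + n * x) + (d + n * y)
  arith = solve-∀

scale : ℕ → Polynomial → Polynomial
scale c = map (c *_)

⟦scale⟧ : ∀ c p n → ⟦ scale c p ⟧ n ≡ c * ⟦ p ⟧ n
⟦scale⟧ c []      n = sym (ℕ.*-zeroʳ c)
⟦scale⟧ c (d ∷ p) n rewrite ⟦scale⟧ c p n = arith c d n (⟦ p ⟧ n)
  where
  arith : ∀ c d n x → c * d + n * (c * x) ≡ c * (d + n * x)
  arith = solve-∀

_⊗_ : Polynomial → Polynomial → Polynomial
[]      ⊗ q = []
(c ∷ p) ⊗ q = scale c q ⊕ (0 ∷ (p ⊗ q))

⟦⊗⟧ : ∀ p q n → ⟦ p ⊗ q ⟧ n ≡ ⟦ p ⟧ n * ⟦ q ⟧ n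
⟦⊗⟧ []      q n = refl
⟦⊗⟧ (c ∷ p) q n rewrite ⟦⊕⟧ (scale c q) (0 ∷ (p ⊗ q)) n | ⟦scale⟧ c q n | ⟦⊗⟧ p q n = arith c n (⟦ p ⟧ n) (⟦ q ⟧ n)
  where
  arith : ∀ c n x y → c * y + n * (x * y) ≡ (c + n * x) * y
  arith = solve-∀

private variable
  f g : ℕ → ℕ

_+ᵇ_ : PolynomiallyBounded f → PolynomiallyBounded g → PolynomiallyBounded (λ n → f n + g n)
(bounded p p≥) +ᵇ (bounded q q≥) = bounded (p ⊕ q) λ n →
  ≤-trans (+-mono-≤ (p≥ n) (q≥ n)) (≤-reflexive (sym (⟦⊕⟧ p q n)))

_*ᵇ_ : PolynomiallyBounded f → PolynomiallyBounded g → PolynomiallyBounded (λ n → f n * g n)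
(bounded p p≥) *ᵇ (bounded q q≥) = bounded (p ⊗ q) λ n →
  ≤-trans (ℕ.*-mono-≤ (p≥ n) (q≥ n)) (≤-reflexive (sym (⟦⊗⟧ p q n)))

constᵇ : ∀ k → PolynomiallyBounded (λ _ → k)
constᵇ k = bounded (k ∷ []) λ n → m≤m+n k (n * 0)

idᵇ : PolynomiallyBounded (λ n → n)
idᵇ = bounded (0 ∷ 1 ∷ []) λ n → ≤-reflexive (sym (trans (cong (λ k → n * suc k) (ℕ.*-zeroʳ n)) (ℕ.*-identityʳ n)))

sucᵇ : PolynomiallyBounded f → PolynomiallyBounded (λ n → suc (f n))
sucᵇ b = constᵇ 1 +ᵇ b

atomCostᵇ : PolynomiallyBounded Costs.atomCost
atomCostᵇ = idᵇ +ᵇ sucᵇ (idᵇ *ᵇ sucᵇ (idᵇ +ᵇ idᵇ))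

traversalᵇ : PolynomiallyBounded Costs.traversal
traversalᵇ = (constᵇ 3 +ᵇ atomCostᵇ) *ᵇ idᵇ

letrecCostᵇ : PolynomiallyBounded Costs.letrecCost
letrecCostᵇ = sucᵇ (sucᵇ idᵇ *ᵇ sucᵇ idᵇ +ᵇ (sucᵇ (idᵇ *ᵇ sucᵇ traversalᵇ) +ᵇ
  (sucᵇ (idᵇ *ᵇ sucᵇ atomCostᵇ) +ᵇ (traversalᵇ +ᵇ sucᵇ (idᵇ *ᵇ sucᵇ traversalᵇ)))))

stepCostᵇ : PolynomiallyBounded Costs.stepCost
stepCostᵇ = sucᵇ (constᵇ 7 +ᵇ (idᵇ +ᵇ (sucᵇ (traversalᵇ +ᵇ traversalᵇ) +ᵇ (sucᵇ (idᵇ +ᵇ sucᵇ idᵇ) +ᵇ letrecCostᵇ))))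

decompCostᵇ : PolynomiallyBounded (λ B → Costs.decompCost B B)
decompCostᵇ = sucᵇ (idᵇ *ᵇ sucᵇ (constᵇ 22 +ᵇ (stepCostᵇ +ᵇ (sucᵇ idᵇ +ᵇ traversalᵇ))))

mainCostᵇ : PolynomiallyBounded Costs.mainCost
mainCostᵇ = decompCostᵇ +ᵇ sucᵇ (idᵇ *ᵇ sucᵇ (sucᵇ (idᵇ *ᵇ sucᵇ idᵇ) +ᵇ decompCostᵇ))

-- Sizes of encoded problems

module EncodingSize (S : Signature) (N : Matching.Naming S) (B : ℕ) where
  open StepSpecifications S N B

  private variable
    n : ℕ
    V : Set

  left≤ : ∀ l r → ∣ l ∣ᵗ ≤ ∣ l ∙ r ∣ᵗ
  left≤ l r = m≤n⇒m≤1+n (m≤m+n ∣ l ∣ᵗ ∣ r ∣ᵗ)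

  right≤ : ∀ l r → ∣ r ∣ᵗ ≤ ∣ l ∙ r ∣ᵗ
  right≤ l r = m≤n⇒m≤1+n (m≤n+m ∣ r ∣ᵗ ∣ l ∣ᵗ)

  swappings-size : ∀ π → 2 * length π ≤ ∣ swappings π ∣ᵗ
  swappings-size []      = z≤n
  swappings-size (p ∷ π) = ≤-trans (≤-reflexive (ℕ.*-suc 2 (length π)))
    (s≤s (s≤s (≤-trans (swappings-size π) (m≤n+m _ _))))

  mutual
    -- The constants in the clauses discard nodes of the tag and of the pairs around the payload.
    size≤encoding : ∀ (nm : V → Tree) e → ∣ e ∣ ≤ ∣ exp nm e ∣ᵗ
    size≤encoding nm (atom a) = s≤s z≤n
    size≤encoding nm (lam a e) = s≤s (s≤s (≤-trans (size≤encoding nm e) (ℕ.m≤n⇒m≤o+n 3 (m≤n+m _ _))))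
    size≤encoding nm (app f es) = s≤s (≤-trans (sizes≤encoding nm es) (ℕ.m≤n⇒m≤o+n 6 (m≤n+m _ _)))
    size≤encoding nm (letrec {n} as u es e) = s≤s (≤-trans (≤-reflexive (sym (ℕ.+-assoc n ∣ es ∣* ∣ e ∣)))
      (ℕ.m≤n⇒m≤o+n 8 (+-mono-≤ (bindings≤encoding nm as es) (size≤encoding nm e))))
    size≤encoding nm (var X) = s≤s z≤n
    size≤encoding nm (susp π X) = s≤s (s≤s (≤-trans (swappings-size π) (ℕ.m≤n⇒m≤o+n 11 (m≤m+n _ _))))

    sizes≤encoding : ∀ (nm : V → Tree) (es : Vec (Exp V) n) → ∣ es ∣* ≤ ∣ exps nm es ∣ᵗ
    sizes≤encoding nm []       = z≤n
    sizes≤encoding nm (e ∷ es) = m≤n⇒m≤1+n (+-mono-≤ (size≤encoding nm e) (sizes≤encoding nm es))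

    bindings≤encoding : ∀ (nm : V → Tree) (as : Vec Atom n) (es : Vec (Exp V) n) → n + ∣ es ∣* ≤ ∣ bindings nm as es ∣ᵗ
    bindings≤encoding nm []       []       = z≤n
    bindings≤encoding {n = suc n} nm (a ∷ as) (e ∷ es) = s≤s (≤-trans (≤-reflexive (swap-sum n ∣ e ∣ ∣ es ∣*))
      (+-mono-≤ (≤-trans (size≤encoding nm e) (m≤n⇒m≤1+n (m≤n+m _ _))) (bindings≤encoding nm as es)))
      where
      swap-sum : ∀ x y z → x + (y + z) ≡ y + (x + z)
      swap-sum = solve-∀

  swappings-small : ∀ π → ∣ swappings π ∣ᵗ ≤ B → SmallPerm π
  swappings-small []            _    = []
  swappings-small ((a , b) ∷ π) size =
    (≤-trans (left≤ (nameₐ a) (nameₐ b)) swap≤ , ≤-trans (right≤ (nameₐ a) (nameₐ b)) swap≤) ∷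
    swappings-small π (≤-trans (right≤ (nameₐ a ∙ nameₐ b) (swappings π)) size)
    where
    swap≤ : ∣ nameₐ a ∙ nameₐ b ∣ᵗ ≤ B
    swap≤ = ≤-trans (left≤ (nameₐ a ∙ nameₐ b) (swappings π)) size

  mutual
    encoding-small : ∀ {nm : V → Tree} {Q : V → Set} → (∀ X → ∣ nm X ∣ᵗ ≤ B → Q X) → ∀ e → ∣ exp nm e ∣ᵗ ≤ B → Small Q e
    encoding-small h (atom a) size = ≤-trans (right≤ leaf _) size
    encoding-small {nm = nm} h (lam a e) size = ≤-trans (left≤ (nameₐ a) (exp nm e)) payload , encoding-small h e (≤-trans (right≤ (nameₐ a) _) payload)
      where
      payload = ≤-trans (right≤ (leaf ∙ leaf) (nameₐ a ∙ exp nm e)) size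
    encoding-small {nm = nm} h (app f es) size = ≤-trans (left≤ (namef f) (exps nm es)) payload , encodings-small h es (≤-trans (right≤ (namef f) _) payload)
      where
      payload = ≤-trans (right≤ (leaf ∙ leaf ∙ leaf) (namef f ∙ exps nm es)) size
    encoding-small {nm = nm} h (letrec as _ es e) size =
      let as≤ , es≤ = bindings-small h as es (≤-trans (left≤ (bindings nm as es) (exp nm e)) payload) in
      as≤ , es≤ , encoding-small h e (≤-trans (right≤ (bindings nm as es) _) payload)
      where
      payload = ≤-trans (right≤ (leaf ∙ leaf ∙ leaf ∙ leaf) (bindings nm as es ∙ exp nm e)) size
    encoding-small h (var X) size = h X (≤-trans (right≤ (leaf ∙ leaf ∙ leaf ∙ leaf ∙ leaf) _) size)
    encoding-small {nm = nm} h (susp π X) size =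
      swappings-small π (≤-trans (left≤ (swappings π) (nm X)) payload) , h X (≤-trans (right≤ (swappings π) (nm X)) payload)
      where
      payload = ≤-trans (right≤ (leaf ∙ leaf ∙ leaf ∙ leaf ∙ leaf ∙ leaf) (swappings π ∙ nm X)) size

    encodings-small : ∀ {nm : V → Tree} {Q : V → Set} → (∀ X → ∣ nm X ∣ᵗ ≤ B → Q X) →
                      ∀ (es : Vec (Exp V) n) → ∣ exps nm es ∣ᵗ ≤ B → Small* Q es
    encodings-small h []       _    = tt
    encodings-small {nm = nm} h (e ∷ es) size =
      encoding-small h e (≤-trans (left≤ (exp nm e) (exps nm es)) size) ,
      encodings-small h es (≤-trans (right≤ (exp nm e) (exps nm es)) size)

    bindings-small : ∀ {nm : V → Tree} {Q : V → Set} → (∀ X → ∣ nm X ∣ᵗ ≤ B → Q X) → ∀ (as : Vec Atom n) (es : Vec (Exp V) n) →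
                     ∣ bindings nm as es ∣ᵗ ≤ B → Allᵥ.All Smallₐ as × Small* Q es
    bindings-small h []       []       _ = Allᵥ.[] , tt
    bindings-small {nm = nm} h (a ∷ as) (e ∷ es) size =
      let as≤ , es≤ = bindings-small h as es (≤-trans (right≤ (nameₐ a ∙ exp nm e) (bindings nm as es)) size) in
      (≤-trans (left≤ (nameₐ a) (exp nm e)) binding Allᵥ.∷ as≤) ,
      encoding-small h e (≤-trans (right≤ (nameₐ a) (exp nm e)) binding) , es≤
      where
      binding = ≤-trans (left≤ (nameₐ a ∙ exp nm e) (bindings nm as es)) size

  -- All names and expressions of Γ are encoded by subtrees of its code, so the input size can serve
  -- as B.
  problem-small : ∀ Γ → ∣ problem Γ ∣ᵗ ≤ B → All SmallEq Γ
  problem-small []            _    = []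
  problem-small ((s ⊴ t) ∷ Γ) size =
    ((encoding-small (λ _ X≤ → X≤) s s≤ , ≤-trans (size≤encoding nameᵥ s) s≤) ,
     (encoding-small (λ ()) t t≤ , ≤-trans (size≤encoding ⊥-elim t) t≤)) ∷
    problem-small Γ (≤-trans (right≤ (exp nameᵥ s ∙ ground t) (problem Γ)) size)
    where
    equation : ∣ exp nameᵥ s ∙ ground t ∣ᵗ ≤ B
    equation = ≤-trans (left≤ (exp nameᵥ s ∙ ground t) (problem Γ)) size
    s≤ : ∣ exp nameᵥ s ∣ᵗ ≤ B
    s≤ = ≤-trans (left≤ (exp nameᵥ s) (ground t)) equation
    t≤ : ∣ ground t ∣ᵗ ≤ B
    t≤ = ≤-trans (right≤ (exp nameᵥ s) (ground t)) equation

  lhsSize≤encoding : ∀ Γ → lhsSize Γ ≤ ∣ problem Γ ∣ᵗ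
  lhsSize≤encoding []            = z≤n
  lhsSize≤encoding ((s ⊴ t) ∷ Γ) = m≤n⇒m≤1+n (+-mono-≤
    (≤-trans (size≤encoding _ s) (left≤ (exp _ s) (ground t))) (lhsSize≤encoding Γ))

-- Decision in nondeterministic polynomial time

module Complexity (S : Signature) where
  open Reachability S
  open LetrecMatch
  open MachineLogic program

  timeᵇ : PolynomiallyBounded (λ B → weight mainBody + callCost * Costs.mainCost B)
  timeᵇ = constᵇ (weight mainBody) +ᵇ constᵇ callCost *ᵇ mainCostᵇ

  decides-matching : ∀ N → DecidesMatching program (polynomial timeᵇ) N
  decides-matching N Γ =
    (λ run → ≤-trans (must-runs-within main-run run) (below timeᵇ size)) ,
    (λ w → must-final main-run) ,
    mk⇔ (λ (σ , run) → sound (must-final main-run run)) (λ (τ , ms) → let σ , may = main-may {τ} Γ small-lhs small ms in σ , may [])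
    where
    open Matching.Encoding S N
    size : ℕ
    size = ∣ problem Γ ∣ᵗ
    -- Here B becomes the size of the input. It occurs only in the specifications, so one program
    -- serves all inputs and all namings.
    open Decision S N size using (main-must; main-may)
    open EncodingSize S N size using (problem-small; lhsSize≤encoding)
    small = problem-small Γ ≤-refl
    small-lhs = lhsSize≤encoding Γ
    main-run = main-must Γ small-lhs small
    -- The final tree encodes some output τ, and τ rather than σ is exhibited as the matcher, which
    -- avoids inverting the encoding.
    sound : ∀ {σ} → success σ ≡ failure ⊎ (∃[ τ ] success σ ≡ success τ × Output Γ τ) → ∃[ τ ] Matcher Γ τ
    sound (inj₂ (τ , _ , out)) = τ , output-sound Γ τ out

  decides-in-NP : DecidesInNP
  decides-in-NP = polynomial-runs , program , polynomial timeᵇ , decides-matching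

theorem6p4 : (S : Signature) → let open Matching S in
    Sound × Complete × DecidesInNP × CollectsAll
theorem6p4 S = Rules.output-sound S , Runs.complete S , Complexity.decides-in-NP S , Runs.collects-all S
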